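{- Let $\Delta_3(n)$ denote the number of broken $3$-diamond partitions of $n$, so that $\sum_{n=0}^{\infty}\Delta_3(n)q^n=\prod_{n=1}^{\infty}\frac{(1-q^{2n})(1-q^{7n})}{(1-q^n)^3(1-q^{14n})}$. Then, as formal power series in $q$ with integer coefficients, $$\prod_{n=1}^\infty(1-q^n)^4(1-q^{2n})^6 \equiv 6\sum_{n=0}^\infty \Delta_3(7n+5)q^n \pmod{7}.$$
   Context: For a positive integer $k$, $\Delta_k(n)$ denotes the number of broken $k$-diamond partitions of $n$ (Andrews and Paule). These numbers are integers determined by the generating function identity $$\sum_{n=0}^{\infty}\Delta_k(n)q^n=\prod_{n=1}^{\infty}\frac{(1-q^{2n})(1-q^{(2k+1)n})}{(1-q^n)^3(1-q^{(4k+2)n})},$$ which may be taken as the definition of $\Delta_k(n)$. For power series $f,g\in\mathbb{Z}[[q]]$ and a positive integer $M$, $f\equiv g \pmod M$ means that for every $n\ge 0$ the coefficients of $q^n$ in $f$ and $g$ are congruent modulo $M$. -}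

module Defs where

open import Data.Bool using (if_then_else_)
open import Data.Fin using (Fin; zero; suc; toℕ)
open import Data.Integer as ℤ using (ℤ; +_; 0ℤ; 1ℤ)
import Data.Integer.Properties as ℤ
open import Data.Integer.Divisibility.Signed using (_∣_)
open import Data.Integer.Tactic.RingSolver using (solve-∀)
open import Data.Nat as ℕ using (ℕ; zero; suc; _∸_; _<_; _≤_; _≡ᵇ_; _≤ᵇ_; z≤n; s≤s; NonZero)
import Data.Nat.Divisibility as ℕ
import Data.Nat.Properties as ℕ
open import Function using (_∘_)
open import Relation.Binary.PropositionalEquality
open import Relation.Nullary using (yes; no; does; contradiction)
open import Relation.Nullary.Decidable using (dec-true; dec-false)

open import Algebra.Bundles using (module AbelianGroup)
open import Algebra.Properties.Group (AbelianGroup.group ℤ.+-0-abelianGroup) using (∙-cancelʳ)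
open import Algebra.Properties.CommutativeMonoid.Sum ℤ.+-0-commutativeMonoid public
  using (sum; sum-syntax; sum⁺-syntax; sum-cong-≗; sum-replicate-zero; ∑-distrib-+)

infix  9 1-q^_ 1/⟨1-q^_⟩ q^_
infixr 8 _^_
infixl 7 _*_ _·_
infix  4 _≡_[mod_]

-- The series Σₙ f(n) qⁿ is represented by its coefficient function f.
PowerSeries : Set
PowerSeries = ℕ → ℤ

q^_ : ℕ → PowerSeries
(q^ d) m = if d ≡ᵇ m then 1ℤ else 0ℤ

one : PowerSeries
one = q^ 0

1-q^_ : ℕ → PowerSeries
(1-q^ d) m = one m ℤ.- (q^ d) m

-- `∑[ i ≤ m ]` ranges over i : Fin (suc m).
_*_ : PowerSeries → PowerSeries → PowerSeries
(f * g) m = ∑[ i ≤ m ] (f (toℕ i) ℤ.* g (m ∸ toℕ i))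

_^_ : PowerSeries → ℕ → PowerSeries
f ^ zero  = one
f ^ suc e = f * f ^ e

_·_ : ℤ → PowerSeries → PowerSeries
(c · f) m = c ℤ.* f m

-- The geometric series 1 + qᵈ + q²ᵈ + …, inverse to 1 - qᵈ for d ≥ 1
-- (see `1/⟨1-q^⟩-inverse`); only used with d ≥ 1.
1/⟨1-q^_⟩ : ℕ → PowerSeries
1/⟨1-q^ d ⟩ m = if does (d ℕ.∣? m) then 1ℤ else 0ℤ

-- f 1 * f 2 * … * f N; the value f 0 is never used.
∏≤ : ℕ → (ℕ → PowerSeries) → PowerSeries
∏≤ zero    f = one
∏≤ (suc N) f = ∏≤ N f * f (suc N)

-- The infinite product f 1 * f 2 * f 3 * ….  When f n ≡ 1 modulo qⁿ for all
-- n ≥ 1, the coefficient of qᵐ in the partial products is constant from the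
-- m-th one on (see `∏-limit`), so this is the q-adic limit.
∏ : (ℕ → PowerSeries) → PowerSeries
∏ f m = ∏≤ m f m

_≡_[mod_] : PowerSeries → PowerSeries → ℕ → Set
f ≡ g [mod M ] = ∀ n → + M ∣ (f n ℤ.- g n)

Δ-factor : ℕ → ℕ → PowerSeries
Δ-factor k n =
  1-q^ (2 ℕ.* n) * 1-q^ ((2 ℕ.* k ℕ.+ 1) ℕ.* n)
    * (1/⟨1-q^ n ⟩ ^ 3 * 1/⟨1-q^ (4 ℕ.* k ℕ.+ 2) ℕ.* n ⟩)

-- Δ k n is the number of broken k-diamond partitions of n (k ≥ 1), defined by
-- its generating function.
Δ : ℕ → ℕ → ℤ
Δ k = ∏ (Δ-factor k)

sum-zero : ∀ {n} (t : Fin n → ℤ) → (∀ i → t i ≡ 0ℤ) → sum t ≡ 0ℤ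
sum-zero {n} t eq = trans (sum-cong-≗ eq) (sum-replicate-zero n)

q^-* : ∀ d g m → (q^ d * g) m ≡ (if d ≤ᵇ m then g (m ∸ d) else 0ℤ)
q^-* zero g m = trans
  (cong₂ ℤ._+_ (ℤ.*-identityˡ (g m)) (sum-zero {m} _ λ _ → refl))
  (ℤ.+-identityʳ (g m))
q^-* (suc d) g zero = refl
q^-* (suc d) g (suc m) = trans (ℤ.+-identityˡ _) (trans (q^-* d g m) (shift d))
  where
  shift : ∀ d → (if d ≤ᵇ m then g (m ∸ d) else 0ℤ) ≡
                (if suc d ≤ᵇ suc m then g (m ∸ d) else 0ℤ)
  shift zero    = refl
  shift (suc d) = refl

1-q^-* : ∀ d g m → (1-q^ d * g) m ℤ.+ (q^ d * g) m ≡ g m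
1-q^-* d g m = trans (sym (∑-distrib-+ {suc m}
  (λ i → (1-q^ d) (toℕ i) ℤ.* g (m ∸ toℕ i)) (λ i → (q^ d) (toℕ i) ℤ.* g (m ∸ toℕ i))))
  (trans (sum-cong-≗ {suc m} λ i → lem (one (toℕ i)) ((q^ d) (toℕ i)) (g (m ∸ toℕ i)))
         (q^-* 0 g m))
  where
  lem : ∀ a b c → (a ℤ.- b) ℤ.* c ℤ.+ b ℤ.* c ≡ a ℤ.* c
  lem = solve-∀

*-oneʳ : ∀ f m → (f * one) m ≡ f m
*-oneʳ f zero    = trans (ℤ.+-identityʳ _) (ℤ.*-identityʳ (f 0))
*-oneʳ f (suc m) = trans (cong₂ ℤ._+_ (ℤ.*-zeroʳ (f 0)) (*-oneʳ (f ∘ suc) m))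
                              (ℤ.+-identityˡ _)

geometric-step : ∀ d .{{_ : NonZero d}} m →
  1/⟨1-q^ d ⟩ m ≡ one m ℤ.+ (q^ d * 1/⟨1-q^ d ⟩) m
geometric-step d m rewrite q^-* d 1/⟨1-q^ d ⟩ m with d ℕ.≤? m
geometric-step d@(suc _) zero | yes ()
geometric-step d@(suc _) zero | no _ rewrite dec-true (d ℕ.∣? 0) (d ℕ.∣0) = refl
geometric-step d m@(suc _) | no d≰m
  rewrite dec-false (d ℕ.∣? m) (d≰m ∘ ℕ.∣⇒≤)
        | dec-false (d ℕ.≤? m) d≰m = refl
geometric-step d m@(suc _) | yes d≤m
  rewrite dec-true (d ℕ.≤? m) d≤m with d ℕ.∣? (m ∸ d)
... | yes p rewrite dec-true (d ℕ.∣? m) (ℕ.∣m∸n∣n⇒∣m d d≤m p ℕ.∣-refl) = refl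
... | no ¬p rewrite dec-false (d ℕ.∣? m) (λ p → ¬p (ℕ.∣m+n∣m⇒∣n (subst (d ℕ.∣_) (sym (ℕ.m+[n∸m]≡n d≤m)) p) ℕ.∣-refl)) = refl

1/⟨1-q^⟩-inverse : ∀ d .{{_ : NonZero d}} m → (1-q^ d * 1/⟨1-q^ d ⟩) m ≡ one m
1/⟨1-q^⟩-inverse d m = ∙-cancelʳ ((q^ d * 1/⟨1-q^ d ⟩) m) _ _
  (trans (1-q^-* d 1/⟨1-q^ d ⟩ m) (geometric-step d m))

-- f ≡ 1 modulo qⁿ
OneBelow : ℕ → PowerSeries → Set
OneBelow n f = ∀ m → m < n → f m ≡ one m

*-stable : ∀ {n} p {f} → OneBelow n f → ∀ m → m < n → (p * f) m ≡ p m
*-stable p {f} f≡1 m m<n = trans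
  (sum-cong-≗ {suc m} λ i → cong (p (toℕ i) ℤ.*_)
    (f≡1 (m ∸ toℕ i) (ℕ.≤-<-trans (ℕ.m∸n≤m m (toℕ i)) m<n)))
  (*-oneʳ p m)

*-oneBelow : ∀ {n f g} → OneBelow n f → OneBelow n g → OneBelow n (f * g)
*-oneBelow {f = f} f≡1 g≡1 m m<n = trans (*-stable f g≡1 m m<n) (f≡1 m m<n)

^-oneBelow : ∀ {n f} e → OneBelow n f → OneBelow n (f ^ e)
^-oneBelow zero    f≡1 m m<n = refl
^-oneBelow (suc e) f≡1 = *-oneBelow f≡1 (^-oneBelow e f≡1)

1-q^-oneBelow : ∀ {n} d → n ≤ d → OneBelow n (1-q^ d)
1-q^-oneBelow d n≤d m m<n
  rewrite dec-false (d ℕ.≟ m) (ℕ.>⇒≢ (ℕ.<-≤-trans m<n n≤d)) = ℤ.+-identityʳ (one m)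

1/⟨1-q^⟩-oneBelow : ∀ {n} d → n ≤ d → OneBelow n 1/⟨1-q^ d ⟩
1/⟨1-q^⟩-oneBelow d n≤d zero m<n rewrite dec-true (d ℕ.∣? 0) (d ℕ.∣0) = refl
1/⟨1-q^⟩-oneBelow d n≤d m@(suc _) m<n
  rewrite dec-false (d ℕ.∣? m) (ℕ.>⇒∤ (ℕ.<-≤-trans m<n n≤d)) = refl

∏-limit : ∀ f → (∀ n → OneBelow (suc n) (f (suc n))) →
          ∀ m N → m ≤ N → ∏≤ N f m ≡ ∏ f m
∏-limit f f≡1 m N m≤N = subst (λ N → ∏≤ N f m ≡ ∏ f m) (ℕ.m∸n+n≡m m≤N) (go (N ∸ m))
  where
  go : ∀ j → ∏≤ (j ℕ.+ m) f m ≡ ∏ f m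
  go zero    = refl
  go (suc j) = trans (*-stable (∏≤ (j ℕ.+ m) f) (f≡1 (j ℕ.+ m)) m (s≤s (ℕ.m≤n+m m j))) (go j)

Δ-limit : ∀ k m N → m ≤ N → ∏≤ N (Δ-factor k) m ≡ Δ k m
Δ-limit k = ∏-limit (Δ-factor k) λ n → let N = suc n in
  *-oneBelow
    (*-oneBelow (1-q^-oneBelow (2 ℕ.* N) (ℕ.m≤n*m N 2))
                (1-q^-oneBelow _ (below (2 ℕ.* k) 1 N)))
    (*-oneBelow (^-oneBelow 3 (1/⟨1-q^⟩-oneBelow N ℕ.≤-refl))
                (1/⟨1-q^⟩-oneBelow _ (below (4 ℕ.* k) 2 N)))
  where
  below : ∀ a b N .{{_ : NonZero b}} → N ≤ (a ℕ.+ b) ℕ.* N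
  below a b@(suc _) N = ℕ.≤-trans (ℕ.m≤n*m N b) (ℕ.*-monoˡ-≤ N (ℕ.m≤n+m b a))

product-limit : ∀ a b → let f = λ n → (1-q^ n) ^ a * (1-q^ (2 ℕ.* n)) ^ b in
                     ∀ m N → m ≤ N → ∏≤ N f m ≡ ∏ f m
product-limit a b = ∏-limit (λ n → (1-q^ n) ^ a * (1-q^ (2 ℕ.* n)) ^ b) λ n → let N = suc n in
  *-oneBelow (^-oneBelow a (1-q^-oneBelow N ℕ.≤-refl))
             (^-oneBelow b (1-q^-oneBelow (2 ℕ.* N) (ℕ.m≤n*m N 2)))

{-# OPTIONS --safe #-}
module Submission where

-- Write E_d = ∏ (1 − qᵈⁿ) and D = q d/dq. Modulo 7 we have E_7d ≡ E_d⁷, so that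
-- ∑ Δ₃(n) qⁿ ≡ E₁⁴ E₂ / E₂(q⁷), and D kills seventh powers. Put F = q^(1/4) E₁⁴ E₂. As
-- D⁶ is the projection away from the exponents divisible by 7, the theorem amounts to
-- D⁶F ≡ F (1 + q⁵ E₁²⁴ E₂⁴⁸). The expansions of η = q^(1/24) E₁ (Euler), η³ (Jacobi)
-- and φ = E₁²/E₂ (Gauss) as theta series ∑ ± nᵉ q^(c n²) and n⁷ ≡ n turn into
--   D³η ≡ − η − η⁴⁹,   D³(η³) ≡ η³,   D³φ ≡ φ − φ⁴⁹,
-- and likewise with q² for q. In terms of logarithmic derivatives, the first two give a
-- series Q with D log η ≡ 5 Q², D Q ≡ 5 (Q³ − 1) and η⁴⁸ ≡ (1 − Q³)²; let T be its
-- analogue for q². The third one forces (Q + T)(Q − T)² ≡ 3, a rational curve. On it the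
-- statement about D⁶F is an identity between polynomials over 𝔽₇ in one parameter.

open import Algebra.Bundles using (CommutativeRing; RawRing)
import Algebra.Properties.CommutativeMonoid.Sum
import Algebra.Properties.Semiring.Exp
import Algebra.Properties.Semiring.Mult.TCOptimised
import Algebra.Solver.Ring
open import Algebra.Solver.Ring.AlmostCommutativeRing using (fromCommutativeRing; _-Raw-AlmostCommutative⟶_)
open import Data.Bool using (if_then_else_)
open import Data.Fin using (Fin; zero; suc; toℕ; #_)
import Data.Integer as ℤ
import Data.Integer.Properties as ℤ
open import Data.Maybe using (Maybe; just; nothing)
open import Data.Nat as ℕ using (ℕ; zero; suc; _∸_; _≤_; _<_; _≡ᵇ_; z≤n; s≤s; NonZero)
import Data.Nat.DivMod as ℕ
import Data.Nat.Properties as ℕ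
import Data.Nat.Tactic.RingSolver as ℕ
open import Data.Product using (_,_)
open import Data.Sum using (inj₁; inj₂)
open import Data.Vec using (Vec; []; _∷_; lookup)
open import Function using (_∘_)
open import Level using (0ℓ)
import Relation.Binary.PropositionalEquality as ≡
open import Relation.Nullary using (yes; no)
open import Relation.Nullary.Decidable using (toWitness; dec-true; dec-false)

-- Three theta series carry the proof because D³ fits them: it multiplies n^e q^(c n²) by c³ n⁶.
-- Fermat's theorem gives the term back unless 7 divides n, and the terms with 7 | n form a series
-- of the same kind in q⁴⁹, a seventh power and hence a constant for D. In the language of modular
-- forms Q is E₄ and T is 4 E₄(q²) modulo 7, where E₆ ≡ 1, E₂ ≡ E₄² and Δ ≡ 1 - E₄³. Relations of
-- this sort are usually verified by a bound on the number of coefficients to compare. Here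
-- everything stays with formal power series, so the relations are derived from the differential
-- equations, and wherever a factor has to be cancelled or a square root chosen, two computed
-- coefficients decide. Fractional powers of q never appear: conjugation by them is built into the
-- derivation, and 1/4 ≡ 2 singles out the exponents 7n + 5.

Characteristic7 : CommutativeRing 0ℓ 0ℓ → Set
Characteristic7 R = 7 × 1# ≈ 0#
  where
  open CommutativeRing R
  open Algebra.Properties.Semiring.Mult.TCOptimised semiring

-- Polynomial identities in characteristic 7

module Char7 (R : CommutativeRing 0ℓ 0ℓ) (char7 : Characteristic7 R) where

  open CommutativeRing R hiding (zero)
  open Algebra.Properties.Semiring.Mult.TCOptimised semiring
  open import Relation.Binary.Reasoning.Setoid setoid
  open Algebra.Properties.Semiring.Exp semiring using (_^_; ^-congˡ; ^-homo-*)

  ι : ℕ → Carrier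
  ι n = n × 1#

  ι-+ : ∀ m n → ι (m ℕ.+ n) ≈ ι m + ι n
  ι-+ = ×-homo-+ 1#

  ι-* : ∀ m n → ι (m ℕ.* n) ≈ ι m * ι n
  ι-* = ×1-homo-*

  ι-*7 : ∀ k → ι (k ℕ.* 7) ≈ 0#
  ι-*7 k = begin
    ι (k ℕ.* 7) ≈⟨ ι-* k 7 ⟩
    ι k * ι 7   ≈⟨ *-congˡ char7 ⟩
    ι k * 0#    ≈⟨ zeroʳ _ ⟩
    0#          ∎

  ι-% : ∀ n → ι (n ℕ.% 7) ≈ ι n
  ι-% n = begin
    ι (n ℕ.% 7)                       ≈⟨ +-identityʳ _ ⟨
    ι (n ℕ.% 7) + 0#                  ≈⟨ +-congˡ (ι-*7 (n ℕ./ 7)) ⟨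
    ι (n ℕ.% 7) + ι (n ℕ./ 7 ℕ.* 7)   ≈⟨ ι-+ (n ℕ.% 7) _ ⟨
    ι (n ℕ.% 7 ℕ.+ n ℕ./ 7 ℕ.* 7)     ≡⟨ ≡.cong ι (ℕ.m≡m%n+[m/n]*n n 7) ⟨
    ι n                               ∎

  private
    -- Residues modulo 7, with 6m for -m, are the coefficients over which the solver normalises. It
    -- thus proves identities that hold only in characteristic 7, and as coefficients are compared
    -- as residues, `R` itself needs no decidable equality.
    rawℤ/7 : RawRing 0ℓ 0ℓ
    rawℤ/7 = record
      { Carrier = ℕ
      ; _≈_ = ≡._≡_
      ; _+_ = λ m n → (m ℕ.+ n) ℕ.% 7
      ; _*_ = λ m n → (m ℕ.* n) ℕ.% 7
      ; -_ = λ m → (6 ℕ.* m) ℕ.% 7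
      ; 0# = 0
      ; 1# = 1
      }

    ι-neg : ∀ m → ι ((6 ℕ.* m) ℕ.% 7) ≈ - ι m
    ι-neg m = begin
      ι ((6 ℕ.* m) ℕ.% 7)         ≈⟨ ι-% (6 ℕ.* m) ⟩
      ι (6 ℕ.* m)                 ≈⟨ +-identityˡ _ ⟨
      0# + ι (6 ℕ.* m)            ≈⟨ +-congʳ (-‿inverseˡ (ι m)) ⟨
      (- ι m + ι m) + ι (6 ℕ.* m) ≈⟨ +-assoc _ _ _ ⟩
      - ι m + (ι m + ι (6 ℕ.* m)) ≈⟨ +-congˡ (ι-+ m (6 ℕ.* m)) ⟨
      - ι m + ι (7 ℕ.* m)         ≡⟨ ≡.cong (λ n → - ι m + ι n) (ℕ.*-comm 7 m) ⟩
      - ι m + ι (m ℕ.* 7)         ≈⟨ +-congˡ (ι-*7 m) ⟩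
      - ι m + 0#                  ≈⟨ +-identityʳ _ ⟩
      - ι m                       ∎

    morphism : rawℤ/7 -Raw-AlmostCommutative⟶ fromCommutativeRing R
    morphism = record
      { ⟦_⟧ = ι
      ; +-homo = λ m n → trans (ι-% (m ℕ.+ n)) (ι-+ m n)
      ; *-homo = λ m n → trans (ι-% (m ℕ.* n)) (ι-* m n)
      ; -‿homo = ι-neg
      ; 0-homo = refl
      ; 1-homo = refl
      }

    ι≟ : ∀ m n → Maybe (ι m ≈ ι n)
    ι≟ m n with m ℕ.≟ n
    ... | yes m≡n = just (reflexive (≡.cong ι m≡n))
    ... | no _    = nothing

  open Algebra.Solver.Ring rawℤ/7 (fromCommutativeRing R) morphism ι≟ public
    using (solve; prove; ⟦_⟧; Polynomial; op; [+]; [*]; var; _:=_; _:+_; _:*_; _:-_; :-_; _:^_; con)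

  frobenius : ∀ x → (ι 1 - x) ^ 7 ≈ ι 1 - x ^ 7
  frobenius = solve 1 (λ x → (con 1 :- x) :^ 7 := con 1 :- x :^ 7) refl

  ι-suc : ∀ n → ι (suc n) ≈ ι 1 + ι n
  ι-suc n = 1+× n 1#

  -- Restricted to multiples of 1, as x⁷ = x may fail for other elements. What remains true in
  -- general, (1 + x)⁷ = 1 + x⁷, drives the induction.
  fermat : ∀ n → ι n ^ 7 ≈ ι n
  fermat zero    = solve 0 (con 0 :^ 7 := con 0) refl
  fermat (suc n) = begin
    ι (suc n) ^ 7       ≈⟨ ^-congˡ 7 (ι-suc n) ⟩
    (ι 1 + ι n) ^ 7     ≈⟨ solve 1 (λ x → (con 1 :+ x) :^ 7 := con 1 :+ x :^ 7) refl (ι n) ⟩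
    ι 1 + ι n ^ 7       ≈⟨ +-congˡ (fermat n) ⟩
    ι 1 + ι n           ≈⟨ ι-suc n ⟨
    ι (suc n)           ∎

-- Derivations and logarithmic derivatives

record IsDerivation (R : CommutativeRing 0ℓ 0ℓ)
  (D : CommutativeRing.Carrier R → CommutativeRing.Carrier R) : Set where
  open CommutativeRing R
  field
    D-cong : ∀ {x y} → x ≈ y → D x ≈ D y
    D-+    : ∀ x y → D (x + y) ≈ D x + D y
    D-*    : ∀ x y → D (x * y) ≈ D x * y + x * D y

module Derivation (R : CommutativeRing 0ℓ 0ℓ) (char7 : Characteristic7 R)
  (D : CommutativeRing.Carrier R → CommutativeRing.Carrier R) (isDerivation : IsDerivation R D) where

  open CommutativeRing R hiding (zero)
  open import Relation.Binary.Reasoning.Setoid setoid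
  open Algebra.Properties.Semiring.Exp semiring using (_^_; ^-congˡ)
  open Char7 R char7
  open IsDerivation isDerivation

  D-0 : D 0# ≈ 0#
  D-0 = begin
    D 0#                  ≈⟨ D-cong (zeroˡ 0#) ⟨
    D (0# * 0#)           ≈⟨ D-* 0# 0# ⟩
    D 0# * 0# + 0# * D 0# ≈⟨ solve 1 (λ x → x :* con 0 :+ con 0 :* x := con 0) refl (D 0#) ⟩
    0#                    ∎

  D-1 : D 1# ≈ 0#
  D-1 = begin
    D 1#                              ≈⟨ solve 1 (λ x → x := x :* con 1 :+ con 1 :* x :- x) refl (D 1#) ⟩
    (D 1# * 1# + 1# * D 1#) - D 1#    ≈⟨ +-congʳ (D-* 1# 1#) ⟨
    D (1# * 1#) - D 1#                ≈⟨ +-congʳ (D-cong (*-identityˡ 1#)) ⟩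
    D 1# - D 1#                       ≈⟨ -‿inverseʳ _ ⟩
    0#                                ∎

  D-ι : ∀ n → D (ι n) ≈ 0#
  D-ι zero    = D-0
  D-ι (suc n) = begin
    D (ι (suc n))   ≈⟨ D-cong (ι-suc n) ⟩
    D (1# + ι n)    ≈⟨ D-+ 1# (ι n) ⟩
    D 1# + D (ι n)  ≈⟨ +-cong D-1 (D-ι n) ⟩
    0# + 0#         ≈⟨ +-identityʳ 0# ⟩
    0#              ∎

  D-neg : ∀ x → D (- x) ≈ - D x
  D-neg x = begin
    D (- x)               ≈⟨ solve 2 (λ a b → a := (a :+ b) :- b) refl (D (- x)) (D x) ⟩
    (D (- x) + D x) - D x ≈⟨ +-congʳ (D-+ (- x) x) ⟨
    D (- x + x) - D x     ≈⟨ +-congʳ (trans (D-cong (-‿inverseˡ x)) D-0) ⟩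
    0# - D x              ≈⟨ +-identityˡ _ ⟩
    - D x                 ∎

  D-^ : ∀ x n → D (x ^ suc n) ≈ ι (suc n) * (x ^ n * D x)
  D-^ x zero = begin
    D (x * 1#)           ≈⟨ D-cong (*-identityʳ x) ⟩
    D x                  ≈⟨ solve 1 (λ a → a := con 1 :* (con 1 :* a)) refl (D x) ⟩
    ι 1 * (1# * D x)     ∎
  D-^ x (suc n) = begin
    D (x * x ^ suc n)                                     ≈⟨ D-* x (x ^ suc n) ⟩
    D x * x ^ suc n + x * D (x ^ suc n)                   ≈⟨ +-congˡ (*-congˡ (D-^ x n)) ⟩
    D x * (x * x ^ n) + x * (ι (suc n) * (x ^ n * D x))
      ≈⟨ solve 4 (λ x' x y k → x' :* (x :* y) :+ x :* (k :* (y :* x')) :=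
                               (con 1 :+ k) :* (x :* y :* x')) refl (D x) x (x ^ n) (ι (suc n)) ⟩
    (ι 1 + ι (suc n)) * (x ^ suc n * D x)                 ≈⟨ *-congʳ (ι-suc (suc n)) ⟨
    ι (suc (suc n)) * (x ^ suc n * D x)                   ∎

  D-^7 : ∀ x → D (x ^ 7) ≈ 0#
  D-^7 x = trans (D-^ x 6) (trans (*-congʳ char7) (zeroˡ _))

  D-inverse : ∀ {x y} → x * y ≈ 1# → D y ≈ - (y * y * D x)
  D-inverse {x} {y} xy≈1 = begin
    D y                                           ≈⟨ *-identityˡ _ ⟨
    1# * D y                                      ≈⟨ *-congʳ xy≈1 ⟨
    x * y * D y
      ≈⟨ solve 4 (λ x y x' y' → x :* y :* y' := y :* (x' :* y :+ x :* y') :- y :* y :* x') refl x y (D x) (D y) ⟩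
    y * (D x * y + x * D y) - y * y * D x         ≈⟨ +-congʳ (*-congˡ (D-* x y)) ⟨
    y * D (x * y) - y * y * D x                   ≈⟨ +-congʳ (*-congˡ (trans (D-cong xy≈1) D-1)) ⟩
    y * 0# - y * y * D x                          ≈⟨ +-congʳ (zeroʳ y) ⟩
    0# - y * y * D x                              ≈⟨ +-identityˡ _ ⟩
    - (y * y * D x)                               ∎

  -- Formal differentiation of solver expressions, with prescribed polynomials as derivatives of the
  -- variables. Once finitely many elements are known to generate a ring closed under `D`, this and
  -- `D-⟦⟧` turn claims about derivatives into polynomial identities that the solver decides.
  ∂ : ∀ {n} → (Fin n → Polynomial n) → Polynomial n → Polynomial n
  ∂ d (op [+] p q)  = ∂ d p :+ ∂ d q
  ∂ d (op [*] p q)  = ∂ d p :* q :+ p :* ∂ d q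
  ∂ d (con c)       = con 0
  ∂ d (var i)       = d i
  ∂ d (p :^ zero)   = con 0
  ∂ d (p :^ suc n)  = con (suc n) :* (p :^ n :* ∂ d p)
  ∂ d (:- p)        = :- ∂ d p

  D-⟦⟧ : ∀ {n} (d : Fin n → Polynomial n) ρ → (∀ i → D (lookup ρ i) ≈ ⟦ d i ⟧ ρ) →
         ∀ p → D (⟦ p ⟧ ρ) ≈ ⟦ ∂ d p ⟧ ρ
  D-⟦⟧ d ρ D-ρ (op [+] p q) = trans (D-+ _ _) (+-cong (D-⟦⟧ d ρ D-ρ p) (D-⟦⟧ d ρ D-ρ q))
  D-⟦⟧ d ρ D-ρ (op [*] p q) = trans (D-* _ _)
    (+-cong (*-congʳ (D-⟦⟧ d ρ D-ρ p)) (*-congˡ (D-⟦⟧ d ρ D-ρ q)))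
  D-⟦⟧ d ρ D-ρ (con c)      = D-ι c
  D-⟦⟧ d ρ D-ρ (var i)      = D-ρ i
  D-⟦⟧ d ρ D-ρ (p :^ zero)  = D-1
  D-⟦⟧ d ρ D-ρ (p :^ suc n) = trans (D-^ _ n) (*-congˡ (*-congˡ (D-⟦⟧ d ρ D-ρ p)))
  D-⟦⟧ d ρ D-ρ (:- p)       = trans (D-neg _) (-‿cong (D-⟦⟧ d ρ D-ρ p))

  -- Conjugating D by the fractional power qᶜ gives D + c, so twist c f is D applied
  -- to qᶜ f; modulo 7 the fraction c may be replaced by an integer.
  twist : Carrier → Carrier → Carrier
  twist c f = D f + c * f

  twist³ : Carrier → Carrier → Carrier
  twist³ c f = twist c (twist c (twist c f))

  twist-cong : ∀ c {f g} → f ≈ g → twist c f ≈ twist c g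
  twist-cong c f≈g = +-cong (D-cong f≈g) (*-congˡ f≈g)

  -- On multiples of an f with logarithmic derivative v, the twist acts on the cofactor as D + v,
  -- and c drops out. Iteration turns higher derivatives of f into differential polynomials in v.
  twist-* : ∀ {c v f} → twist c f ≈ v * f → ∀ g → twist c (g * f) ≈ (D g + v * g) * f
  twist-* {c} {v} {f} eq g = begin
    D (g * f) + c * (g * f)           ≈⟨ +-congʳ (D-* g f) ⟩
    D g * f + g * D f + c * (g * f)
      ≈⟨ solve 5 (λ g g' f f' c → g' :* f :+ g :* f' :+ c :* (g :* f) :=
                                  g' :* f :+ g :* (f' :+ c :* f)) refl g (D g) f (D f) c ⟩
    D g * f + g * twist c f           ≈⟨ +-congˡ (*-congˡ eq) ⟩
    D g * f + g * (v * f)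
      ≈⟨ solve 4 (λ g g' f v → g' :* f :+ g :* (v :* f) := (g' :+ v :* g) :* f) refl g (D g) f v ⟩
    (D g + v * g) * f                 ∎

  -- The third complete Bell polynomial: f‴/f in terms of v = f′/f.
  third : Carrier → Carrier
  third v = D (D v) + ι 3 * (v * D v) + v ^ 3

  twist³-eigen : ∀ {c v f} → twist c f ≈ v * f → twist³ c f ≈ third v * f
  twist³-eigen {c} {v} {f} eq = begin
    twist³ c f                                     ≈⟨ twist-cong c (twist-cong c eq) ⟩
    twist c (twist c (v * f))                      ≈⟨ twist-cong c (twist-* eq v) ⟩
    twist c ((D v + v * v) * f)                    ≈⟨ twist-* eq _ ⟩
    (D (D v + v * v) + v * (D v + v * v)) * f
      ≈⟨ *-congʳ (+-congʳ (trans (D-+ _ _) (+-congˡ (D-* v v)))) ⟩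
    (D (D v) + (D v * v + v * D v) + v * (D v + v * v)) * f
      ≈⟨ *-congʳ (solve 3 (λ v v' v'' → v'' :+ (v' :* v :+ v :* v') :+ v :* (v' :+ v :* v) :=
                                        v'' :+ con 3 :* (v :* v') :+ v :^ 3) refl v (D v) (D (D v))) ⟩
    third v * f                                    ∎

  *-cancelʳ-unit : ∀ {e i x y} → e * i ≈ 1# → x * e ≈ y * e → x ≈ y
  *-cancelʳ-unit {e} {i} {x} {y} ei≈1 eq = begin
    x           ≈⟨ *-identityʳ x ⟨
    x * 1#      ≈⟨ *-congˡ ei≈1 ⟨
    x * (e * i) ≈⟨ *-assoc x e i ⟨
    x * e * i   ≈⟨ *-congʳ eq ⟩
    y * e * i   ≈⟨ *-assoc y e i ⟩
    y * (e * i) ≈⟨ *-congˡ ei≈1 ⟩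
    y * 1#      ≈⟨ *-identityʳ y ⟩
    y           ∎

  -- Ramanujan's equations modulo 7 from the series for η and η³

  -- Applied to e = (qᵈ; qᵈ)_∞ and δ = d. Since 1/24 ≡ 5, u is the logarithmic
  -- derivative of qᵈᐟ²⁴ e, that is of η; r = q²ᵈ e⁴⁹, so that Z = q²ᵈ e⁴⁸ is Δ². The
  -- series Q is E₄ up to a constant factor, and D-Q is Ramanujan's equation modulo 7,
  -- where E₆ ≡ 1.
  module LogDerivative (δ e i r : Carrier) (D-δ : D δ ≈ 0#) (ei≈1 : e * i ≈ 1#) (D-r : D r ≈ ι 2 * (δ * r))
    (jacobi : twist³ δ (e ^ 3) ≈ e ^ 3)
    (euler : twist³ (ι 5 * δ) e ≈ - e - r)
    where

    u Q Z : Carrier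
    u = ι 5 * δ + D e * i
    Q = ι 2 * (u * u) - D u
    Z = r * i

    twist-e : twist (ι 5 * δ) e ≈ u * e
    twist-e = begin
      D e + ι 5 * δ * e                 ≈⟨ +-congʳ (trans (sym (*-identityʳ _)) (*-congˡ (sym ei≈1))) ⟩
      D e * (e * i) + ι 5 * δ * e
        ≈⟨ solve 4 (λ e' e i δ → e' :* (e :* i) :+ con 5 :* δ :* e := (con 5 :* δ :+ e' :* i) :* e) refl (D e) e i δ ⟩
      u * e                             ∎

    private
      De≈ : D e ≈ (u - ι 5 * δ) * e
      De≈ = begin
        D e                               ≈⟨ solve 2 (λ a b → a := (a :+ b) :- b) refl (D e) (ι 5 * δ * e) ⟩
        twist (ι 5 * δ) e - ι 5 * δ * e   ≈⟨ +-congʳ twist-e ⟩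
        u * e - ι 5 * δ * e               ≈⟨ solve 3 (λ u e d → u :* e :- d :* e := (u :- d) :* e) refl u e (ι 5 * δ) ⟩
        (u - ι 5 * δ) * e                 ∎

      twist-e³ : twist δ (e ^ 3) ≈ (ι 3 * u) * e ^ 3
      twist-e³ = begin
        D (e ^ 3) + δ * e ^ 3                       ≈⟨ +-congʳ (D-^ e 2) ⟩
        ι 3 * (e ^ 2 * D e) + δ * e ^ 3             ≈⟨ +-congʳ (*-congˡ (*-congˡ De≈)) ⟩
        ι 3 * (e ^ 2 * ((u - ι 5 * δ) * e)) + δ * e ^ 3
          ≈⟨ solve 3 (λ u e δ → con 3 :* (e :^ 2 :* ((u :- con 5 :* δ) :* e)) :+ δ :* e :^ 3 :=
                                (con 3 :* u) :* e :^ 3) refl u e δ ⟩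
        (ι 3 * u) * e ^ 3                           ∎

      e³i³≈1 : e ^ 3 * i ^ 3 ≈ 1#
      e³i³≈1 = begin
        e ^ 3 * i ^ 3   ≈⟨ solve 2 (λ e i → e :^ 3 :* i :^ 3 := (e :* i) :^ 3) refl e i ⟩
        (e * i) ^ 3     ≈⟨ ^-congˡ 3 ei≈1 ⟩
        1# ^ 3          ≈⟨ solve 0 (con 1 :^ 3 := con 1) refl ⟩
        1#              ∎

      D-3* : ∀ x → D (ι 3 * x) ≈ ι 3 * D x
      D-3* x = begin
        D (ι 3 * x)             ≈⟨ D-* (ι 3) x ⟩
        D (ι 3) * x + ι 3 * D x ≈⟨ +-congʳ (*-congʳ (D-ι 3)) ⟩
        0# * x + ι 3 * D x      ≈⟨ solve 2 (λ x y → con 0 :* x :+ y := y) refl x (ι 3 * D x) ⟩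
        ι 3 * D x               ∎

      third-3u : ι 3 * D (D u) + ι 3 * (ι 3 * u * (ι 3 * D u)) + (ι 3 * u) ^ 3 ≈ 1#
      third-3u = begin
        ι 3 * D (D u) + ι 3 * (ι 3 * u * (ι 3 * D u)) + (ι 3 * u) ^ 3
          ≈⟨ +-congʳ (+-cong (trans (D-cong (D-3* u)) (D-3* (D u))) (*-congˡ (*-congˡ (D-3* u)))) ⟨
        third (ι 3 * u)
          ≈⟨ *-cancelʳ-unit e³i³≈1 (trans (sym (twist³-eigen twist-e³)) (trans jacobi (sym (*-identityˡ _)))) ⟩
        1#              ∎

    -- The Jacobi equation, read through the logarithmic derivative 3u of η³ and solved for its
    -- leading term; 5 inverts 3.
    DDu : D (D u) ≈ ι 5 * (ι 1 + u * D u + u ^ 3)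
    DDu = begin
      D (D u)
        ≈⟨ solve 3 (λ u u' u'' → u'' := con 5 :* (con 3 :* u'' :+ con 3 :* (con 3 :* u :* (con 3 :* u')) :+ (con 3 :* u) :^ 3
                                                 :+ u :* u' :+ u :^ 3)) refl u (D u) (D (D u)) ⟩
      ι 5 * (ι 3 * D (D u) + ι 3 * (ι 3 * u * (ι 3 * D u)) + (ι 3 * u) ^ 3 + u * D u + u ^ 3)
        ≈⟨ *-congˡ (+-congʳ (+-congʳ third-3u)) ⟩
      ι 5 * (ι 1 + u * D u + u ^ 3) ∎

    private
      third-u : third u ≈ - 1# - Z
      third-u = *-cancelʳ-unit ei≈1 (begin
        third u * e              ≈⟨ twist³-eigen twist-e ⟨
        _                        ≈⟨ euler ⟩
        - e - r                  ≈⟨ +-congˡ (-‿cong (trans (*-congˡ ei≈1) (*-identityʳ r))) ⟨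
        - e - r * (e * i)        ≈⟨ solve 3 (λ e i r → :- e :- r :* (e :* i) := (:- con 1 :- r :* i) :* e) refl e i r ⟩
        (- 1# - Z) * e           ∎)

    -- The third-order equations for η and for η³ both contain D² u. Eliminating it leaves Z as a
    -- polynomial in u and D u.
    Z≈ : Z ≈ ι 1 - u * D u + u ^ 3
    Z≈ = begin
      Z                                             ≈⟨ solve 1 (λ z → z := :- con 1 :- (:- con 1 :- z)) refl Z ⟩
      - 1# - (- 1# - Z)                             ≈⟨ +-congˡ (-‿cong third-u) ⟨
      - 1# - third u                                ≈⟨ +-congˡ (-‿cong (+-congʳ (+-congʳ DDu))) ⟩
      - 1# - (ι 5 * (ι 1 + u * D u + u ^ 3) + ι 3 * (u * D u) + u ^ 3)
        ≈⟨ solve 2 (λ u u' → :- con 1 :- (con 5 :* (con 1 :+ u :* u' :+ u :^ 3) :+ con 3 :* (u :* u') :+ u :^ 3) :=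
                             con 1 :- u :* u' :+ u :^ 3) refl u (D u) ⟩
      ι 1 - u * D u + u ^ 3                         ∎

    private
      -- In the application Z is η⁴⁸, whose logarithmic derivative 48u is -u modulo 7.
      D-Z : D Z ≈ - (u * Z)
      D-Z = begin
        D (r * i)                                       ≈⟨ D-* r i ⟩
        D r * i + r * D i                               ≈⟨ +-cong (*-congʳ D-r) (*-congˡ (D-inverse ei≈1)) ⟩
        ι 2 * (δ * r) * i + r * - (i * i * D e)
          ≈⟨ solve 4 (λ δ r i e' → con 2 :* (δ :* r) :* i :+ r :* (:- (i :* i :* e')) :=
                                   :- ((con 5 :* δ :+ e' :* i) :* (r :* i))) refl δ r i (D e) ⟩
        - (u * Z)                                       ∎

      ρ : Vec Carrier 2
      ρ = u ∷ D u ∷ []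

      U U' : Polynomial 2
      U  = var zero
      U' = var (suc zero)

      d : Fin 2 → Polynomial 2
      d zero       = U'
      d (suc zero) = con 5 :* (con 1 :+ U :* U' :+ U :^ 3)

      D-ρ : ∀ i → D (lookup ρ i) ≈ ⟦ d i ⟧ ρ
      D-ρ zero       = refl
      D-ρ (suc zero) = DDu

      z q : Polynomial 2
      z = con 1 :- U :* U' :+ U :^ 3
      q = con 2 :* (U :* U) :- U'

      -- Compares D Z ≈ -uZ with the derivative of the polynomial for Z along the system `d`. This
      -- lowers the order of the equation for u from two to one.
      0≈ : ⟦ ∂ d z :+ U :* z ⟧ ρ ≈ 0#
      0≈ = begin
        ⟦ ∂ d z ⟧ ρ + u * ⟦ z ⟧ ρ   ≈⟨ +-cong (D-⟦⟧ d ρ D-ρ z) (*-congˡ Z≈) ⟨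
        D (⟦ z ⟧ ρ) + u * Z         ≈⟨ +-congʳ (D-cong Z≈) ⟨
        D Z + u * Z                 ≈⟨ +-congʳ D-Z ⟩
        - (u * Z) + u * Z           ≈⟨ -‿inverseˡ _ ⟩
        0#                          ∎

    -- The first-order relation is quadratic in D u. Completing the square, after doubling it and
    -- adding u, is what singles out Q = 2u² - D u. For modular forms and δ = 1 this is the
    -- congruence E₂ ≡ E₈ = E₄².
    u≈5Q² : u ≈ ι 5 * (Q * Q)
    u≈5Q² = begin
      u                                       ≈⟨ +-identityʳ u ⟨
      u + 0#                                  ≈⟨ +-congˡ (trans (*-congˡ 0≈) (zeroʳ (ι 2))) ⟨
      ⟦ U :+ con 2 :* (∂ d z :+ U :* z) ⟧ ρ   ≈⟨ prove ρ (U :+ con 2 :* (∂ d z :+ U :* z)) (con 5 :* (q :* q)) refl ⟩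
      ι 5 * (Q * Q)                           ∎

    D-Q : D Q ≈ ι 5 * (Q ^ 3 - ι 1)
    D-Q = begin
      D Q                                   ≈⟨ D-⟦⟧ d ρ D-ρ q ⟩
      ⟦ ∂ d q ⟧ ρ
        ≈⟨ prove ρ (∂ d q) (con 2 :+ con 6 :* (U :* U') :+ con 2 :* U :^ 3) refl ⟩
      ι 2 + ι 6 * (u * D u) + ι 2 * u ^ 3
        ≈⟨ +-cong (+-congˡ (*-congˡ (*-cong u≈5Q² Du≈))) (*-congˡ (^-congˡ 3 u≈5Q²)) ⟩
      ι 2 + ι 6 * (ι 5 * (Q * Q) * (Q ^ 4 - Q)) + ι 2 * (ι 5 * (Q * Q)) ^ 3
        ≈⟨ solve 1 (λ q → con 2 :+ con 6 :* (con 5 :* (q :* q) :* (q :^ 4 :- q)) :+ con 2 :* (con 5 :* (q :* q)) :^ 3 :=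
                          con 5 :* (q :^ 3 :- con 1)) refl Q ⟩
      ι 5 * (Q ^ 3 - ι 1)                   ∎
      where
      Du≈ : D u ≈ Q ^ 4 - Q
      Du≈ = begin
        D u                                   ≈⟨ prove ρ U' (con 2 :* (U :* U) :- q) refl ⟩
        ι 2 * (u * u) - Q                     ≈⟨ +-congʳ (*-congˡ (*-cong u≈5Q² u≈5Q²)) ⟩
        ι 2 * (ι 5 * (Q * Q) * (ι 5 * (Q * Q))) - Q
          ≈⟨ solve 1 (λ q → con 2 :* (con 5 :* (q :* q) :* (con 5 :* (q :* q))) :- q := q :^ 4 :- q) refl Q ⟩
        Q ^ 4 - Q                             ∎

    -- Classically 1728 Δ = E₄³ - E₆², with 1728 ≡ -1 and E₆ ≡ 1. Only the square is within reach
    -- here, because the Euler equation sees Δ through η⁴⁹/η = Δ².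
    Z≈[1-Q³]² : Z ≈ (ι 1 - Q ^ 3) ^ 2
    Z≈[1-Q³]² = begin
      Z                                       ≈⟨ Z≈ ⟩
      ι 1 - u * D u + u ^ 3
        ≈⟨ prove ρ z (con 1 :- U :* (con 2 :* (U :* U) :- q) :+ U :^ 3) refl ⟩
      ι 1 - u * (ι 2 * (u * u) - Q) + u ^ 3
        ≈⟨ +-cong (+-congˡ (-‿cong (*-cong u≈5Q² (+-congʳ (*-congˡ (*-cong u≈5Q² u≈5Q²)))))) (^-congˡ 3 u≈5Q²) ⟩
      ι 1 - v * (ι 2 * (v * v) - Q) + v ^ 3
        ≈⟨ solve 1 (λ q → let v = con 5 :* (q :* q) in
             con 1 :- v :* (con 2 :* (v :* v) :- q) :+ v :^ 3 := (con 1 :- q :^ 3) :^ 2) refl Q ⟩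
      (ι 1 - Q ^ 3) ^ 2                       ∎
      where
      v : Carrier
      v = ι 5 * (Q * Q)

  -- Two levels and the rational curve that relates them

  -- The ODE `gauss` expresses φ₄₉/φ as a polynomial in Q and T. Taking its logarithmic
  -- derivative gives a polynomial relation that factors into the modular equation
  -- between Q and T and the polynomial assumed cancellable in `cancel`.
  module TwoLevels (u w Q T φ φ⁻¹ φ₄₉ : Carrier)
    (u≈5Q² : u ≈ ι 5 * (Q * Q)) (D-Q : D Q ≈ ι 5 * (Q ^ 3 - ι 1))
    (w≈5T² : w ≈ ι 5 * (T * T)) (D-T : D T ≈ ι 5 * (T ^ 3 - ι 1))
    (φφ⁻¹≈1 : φ * φ⁻¹ ≈ 1#) (D-φ₄₉ : D φ₄₉ ≈ 0#)
    (twist-φ : twist 0# φ ≈ (ι 2 * u - w) * φ)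
    (gauss : twist³ 0# φ ≈ φ - φ₄₉)
    (cancel : ∀ x → x * ((Q + T) * ((Q ^ 2 - T ^ 2) ^ 2 - ι 2 * T)) ≈ 0# → x ≈ 0#)
    where

    private
      module _ where
        ρ : Vec Carrier 2
        ρ = Q ∷ T ∷ []

        q t v w₃ : Polynomial 2
        q = var zero
        t = var (suc zero)
        v = con 3 :* q :^ 2 :+ con 2 :* t :^ 2

        d : Fin 2 → Polynomial 2
        d zero       = con 5 :* (q :^ 3 :- con 1)
        d (suc zero) = con 5 :* (t :^ 3 :- con 1)

        w₃ = ∂ d (∂ d v) :+ con 3 :* (v :* ∂ d v) :+ v :^ 3

        D-ρ : ∀ i → D (lookup ρ i) ≈ ⟦ d i ⟧ ρ
        D-ρ zero       = D-Q
        D-ρ (suc zero) = D-T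

        D-poly : ∀ p → D (⟦ p ⟧ ρ) ≈ ⟦ ∂ d p ⟧ ρ
        D-poly = D-⟦⟧ d ρ D-ρ

        V Y : Carrier
        V = ⟦ v ⟧ ρ
        Y = φ₄₉ * φ⁻¹

        V≈ : ι 2 * u - w ≈ V
        V≈ = begin
          ι 2 * u - w                               ≈⟨ +-cong (*-congˡ u≈5Q²) (-‿cong w≈5T²) ⟩
          ι 2 * (ι 5 * (Q * Q)) - ι 5 * (T * T)
            ≈⟨ prove ρ (con 2 :* (con 5 :* (q :* q)) :- con 5 :* (t :* t)) v refl ⟩
          V                                         ∎

        D-φ : D φ ≈ V * φ
        D-φ = begin
          D φ                 ≈⟨ solve 2 (λ x f → x := x :+ con 0 :* f) refl (D φ) φ ⟩
          twist 0# φ          ≈⟨ trans twist-φ (*-congʳ V≈) ⟩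
          V * φ               ∎

        D-Y : D Y ≈ - (V * Y)
        D-Y = begin
          D Y                                         ≈⟨ D-* _ _ ⟩
          D φ₄₉ * φ⁻¹ + φ₄₉ * D φ⁻¹
            ≈⟨ +-cong (*-congʳ D-φ₄₉) (*-congˡ (trans (D-inverse φφ⁻¹≈1) (-‿cong (*-congˡ D-φ)))) ⟩
          0# * φ⁻¹ + φ₄₉ * - (φ⁻¹ * φ⁻¹ * (V * φ))
            ≈⟨ solve 4 (λ f i V g → con 0 :* i :+ g :* (:- (i :* i :* (V :* f))) :=
                                    :- (V :* (g :* i) :* (f :* i))) refl φ φ⁻¹ V φ₄₉ ⟩
          - (V * Y * (φ * φ⁻¹))                       ≈⟨ -‿cong (trans (*-congˡ φφ⁻¹≈1) (*-identityʳ _)) ⟩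
          - (V * Y)                                   ∎

        w₃≈1-Y : ⟦ w₃ ⟧ ρ ≈ 1# - Y
        w₃≈1-Y = begin
          ⟦ w₃ ⟧ ρ
            ≈⟨ +-congʳ (+-cong (trans (D-cong (D-poly v)) (D-poly (∂ d v))) (*-congˡ (*-congˡ (D-poly v)))) ⟨
          third V
            ≈⟨ *-cancelʳ-unit φφ⁻¹≈1 (begin
                 third V * φ                            ≈⟨ twist³-eigen (trans twist-φ (*-congʳ V≈)) ⟨
                 twist³ 0# φ                            ≈⟨ gauss ⟩
                 φ - φ₄₉                                ≈⟨ +-congˡ (-‿cong (trans (*-congˡ φφ⁻¹≈1) (*-identityʳ _))) ⟨
                 φ - φ₄₉ * (φ * φ⁻¹)
                   ≈⟨ solve 3 (λ f i g → f :- g :* (f :* i) := (con 1 :- g :* i) :* f) refl φ φ⁻¹ φ₄₉ ⟩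
                 (1# - Y) * φ                           ∎) ⟩
          1# - Y                                      ∎

        h : Polynomial 2
        h = ∂ d w₃ :- v :* (con 1 :- w₃)

        -- As `D` kills φ₄₉, the quotient Y has logarithmic derivative -V. Inserting Y = 1 - w₃
        -- removes Y and leaves a relation in Q and T alone.
        h≈0 : ⟦ h ⟧ ρ ≈ 0#
        h≈0 = begin
          ⟦ ∂ d w₃ ⟧ ρ - V * (1# - ⟦ w₃ ⟧ ρ)
            ≈⟨ +-cong (trans (sym (D-poly w₃)) (D-cong w₃≈1-Y)) (-‿cong (*-congˡ (+-congˡ (-‿cong w₃≈1-Y)))) ⟩
          D (1# - Y) - V * (1# - (1# - Y))
            ≈⟨ +-congʳ (trans (D-+ 1# _) (+-cong D-1 (trans (D-neg Y) (-‿cong D-Y)))) ⟩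
          (0# - - (V * Y)) - V * (1# - (1# - Y))
            ≈⟨ solve 2 (λ V y → (con 0 :- :- (V :* y)) :- V :* (con 1 :- (con 1 :- y)) := con 0) refl V Y ⟩
          0#                                          ∎

    modular-equation : (Q + T) * (Q - T) ^ 2 ≈ ι 3
    modular-equation = begin
      (Q + T) * (Q - T) ^ 2
        ≈⟨ solve 1 (λ x → x := (x :- con 3) :+ con 3) refl _ ⟩
      ((Q + T) * (Q - T) ^ 2 - ι 3) + ι 3
        ≈⟨ +-congʳ (cancel _ (begin
             _            ≈⟨ prove ρ (((q :+ t) :* (q :- t) :^ 2 :- con 3) :* ((q :+ t) :* ((q :^ 2 :- t :^ 2) :^ 2 :- con 2 :* t)))
                               (con 3 :* h) refl ⟩
             ι 3 * ⟦ h ⟧ ρ ≈⟨ *-congˡ h≈0 ⟩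
             ι 3 * 0#     ≈⟨ zeroʳ _ ⟩
             0#           ∎)) ⟩
      0# + ι 3     ≈⟨ +-identityˡ _ ⟩
      ι 3          ∎

    -- The curve (Q + T)(Q − T)² = 3 is rational, with parameter A and B = 1/A. In terms
    -- of b = B² and X = A³ everything below is a polynomial.
    private
      module _ where
        A B b X : Carrier
        A = T ^ 2 - Q ^ 2
        B = ι 2 * (Q - T)
        b = B ^ 2
        X = A ^ 3

        -- The factor 2 in `B` normalises the product: 2(Q - T)(T² - Q²) = -2(Q + T)(Q - T)², and -2
        -- · 3 ≡ 1.
        BA≈1 : B * A ≈ ι 1
        BA≈1 = begin
          B * A
            ≈⟨ prove ρ (con 2 :* (q :- t) :* (t :^ 2 :- q :^ 2)) (con 5 :* ((q :+ t) :* (q :- t) :^ 2)) refl ⟩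
          ι 5 * ((Q + T) * (Q - T) ^ 2)       ≈⟨ *-congˡ modular-equation ⟩
          ι 5 * ι 3                           ≈⟨ solve 0 (con 5 :* con 3 := con 1) refl ⟩
          ι 1                                 ∎

        -- The solver does not know that BA is 1. The relation enters by inserting the powers of BA
        -- that make both sides of an equation the same polynomial in A and B.
        *-BA : ∀ n x → x * (B * A) ^ n ≈ x
        *-BA n x = begin
          x * (B * A) ^ n   ≈⟨ *-congˡ (^-congˡ n BA≈1) ⟩
          x * ι 1 ^ n       ≈⟨ *-congˡ (1^ n) ⟩
          x * 1#            ≈⟨ *-identityʳ x ⟩
          x                 ∎
          where
          1^ : ∀ n → ι 1 ^ n ≈ 1#
          1^ zero    = refl
          1^ (suc n) = trans (*-identityˡ _) (1^ n)

        Q+T≈5A² : Q + T ≈ ι 5 * A ^ 2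
        Q+T≈5A² = begin
          Q + T                               ≈⟨ *-BA 2 _ ⟨
          (Q + T) * (B * A) ^ 2
            ≈⟨ solve 3 (λ q t a → (q :+ t) :* (con 2 :* (q :- t) :* a) :^ 2 :=
                                  con 4 :* ((q :+ t) :* (q :- t) :^ 2) :* a :^ 2) refl Q T A ⟩
          ι 4 * ((Q + T) * (Q - T) ^ 2) * A ^ 2   ≈⟨ *-congʳ (*-congˡ modular-equation) ⟩
          ι 4 * ι 3 * A ^ 2                   ≈⟨ solve 1 (λ a → con 4 :* con 3 :* a := con 5 :* a) refl (A ^ 2) ⟩
          ι 5 * A ^ 2                         ∎

        Q≈ : Q ≈ ι 6 * A ^ 2 + ι 2 * B
        Q≈ = begin
          Q
            ≈⟨ prove ρ q (con 4 :* (q :+ t) :+ con 2 :* (con 2 :* (q :- t))) refl ⟩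
          ι 4 * (Q + T) + ι 2 * B             ≈⟨ +-congʳ (*-congˡ Q+T≈5A²) ⟩
          ι 4 * (ι 5 * A ^ 2) + ι 2 * B
            ≈⟨ solve 2 (λ x y → con 4 :* (con 5 :* x) :+ y := con 6 :* x :+ y) refl (A ^ 2) (ι 2 * B) ⟩
          ι 6 * A ^ 2 + ι 2 * B               ∎

        T≈ : T ≈ ι 6 * A ^ 2 - ι 2 * B
        T≈ = begin
          T
            ≈⟨ prove ρ t (con 4 :* (q :+ t) :- con 2 :* (con 2 :* (q :- t))) refl ⟩
          ι 4 * (Q + T) - ι 2 * B             ≈⟨ +-congʳ (*-congˡ Q+T≈5A²) ⟩
          ι 4 * (ι 5 * A ^ 2) - ι 2 * B
            ≈⟨ solve 2 (λ x y → con 4 :* (con 5 :* x) :- y := con 6 :* x :- y) refl (A ^ 2) (ι 2 * B) ⟩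
          ι 6 * A ^ 2 - ι 2 * B               ∎

        D-B : D B ≈ A ^ 3 - B ^ 3
        D-B = begin
          D B                                 ≈⟨ D-poly (con 2 :* (q :- t)) ⟩
          ⟦ ∂ d (con 2 :* (q :- t)) ⟧ ρ       ≈⟨ prove ρ (∂ d (con 2 :* (q :- t))) (con 3 :* (q :^ 3 :- t :^ 3)) refl ⟩
          ι 3 * (Q ^ 3 - T ^ 3)               ≈⟨ *-congˡ (+-cong (^-congˡ 3 Q≈) (-‿cong (^-congˡ 3 T≈))) ⟩
          ι 3 * ((ι 6 * A ^ 2 + ι 2 * B) ^ 3 - (ι 6 * A ^ 2 - ι 2 * B) ^ 3)
            ≈⟨ solve 2 (λ a b → con 3 :* ((con 6 :* a :^ 2 :+ con 2 :* b) :^ 3 :- (con 6 :* a :^ 2 :- con 2 :* b) :^ 3) :=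
                                a :^ 3 :* (b :* a) :^ 1 :- b :^ 3) refl A B ⟩
          A ^ 3 * (B * A) ^ 1 - B ^ 3         ≈⟨ +-congʳ (*-BA 1 _) ⟩
          A ^ 3 - B ^ 3                       ∎

        σ : Vec Carrier 2
        σ = b ∷ X ∷ []

        y x s : Polynomial 2
        y = var zero
        x = var (suc zero)
        s = y :* (con 2 :+ con 3 :* x :+ con 4 :* x :^ 2)

        ∂σ : Fin 2 → Polynomial 2
        ∂σ zero       = con 5 :* (y :^ 2 :* (con 1 :- x :^ 2))
        ∂σ (suc zero) = con 3 :* (y :* x :* (con 1 :- x :^ 2))

        D-σ : ∀ i → D (lookup σ i) ≈ ⟦ ∂σ i ⟧ σ
        D-σ zero = begin
          D (B ^ 2)                           ≈⟨ D-^ B 1 ⟩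
          ι 2 * (B ^ 1 * D B)                 ≈⟨ *-congˡ (*-congˡ D-B) ⟩
          ι 2 * (B ^ 1 * (A ^ 3 - B ^ 3))     ≈⟨ *-congˡ (*-congˡ (+-congʳ (*-BA 3 _))) ⟨
          ι 2 * (B ^ 1 * (A ^ 3 * (B * A) ^ 3 - B ^ 3))
            ≈⟨ solve 2 (λ a b → con 2 :* (b :^ 1 :* (a :^ 3 :* (b :* a) :^ 3 :- b :^ 3)) :=
                                con 5 :* ((b :^ 2) :^ 2 :* (con 1 :- (a :^ 3) :^ 2))) refl A B ⟩
          ⟦ ∂σ zero ⟧ σ                       ∎
        D-σ (suc zero) = begin
          D (A ^ 3)                           ≈⟨ D-^ A 2 ⟩
          ι 3 * (A ^ 2 * D A)                 ≈⟨ *-congˡ (*-congˡ (trans (D-inverse BA≈1) (-‿cong (*-congˡ D-B)))) ⟩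
          ι 3 * (A ^ 2 * - (A * A * (A ^ 3 - B ^ 3)))
            ≈⟨ solve 2 (λ a b → con 3 :* (a :^ 2 :* (:- (a :* a :* (a :^ 3 :- b :^ 3)))) :=
                                con 3 :* (b :^ 2 :* a :^ 3 :* (b :* a) :^ 1 :- a :^ 7)) refl A B ⟩
          ι 3 * (b * X * (B * A) ^ 1 - A ^ 7) ≈⟨ *-congˡ (+-cong (*-BA 1 _) (-‿cong (sym (*-BA 2 _)))) ⟩
          ι 3 * (b * X - A ^ 7 * (B * A) ^ 2)
            ≈⟨ solve 2 (λ a b → con 3 :* (b :^ 2 :* a :^ 3 :- a :^ 7 :* (b :* a) :^ 2) :=
                                con 3 :* (b :^ 2 :* a :^ 3 :* (con 1 :- (a :^ 3) :^ 2))) refl A B ⟩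
          ⟦ ∂σ (suc zero) ⟧ σ                 ∎

        4u+w≈ : ι 4 * u + w ≈ ⟦ s ⟧ σ
        4u+w≈ = begin
          ι 4 * u + w
            ≈⟨ +-cong (*-congˡ (trans u≈5Q² (*-congˡ (*-cong Q≈ Q≈)))) (trans w≈5T² (*-congˡ (*-cong T≈ T≈))) ⟩
          ι 4 * (ι 5 * ((ι 6 * A ^ 2 + ι 2 * B) * (ι 6 * A ^ 2 + ι 2 * B))) +
                 ι 5 * ((ι 6 * A ^ 2 - ι 2 * B) * (ι 6 * A ^ 2 - ι 2 * B))
            ≈⟨ solve 2 (λ a b → let q = con 6 :* a :^ 2 :+ con 2 :* b; t = con 6 :* a :^ 2 :- con 2 :* b in
                 con 4 :* (con 5 :* (q :* q)) :+ con 5 :* (t :* t) :=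
                 con 2 :* b :^ 2 :+ con 3 :* (a :^ 2 :* b) :+ con 4 :* a :^ 4) refl A B ⟩
          ι 2 * B ^ 2 + ι 3 * (A ^ 2 * B) + ι 4 * A ^ 4
            ≈⟨ +-cong (+-congˡ (*-congˡ (*-BA 1 _))) (*-congˡ (*-BA 2 _)) ⟨
          ι 2 * B ^ 2 + ι 3 * (A ^ 2 * B * (B * A) ^ 1) + ι 4 * (A ^ 4 * (B * A) ^ 2)
            ≈⟨ solve 2 (λ a b →
                 con 2 :* b :^ 2 :+ con 3 :* (a :^ 2 :* b :* (b :* a) :^ 1) :+ con 4 :* (a :^ 4 :* (b :* a) :^ 2) :=
                 b :^ 2 :* (con 2 :+ con 3 :* a :^ 3 :+ con 4 :* (a :^ 3) :^ 2)) refl A B ⟩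
          ⟦ s ⟧ σ                             ∎

        τ : Polynomial 2 → Polynomial 2
        τ p = ∂ ∂σ p :+ s :* p

        -- Both summands of 1 + (1 - Q³)(1 - T³)² brought to degree 12 in B by factors XB³ = 1. With
        -- 1 written as XB³, the differences 1 - Q³ and 1 - T³ become B³(X + 1)²(X - 1) and B³(X -
        -- 1)²(X + 1).
        p₆ : Polynomial 2
        p₆ = y :^ 6 :* (x :^ 4 :- x :* (con 1 :+ x) :^ 4 :* (con 1 :- x) :^ 5)

        p₆≈ : ⟦ p₆ ⟧ σ ≈ ι 1 + (ι 1 - Q ^ 3) * (ι 1 - T ^ 3) ^ 2
        p₆≈ = begin
          ⟦ p₆ ⟧ σ
            ≈⟨ solve 2 (λ b x → let o = con 1 :* (x :* b :^ 3); q = b :* (con 6 :* x :+ con 2); t = b :* (con 6 :* x :- con 2) in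
                 (b :^ 2) :^ 6 :* (x :^ 4 :- x :* (con 1 :+ x) :^ 4 :* (con 1 :- x) :^ 5) :=
                 o :^ 4 :+ o :* (o :- q :^ 3) :* (o :- t :^ 3) :^ 2) refl B X ⟩
          o ^ 4 + o * (o - q′ ^ 3) * (o - t′ ^ 3) ^ 2
            ≈⟨ +-cong (^-congˡ 4 o≈1) (*-cong (*-cong o≈1 (+-cong o≈1 (-‿cong (^-congˡ 3 q′≈Q))))
                 (^-congˡ 2 (+-cong o≈1 (-‿cong (^-congˡ 3 t′≈T))))) ⟩
          ι 1 ^ 4 + ι 1 * (ι 1 - Q ^ 3) * (ι 1 - T ^ 3) ^ 2
            ≈⟨ solve 2 (λ x y → con 1 :^ 4 :+ con 1 :* x :* y := con 1 :+ x :* y) refl _ _ ⟩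
          ι 1 + (ι 1 - Q ^ 3) * (ι 1 - T ^ 3) ^ 2 ∎
          where
          o q′ t′ : Carrier
          o = ι 1 * (X * B ^ 3)
          q′ = B * (ι 6 * X + ι 2)
          t′ = B * (ι 6 * X - ι 2)

          o≈1 : o ≈ ι 1
          o≈1 = trans (*-congˡ (solve 2 (λ a b → a :^ 3 :* b :^ 3 := (b :* a) :^ 3) refl A B)) (*-BA 3 (ι 1))

          q′≈Q : q′ ≈ Q
          q′≈Q = begin
            q′                                     ≈⟨ solve 2 (λ a b → b :* (con 6 :* a :^ 3 :+ con 2) :=
                                                       con 6 :* (a :^ 2 :* (b :* a) :^ 1) :+ con 2 :* b) refl A B ⟩
            ι 6 * (A ^ 2 * (B * A) ^ 1) + ι 2 * B  ≈⟨ +-congʳ (*-congˡ (*-BA 1 _)) ⟩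
            ι 6 * A ^ 2 + ι 2 * B                  ≈⟨ Q≈ ⟨
            Q                                      ∎

          t′≈T : t′ ≈ T
          t′≈T = begin
            t′                                     ≈⟨ solve 2 (λ a b → b :* (con 6 :* a :^ 3 :- con 2) :=
                                                       con 6 :* (a :^ 2 :* (b :* a) :^ 1) :- con 2 :* b) refl A B ⟩
            ι 6 * (A ^ 2 * (B * A) ^ 1) - ι 2 * B  ≈⟨ +-congʳ (*-congˡ (*-BA 1 _)) ⟩
            ι 6 * A ^ 2 - ι 2 * B                  ≈⟨ T≈ ⟨
            T                                      ∎

    -- Each twist replaces the cofactor p of f by `τ p`. The derivatives of b and X and the
    -- multiplier s all carry one extra factor b, so the k-th cofactor, starting from 1, is bᵏ times
    -- a polynomial in X; `p₁` to `p₆` are these cofactors.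
    twist⁶ : ∀ {c f} → twist c f ≈ (ι 4 * u + w) * f →
      twist³ c (twist³ c f) ≈
      (ι 1 + (ι 1 - Q ^ 3) * (ι 1 - T ^ 3) ^ 2) * f
    twist⁶ {c} {f} twist-f = begin
      twist³ c (twist³ c f)
        ≈⟨ cong (cong (cong (cong (cong (cong (sym (*-identityˡ f))))))) ⟩
      tw (tw (tw (tw (tw (tw (1# * f))))))
        ≈⟨ cong (cong (cong (cong (cong (step (con 1) p₁ (prove σ (τ (con 1)) p₁ refl)))))) ⟩
      tw (tw (tw (tw (tw (⟦ p₁ ⟧ σ * f)))))       ≈⟨ cong (cong (cong (cong (step p₁ p₂ (prove σ (τ p₁) p₂ refl))))) ⟩
      tw (tw (tw (tw (⟦ p₂ ⟧ σ * f))))            ≈⟨ cong (cong (cong (step p₂ p₃ (prove σ (τ p₂) p₃ refl)))) ⟩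
      tw (tw (tw (⟦ p₃ ⟧ σ * f)))                 ≈⟨ cong (cong (step p₃ p₄ (prove σ (τ p₃) p₄ refl))) ⟩
      tw (tw (⟦ p₄ ⟧ σ * f))                      ≈⟨ cong (step p₄ p₅ (prove σ (τ p₄) p₅ refl)) ⟩
      tw (⟦ p₅ ⟧ σ * f)                           ≈⟨ step p₅ p₆ (prove σ (τ p₅) p₆ refl) ⟩
      ⟦ p₆ ⟧ σ * f                                ≈⟨ *-congʳ p₆≈ ⟩
      (ι 1 + (ι 1 - Q ^ 3) * (ι 1 - T ^ 3) ^ 2) * f ∎
      where
      tw : Carrier → Carrier
      tw = twist c

      cong : ∀ {f g} → f ≈ g → tw f ≈ tw g
      cong = twist-cong c

      step : ∀ p p′ → ⟦ τ p ⟧ σ ≈ ⟦ p′ ⟧ σ → tw (⟦ p ⟧ σ * f) ≈ ⟦ p′ ⟧ σ * f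
      step p p′ τp≈p′ = trans (twist-* (trans twist-f (*-congʳ 4u+w≈)) (⟦ p ⟧ σ))
        (*-congʳ (trans (+-congʳ (D-⟦⟧ ∂σ σ D-σ p)) τp≈p′))

      p₁ p₂ p₃ p₄ p₅ : Polynomial 2
      p₁ = y :^ 1 :* (con 2 :+ con 3 :* x :+ con 4 :* x :^ 2)
      p₂ = y :^ 2 :* (x :+ con 3 :* x :^ 2)
      p₃ = y :^ 3 :* (x :+ x :^ 2 :+ con 6 :* x :^ 4)
      p₄ = y :^ 4 :* (con 6 :* x :+ con 5 :* x :^ 2 :+ con 3 :* x :^ 3 :+ con 3 :* x :^ 4 :+ con 4 :* x :^ 5 :+ con 2 :* x :^ 6)
      p₅ = y :^ 5 :* (con 3 :* x :+ con 4 :* x :^ 2 :+ x :^ 3 :+ x :^ 4 :+ con 5 :* x :^ 5 :+ x :^ 6 :+ x :^ 7 :+ con 2 :* x :^ 8)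

-- Cauchy products of coefficient sequences

module SeriesLaws (K : CommutativeRing 0ℓ 0ℓ) (char7 : Characteristic7 K) where

  open CommutativeRing K hiding (zero)
  open import Relation.Binary.Reasoning.Setoid setoid
  open Char7 K char7
  open Algebra.Properties.CommutativeMonoid.Sum +-commutativeMonoid using () renaming (sum to ∑)

  infixl 7 _⊛_ _•_
  infixl 6 _⊕_

  Series : Set
  Series = ℕ → Carrier

  one : Series
  one m = if 0 ≡ᵇ m then 1# else 0#

  -- The sum unfolds so that (f ⊛ g) (suc m) is f 0 * g (suc m) + (tail f ⊛ g) m by computation, the
  -- recursion behind every induction below. Over the integers modulo 7 it also computes to the
  -- product in which the theorem is stated.
  _⊛_ : Series → Series → Series
  (f ⊛ g) m = ∑ {suc m} (λ i → f (toℕ i) * g (m ∸ toℕ i))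

  _•_ : Carrier → Series → Series
  (c • f) m = c * f m

  tail : Series → Series
  tail f = f ∘ suc

  _⊕_ : Series → Series → Series
  (f ⊕ g) m = f m + g m

  ⊝_ : Series → Series
  (⊝ f) m = - f m

  ⊛-cong-≤ : ∀ m {f f′ g g′} → (∀ k → k ≤ m → f k ≈ f′ k) → (∀ k → k ≤ m → g k ≈ g′ k) →
             (f ⊛ g) m ≈ (f′ ⊛ g′) m
  ⊛-cong-≤ zero    p q = +-congʳ (*-cong (p 0 z≤n) (q 0 z≤n))
  ⊛-cong-≤ (suc m) p q = +-cong (*-cong (p 0 z≤n) (q (suc m) ℕ.≤-refl))
    (⊛-cong-≤ m (λ k k≤m → p (suc k) (s≤s k≤m)) (λ k k≤m → q k (ℕ.m≤n⇒m≤1+n k≤m)))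

  ⊛-cong : ∀ m {f f′ g g′} → (∀ k → f k ≈ f′ k) → (∀ k → g k ≈ g′ k) → (f ⊛ g) m ≈ (f′ ⊛ g′) m
  ⊛-cong m p q = ⊛-cong-≤ m (λ k _ → p k) (λ k _ → q k)

  ⊛-distribʳ : ∀ m f g h → ((f ⊕ g) ⊛ h) m ≈ (f ⊛ h) m + (g ⊛ h) m
  ⊛-distribʳ zero    f g h =
    solve 3 (λ a b c → (a :+ b) :* c :+ con 0 := (a :* c :+ con 0) :+ (b :* c :+ con 0)) refl (f 0) (g 0) (h 0)
  ⊛-distribʳ (suc m) f g h = begin
    (f 0 + g 0) * h (suc m) + ((tail f ⊕ tail g) ⊛ h) m ≈⟨ +-congˡ (⊛-distribʳ m (tail f) (tail g) h) ⟩
    _ ≈⟨ solve 5 (λ a b c x y → (a :+ b) :* c :+ (x :+ y) := (a :* c :+ x) :+ (b :* c :+ y)) refl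
           (f 0) (g 0) (h (suc m)) ((tail f ⊛ h) m) ((tail g ⊛ h) m) ⟩
    _ ∎

  ⊛-scaleˡ : ∀ m c f h → ((c • f) ⊛ h) m ≈ c * (f ⊛ h) m
  ⊛-scaleˡ zero    c f h =
    solve 3 (λ c a b → c :* a :* b :+ con 0 := c :* (a :* b :+ con 0)) refl c (f 0) (h 0)
  ⊛-scaleˡ (suc m) c f h = begin
    c * f 0 * h (suc m) + ((c • tail f) ⊛ h) m ≈⟨ +-congˡ (⊛-scaleˡ m c (tail f) h) ⟩
    _ ≈⟨ solve 4 (λ c a b x → c :* a :* b :+ c :* x := c :* (a :* b :+ x)) refl c (f 0) (h (suc m)) ((tail f ⊛ h) m) ⟩
    _ ∎

  ⊛-assoc : ∀ m f g h → ((f ⊛ g) ⊛ h) m ≈ (f ⊛ (g ⊛ h)) m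
  ⊛-assoc zero    f g h =
    solve 3 (λ a b c → (a :* b :+ con 0) :* c :+ con 0 := a :* (b :* c :+ con 0) :+ con 0) refl (f 0) (g 0) (h 0)
  ⊛-assoc (suc m) f g h = begin
    (f 0 * g 0 + 0#) * h (suc m) + (((f 0 • tail g) ⊕ (tail f ⊛ g)) ⊛ h) m
      ≈⟨ +-congˡ (⊛-distribʳ m (f 0 • tail g) (tail f ⊛ g) h) ⟩
    (f 0 * g 0 + 0#) * h (suc m) + (((f 0 • tail g) ⊛ h) m + ((tail f ⊛ g) ⊛ h) m)
      ≈⟨ +-congˡ (+-cong (⊛-scaleˡ m (f 0) (tail g) h) (⊛-assoc m (tail f) g h)) ⟩
    _ ≈⟨ solve 5 (λ a b c x y → (a :* b :+ con 0) :* c :+ (a :* x :+ y) := a :* (b :* c :+ x) :+ y) refl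
           (f 0) (g 0) (h (suc m)) ((tail g ⊛ h) m) ((tail f ⊛ (g ⊛ h)) m) ⟩
    _ ∎

  -- The recursion peels the left factor only. Swapping, peeling the other factor and swapping back
  -- leads from m + 2 to m + 1 and m, hence the two base cases.
  ⊛-comm : ∀ m f g → (f ⊛ g) m ≈ (g ⊛ f) m
  ⊛-comm zero          f g = solve 2 (λ a b → a :* b :+ con 0 := b :* a :+ con 0) refl (f 0) (g 0)
  ⊛-comm (suc zero)    f g =
    solve 4 (λ a b c d → a :* b :+ (c :* d :+ con 0) := d :* c :+ (b :* a :+ con 0)) refl (f 0) (g 1) (f 1) (g 0)
  ⊛-comm (suc (suc m)) f g = begin
    f 0 * g (2 ℕ.+ m) + (tail f ⊛ g) (suc m)
      ≈⟨ +-congˡ (⊛-comm (suc m) (tail f) g) ⟩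
    f 0 * g (2 ℕ.+ m) + (g 0 * f (2 ℕ.+ m) + (tail g ⊛ tail f) m)
      ≈⟨ +-congˡ (+-congˡ (⊛-comm m (tail g) (tail f))) ⟩
    f 0 * g (2 ℕ.+ m) + (g 0 * f (2 ℕ.+ m) + (tail f ⊛ tail g) m)
      ≈⟨ solve 5 (λ a b c d x → a :* b :+ (c :* d :+ x) := c :* d :+ (a :* b :+ x)) refl
           (f 0) (g (2 ℕ.+ m)) (g 0) (f (2 ℕ.+ m)) ((tail f ⊛ tail g) m) ⟩
    g 0 * f (2 ℕ.+ m) + (f ⊛ tail g) (suc m)
      ≈⟨ +-congˡ (⊛-comm (suc m) f (tail g)) ⟩
    g 0 * f (2 ℕ.+ m) + (tail g ⊛ f) (suc m) ∎

  ⊛-identityʳ : ∀ f m → (f ⊛ one) m ≈ f m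
  ⊛-identityʳ f zero    = solve 1 (λ a → a :* con 1 :+ con 0 := a) refl (f 0)
  ⊛-identityʳ f (suc m) = trans (+-congˡ (⊛-identityʳ (tail f) m)) (solve 2 (λ a b → a :* con 0 :+ b := b) refl (f 0) (f (suc m)))

  D : Series → Series
  D f m = ι m * f m

  leibniz : ∀ m f g → (D (f ⊛ g)) m ≈ (D f ⊛ g) m + (f ⊛ D g) m
  leibniz zero    f g = solve 2 (λ a b → con 0 :* (a :* b :+ con 0) :=
    (con 0 :* a :* b :+ con 0) :+ (a :* (con 0 :* b) :+ con 0)) refl (f 0) (g 0)
  leibniz (suc m) f g = begin
    ι (suc m) * (f 0 * g (suc m) + (tail f ⊛ g) m)
      ≈⟨ *-congʳ (ι-suc m) ⟩
    (1# + ι m) * (f 0 * g (suc m) + (tail f ⊛ g) m)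
      ≈⟨ solve 4 (λ k a b x → (con 1 :+ k) :* (a :* b :+ x) := a :* ((con 1 :+ k) :* b) :+ (x :+ k :* x)) refl
           (ι m) (f 0) (g (suc m)) ((tail f ⊛ g) m) ⟩
    f 0 * ((1# + ι m) * g (suc m)) + ((tail f ⊛ g) m + D (tail f ⊛ g) m)
      ≈⟨ +-cong (*-congˡ (*-congʳ (sym (ι-suc m)))) (+-congˡ (leibniz m (tail f) g)) ⟩
    f 0 * D g (suc m) + ((tail f ⊛ g) m + ((D (tail f) ⊛ g) m + (tail f ⊛ D g) m))
      ≈⟨ solve 6 (λ a b c x y z → a :* b :+ (x :+ (y :+ z)) := (con 0 :* a :* c :+ (x :+ y)) :+ (a :* b :+ z)) refl
           (f 0) (D g (suc m)) (g (suc m)) ((tail f ⊛ g) m) ((D (tail f) ⊛ g) m) ((tail f ⊛ D g) m) ⟩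
    (0# * f 0 * g (suc m) + ((tail f ⊛ g) m + (D (tail f) ⊛ g) m)) + (f ⊛ D g) (suc m)
      ≈⟨ +-congʳ (+-congˡ (⊛-distribʳ m (tail f) (D (tail f)) g)) ⟨
    (0# * f 0 * g (suc m) + ((tail f ⊕ D (tail f)) ⊛ g) m) + (f ⊛ D g) (suc m)
      ≈⟨ +-congʳ (+-congˡ (⊛-cong m (λ k → begin
           f (suc k) + ι k * f (suc k) ≈⟨ solve 2 (λ k x → x :+ k :* x := (con 1 :+ k) :* x) refl (ι k) (f (suc k)) ⟩
           (1# + ι k) * f (suc k)      ≈⟨ *-congʳ (ι-suc k) ⟨
           ι (suc k) * f (suc k)           ∎) (λ k → refl {g k}))) ⟩
    (D f ⊛ g) (suc m) + (f ⊛ D g) (suc m) ∎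

  ⊛-zeroʳ : ∀ m f → (f ⊛ λ _ → 0#) m ≈ 0#
  ⊛-zeroʳ zero    f = solve 1 (λ a → a :* con 0 :+ con 0 := con 0) refl (f 0)
  ⊛-zeroʳ (suc m) f = trans (+-congˡ (⊛-zeroʳ m (tail f))) (solve 1 (λ a → a :* con 0 :+ con 0 := con 0) refl (f 0))

  ⊛-order : ∀ a b {f g} → (∀ m → m < a → f m ≈ 0#) → (∀ m → m < b → g m ≈ 0#) →
            ∀ m → m < a ℕ.+ b → (f ⊛ g) m ≈ 0#
  ⊛-order zero    b {f} f≈0 g≈0 m m<b = trans
    (⊛-cong-≤ m (λ k _ → refl {f k}) (λ k k≤m → g≈0 k (ℕ.≤-<-trans k≤m m<b))) (⊛-zeroʳ m f)
  ⊛-order (suc a) b {f} {g} f≈0 g≈0 zero    _          = trans (+-congʳ (*-congʳ (f≈0 0 (s≤s z≤n))))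
    (solve 1 (λ x → con 0 :* x :+ con 0 := con 0) refl (g 0))
  ⊛-order (suc a) b {f} {g} f≈0 g≈0 (suc m) (s≤s m<a+b) = trans
    (+-cong (*-congʳ (f≈0 0 (s≤s z≤n))) (⊛-order a b (λ k k<a → f≈0 (suc k) (s≤s k<a)) g≈0 m m<a+b))
    (solve 1 (λ x → con 0 :* x :+ con 0 := con 0) refl (g (suc m)))

  ⊛-leading : ∀ N f g → (∀ m → m < N → g m ≈ 0#) → (g ⊛ f) N ≈ g N * f 0
  ⊛-leading zero    f g g≈0 = +-identityʳ _
  ⊛-leading (suc N) f g g≈0 = trans
    (+-cong (*-congʳ (g≈0 0 (s≤s z≤n))) (⊛-leading N f (tail g) (λ m m<N → g≈0 (suc m) (s≤s m<N))))
    (solve 2 (λ x y → con 0 :* x :+ y := y) refl (f (suc N)) (g (suc N) * f 0))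

  -- Strong induction: if g vanishes below m, the product has coefficient g m * f 0 at m, and f 0 is
  -- invertible.
  ⊛-cancel : ∀ {c f g} → c * f 0 ≈ 1# → (∀ m → (g ⊛ f) m ≈ 0#) → ∀ m → g m ≈ 0#
  ⊛-cancel {c} {f} {g} cf₀≈1 gf≈0 m = below (suc m) m ℕ.≤-refl
    where
    below : ∀ N m → m < N → g m ≈ 0#
    below (suc N) m (s≤s m≤N) with ℕ.m≤n⇒m<n∨m≡n m≤N
    ... | inj₁ m<N    = below N m m<N
    ... | inj₂ ≡.refl = begin
      g m               ≈⟨ trans (*-congˡ cf₀≈1) (*-identityʳ _) ⟨
      g m * (c * f 0)   ≈⟨ solve 3 (λ x c y → x :* (c :* y) := c :* (x :* y)) refl (g m) c (f 0) ⟩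
      c * (g m * f 0)   ≈⟨ *-congˡ (trans (sym (⊛-leading m f g (below m))) (gf≈0 m)) ⟩
      c * 0#            ≈⟨ zeroʳ c ⟩
      0#                ∎

  ⊛-cancel₁ : ∀ {c f g} → f 0 ≈ 0# → c * f 1 ≈ 1# → (∀ m → (g ⊛ f) m ≈ 0#) → ∀ m → g m ≈ 0#
  ⊛-cancel₁ {c} {f} {g} f₀≈0 cf₁≈1 gf≈0 = ⊛-cancel {c} {tail f} {g} cf₁≈1 λ m → begin
    (g ⊛ tail f) m                    ≈⟨ ⊛-comm m g (tail f) ⟩
    (tail f ⊛ g) m                    ≈⟨ solve 2 (λ x y → y := con 0 :* x :+ y) refl (g (suc m)) _ ⟩
    0# * g (suc m) + (tail f ⊛ g) m   ≈⟨ +-congʳ (*-congʳ f₀≈0) ⟨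
    (f ⊛ g) (suc m)                   ≈⟨ ⊛-comm (suc m) f g ⟩
    (g ⊛ f) (suc m)                   ≈⟨ gf≈0 (suc m) ⟩
    0#                                ∎

-- Gaussian binomials and the finite triple product

module FiniteTheta (R : CommutativeRing 0ℓ 0ℓ) (char7 : Characteristic7 R) where

  open CommutativeRing R hiding (zero)
  open import Relation.Binary.Reasoning.Setoid setoid
  open Algebra.Properties.Semiring.Exp semiring using (_^_; ^-congˡ; ^-homo-*; ^-assocʳ)
  open Char7 R char7

  ∑< : ℕ → (ℕ → Carrier) → Carrier
  ∑< zero    f = 0#
  ∑< (suc n) f = ∑< n f + f n

  ∑<-cong : ∀ n {f g} → (∀ k → k < n → f k ≈ g k) → ∑< n f ≈ ∑< n g
  ∑<-cong zero    f≈g = refl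
  ∑<-cong (suc n) f≈g = +-cong (∑<-cong n (λ k k<n → f≈g k (ℕ.m<n⇒m<1+n k<n))) (f≈g n ℕ.≤-refl)

  *-∑< : ∀ n c f → c * ∑< n f ≈ ∑< n (λ k → c * f k)
  *-∑< zero    c f = zeroʳ c
  *-∑< (suc n) c f = trans (distribˡ c _ _) (+-congʳ (*-∑< n c f))

  infixl 8 _! 
  -- (p;p)ₙ
  _! : Carrier → ℕ → Carrier
  (p !) zero    = 1#
  (p !) (suc n) = (p !) n * (1# - p ^ suc n)

  module _ (p : Carrier) (r⁻¹ : ℕ → Carrier) (r-inverse : ∀ n → (p !) n * r⁻¹ n ≈ 1#) where

    private
      r : ℕ → Carrier
      r = p !

    r⁻¹-suc : ∀ n → (1# - p ^ suc n) * r⁻¹ (suc n) ≈ r⁻¹ n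
    r⁻¹-suc n = begin
      (1# - p ^ suc n) * r⁻¹ (suc n)                    ≈⟨ trans (*-congʳ (r-inverse n)) (*-identityˡ _) ⟨
      r n * r⁻¹ n * ((1# - p ^ suc n) * r⁻¹ (suc n))
        ≈⟨ solve 4 (λ a b c d → a :* b :* (c :* d) := b :* (a :* c :* d)) refl (r n) (r⁻¹ n) (1# - p ^ suc n) (r⁻¹ (suc n)) ⟩
      r⁻¹ n * (r (suc n) * r⁻¹ (suc n))                 ≈⟨ trans (*-congˡ (r-inverse (suc n))) (*-identityʳ _) ⟩
      r⁻¹ n                                             ∎

    -- s n k = 1/(p;p)ₙ₋ₖ, which is 0 for k > n.
    s : ℕ → ℕ → Carrier
    s n       zero    = r⁻¹ n
    s zero    (suc k) = 0#
    s (suc n) (suc k) = s n k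

    s-> : ∀ n k → n < k → s n k ≈ 0#
    s-> zero    (suc k) _         = refl
    s-> (suc n) (suc k) (s≤s n<k) = s-> n k n<k

    s-+ : ∀ k i → s (k ℕ.+ i) k ≈ r⁻¹ i
    s-+ zero    i = refl
    s-+ (suc k) i = s-+ k i

    s-+-1 : ∀ k i → s (k ℕ.+ i) (1 ℕ.+ k) ≈ (1# - p ^ i) * r⁻¹ i
    s-+-1 (suc k) i       = s-+-1 k i
    s-+-1 zero    zero    = solve 1 (λ x → con 0 := (con 1 :- con 1) :* x) refl _
    s-+-1 zero    (suc i) = sym (r⁻¹-suc i)

    -- Multiplied by p so that p(1 - p^(i-1)) can be written p - p^i, without an exponent i - 1. The
    -- formula then covers i = 0 and i = 1 too, where both sides vanish.
    s-+-2 : ∀ k i → p * s (k ℕ.+ i) (2 ℕ.+ k) ≈ (p - p ^ i) * ((1# - p ^ i) * r⁻¹ i)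
    s-+-2 (suc k) i             = s-+-2 k i
    s-+-2 zero    zero          = solve 2 (λ p x → p :* con 0 := (p :- con 1) :* ((con 1 :- con 1) :* x)) refl p _
    s-+-2 zero    (suc zero)    = solve 2 (λ p x → p :* con 0 := (p :- p :* con 1) :* x) refl p _
    s-+-2 zero    (suc (suc i)) = begin
      p * r⁻¹ i                                          ≈⟨ *-congˡ (trans (*-congˡ (r⁻¹-suc (suc i))) (r⁻¹-suc i)) ⟨
      p * ((1# - p ^ suc i) * ((1# - p ^ suc (suc i)) * r⁻¹ (suc (suc i))))
        ≈⟨ solve 3 (λ p y x → p :* ((con 1 :- y) :* x) := (p :- p :* y) :* x) refl p (p ^ suc i) _ ⟩
      (p - p ^ suc (suc i)) * ((1# - p ^ suc (suc i)) * r⁻¹ (suc (suc i))) ∎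

    -- The Gaussian binomial coefficient [2n+1 choose n−k].
    C : ℕ → ℕ → Carrier
    C n k = r (2 ℕ.* n ℕ.+ 1) * s n k * r⁻¹ (n ℕ.+ k ℕ.+ 1)

    C-> : ∀ n k → n < k → C n k ≈ 0#
    C-> n k n<k = begin
      C n k                                               ≈⟨ *-congʳ (*-congˡ (s-> n k n<k)) ⟩
      r (2 ℕ.* n ℕ.+ 1) * 0# * r⁻¹ (n ℕ.+ k ℕ.+ 1)
        ≈⟨ solve 2 (λ a b → a :* con 0 :* b := con 0) refl _ _ ⟩
      0#                                                  ∎

    r-2n+3 : ∀ n → r (2 ℕ.* suc n ℕ.+ 1) ≈
      r (2 ℕ.* n ℕ.+ 1) * (1# - p ^ (2 ℕ.* n ℕ.+ 2)) * (1# - p * p ^ (2 ℕ.* n ℕ.+ 2))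
    r-2n+3 n = begin
      r (2 ℕ.* suc n ℕ.+ 1)                       ≡⟨ ≡.cong r (e₁ n) ⟩
      r (suc (suc (2 ℕ.* n ℕ.+ 1)))               ≡⟨ ≡.cong (λ m → r (2 ℕ.* n ℕ.+ 1) * (1# - p ^ m) * (1# - p * p ^ m)) (e₂ n) ⟩
      r (2 ℕ.* n ℕ.+ 1) * (1# - p ^ (2 ℕ.* n ℕ.+ 2)) * (1# - p * p ^ (2 ℕ.* n ℕ.+ 2)) ∎
      where
      e₁ : ∀ n → 2 ℕ.* suc n ℕ.+ 1 ≡.≡ suc (suc (2 ℕ.* n ℕ.+ 1))
      e₁ = ℕ.solve-∀
      e₂ : ∀ n → suc (2 ℕ.* n ℕ.+ 1) ≡.≡ 2 ℕ.* n ℕ.+ 2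
      e₂ = ℕ.solve-∀

    r⁻¹-at : ∀ m {m′} → m′ ≡.≡ m → r⁻¹ m′ ≈ r⁻¹ m
    r⁻¹-at m eq = reflexive (≡.cong r⁻¹ eq)

    -- The recurrence `C-suc` at the fold: [2n+1 choose n+1] equals [2n+1 choose n], so the
    -- neighbour at k = -1 is `C n 0` again.
    C-zero : ∀ n → C (suc n) 0 ≈
      (1# + p ^ (2 ℕ.* n ℕ.+ 2)) * C n 0 + p ^ (n ℕ.+ 1) * C n 0 + p ^ (n ℕ.+ 2) * C n 1
    C-zero n = begin
      C (suc n) 0
        ≈⟨ *-cong (*-congʳ (trans (r-2n+3 n) (*-cong (*-congˡ (+-congˡ (-‿cong p^2n+2))) (+-congˡ (-‿cong (*-congˡ p^2n+2))))))
                  (r⁻¹-at (2 ℕ.+ n) (e₀ n)) ⟩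
      ρ * (1# - P * P) * (1# - p * (P * P)) * x * y
        ≈⟨ solve 5 (λ p P ρ x y →
             ρ :* (con 1 :- P :* P) :* (con 1 :- p :* (P :* P)) :* x :* y :=
             (con 1 :+ P :* P) :* (ρ :* ((con 1 :- P) :* x) :* ((con 1 :- p :* P) :* y)) :+
             P :* (ρ :* ((con 1 :- P) :* x) :* ((con 1 :- p :* P) :* y)) :+
             P :* (ρ :* ((p :- P) :* ((con 1 :- P) :* x)) :* y)) refl p P ρ x y ⟩
      (1# + P * P) * (ρ * ((1# - P) * x) * ((1# - p * P) * y)) + P * (ρ * ((1# - P) * x) * ((1# - p * P) * y)) +
        P * (ρ * ((p - P) * ((1# - P) * x)) * y)
        ≈⟨ +-cong (+-cong (*-cong (+-congˡ (sym p^2n+2)) C₀) (*-cong p^n+1 C₀)) C₁ ⟩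
      (1# + p ^ (2 ℕ.* n ℕ.+ 2)) * C n 0 + p ^ (n ℕ.+ 1) * C n 0 + p ^ (n ℕ.+ 2) * C n 1 ∎
      where
      P ρ x y : Carrier
      P = p ^ suc n
      ρ = r (2 ℕ.* n ℕ.+ 1)
      x = r⁻¹ (suc n)
      y = r⁻¹ (2 ℕ.+ n)

      e₀ : ∀ n → suc n ℕ.+ 0 ℕ.+ 1 ≡.≡ 2 ℕ.+ n
      e₀ = ℕ.solve-∀
      e₁ : ∀ n → 2 ℕ.* n ℕ.+ 2 ≡.≡ suc n ℕ.+ suc n
      e₁ = ℕ.solve-∀
      e₂ : ∀ n → n ℕ.+ 0 ℕ.+ 1 ≡.≡ suc n
      e₂ = ℕ.solve-∀
      e₃ : ∀ n → n ℕ.+ 1 ℕ.+ 1 ≡.≡ 2 ℕ.+ n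
      e₃ = ℕ.solve-∀

      p^2n+2 : p ^ (2 ℕ.* n ℕ.+ 2) ≈ P * P
      p^2n+2 = trans (reflexive (≡.cong (p ^_) (e₁ n))) (^-homo-* p (suc n) (suc n))

      p^n+1 : P ≈ p ^ (n ℕ.+ 1)
      p^n+1 = reflexive (≡.cong (p ^_) (ℕ.+-comm 1 n))

      C₀ : ρ * ((1# - P) * x) * ((1# - p * P) * y) ≈ C n 0
      C₀ = *-cong (*-congˡ (r⁻¹-suc n)) (trans (r⁻¹-suc (suc n)) (sym (r⁻¹-at (suc n) (e₂ n))))

      C₁ : P * (ρ * ((p - P) * ((1# - P) * x)) * y) ≈ p ^ (n ℕ.+ 2) * C n 1
      C₁ = begin
        P * (ρ * ((p - P) * ((1# - P) * x)) * y)   ≈⟨ *-congˡ (*-congʳ (*-congˡ (s-+-2 0 (suc n)))) ⟨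
        P * (ρ * (p * s n 1) * y)
          ≈⟨ solve 5 (λ p P ρ s y → P :* (ρ :* (p :* s) :* y) := p :* P :* (ρ :* s :* y)) refl p P ρ (s n 1) y ⟩
        p * P * (ρ * s n 1 * y)
          ≈⟨ *-cong (reflexive (≡.cong (p ^_) (ℕ.+-comm 2 n))) (*-congˡ (sym (r⁻¹-at (2 ℕ.+ n) (e₃ n)))) ⟩
        p ^ (n ℕ.+ 2) * C n 1                      ∎

    -- Pascal's rule applied twice, from row 2n + 1 to row 2n + 3. For j ≤ n, writing n = j + i puts
    -- all three binomials over the common denominators x and y, and a polynomial identity in P =
    -- p^i and K = p^(n+j+2) remains.
    C-suc : ∀ n j → C (suc n) (suc j) ≈
      (1# + p ^ (2 ℕ.* n ℕ.+ 2)) * C n (suc j) + p ^ (n ∸ j) * C n j + p ^ (n ℕ.+ j ℕ.+ 3) * C n (suc (suc j))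
    C-suc n j with ℕ.≤-<-connex j n
    ... | inj₂ n<j = begin
      C (suc n) (suc j)                           ≈⟨ C-> (suc n) (suc j) (s≤s n<j) ⟩
      0#                                          ≈⟨ solve 3 (λ a b c → con 0 := a :* con 0 :+ b :* con 0 :+ c :* con 0) refl _ _ _ ⟩
      (1# + p ^ (2 ℕ.* n ℕ.+ 2)) * 0# + p ^ (n ∸ j) * 0# + p ^ (n ℕ.+ j ℕ.+ 3) * 0#
        ≈⟨ +-cong (+-cong (*-congˡ (C-> n (suc j) (ℕ.m<n⇒m<1+n n<j))) (*-congˡ (C-> n j n<j)))
                  (*-congˡ (C-> n (suc (suc j)) (ℕ.m<n⇒m<1+n (ℕ.m<n⇒m<1+n n<j)))) ⟨
      _                                           ∎
    ... | inj₁ j≤n = ≡.subst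
      (λ n → C (suc n) (suc j) ≈
        (1# + p ^ (2 ℕ.* n ℕ.+ 2)) * C n (suc j) + p ^ (n ∸ j) * C n j + p ^ (n ℕ.+ j ℕ.+ 3) * C n (suc (suc j)))
      (ℕ.m+[n∸m]≡n j≤n) (shifted (n ∸ j))
      where
      shifted : ∀ i → let n = j ℕ.+ i in C (suc n) (suc j) ≈
        (1# + p ^ (2 ℕ.* n ℕ.+ 2)) * C n (suc j) + p ^ (n ∸ j) * C n j + p ^ (n ℕ.+ j ℕ.+ 3) * C n (suc (suc j))
      shifted i = begin
        C (suc m) (suc j)
          ≈⟨ *-cong (*-cong (trans (r-2n+3 m) (*-cong (*-congˡ (+-congˡ (-‿cong p^2m+2))) (+-congˡ (-‿cong (*-congˡ p^2m+2)))))
                            (s-+ j i))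
                    (r⁻¹-at (m ℕ.+ j ℕ.+ 3) (e₀ m j)) ⟩
        ρ * (1# - P * K) * (1# - p * (P * K)) * x * y
          ≈⟨ solve 6 (λ p P K ρ x y →
               ρ :* (con 1 :- P :* K) :* (con 1 :- p :* (P :* K)) :* x :* y :=
               (con 1 :+ P :* K) :* (ρ :* ((con 1 :- P) :* x) :* ((con 1 :- p :* K) :* y)) :+
               P :* (ρ :* x :* ((con 1 :- K) :* ((con 1 :- p :* K) :* y))) :+
               K :* (ρ :* ((p :- P) :* ((con 1 :- P) :* x)) :* y)) refl p P K ρ x y ⟩
        (1# + P * K) * (ρ * ((1# - P) * x) * ((1# - p * K) * y)) +
        P * (ρ * x * ((1# - K) * ((1# - p * K) * y))) + K * (ρ * ((p - P) * ((1# - P) * x)) * y)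
          ≈⟨ +-cong (+-cong (*-cong (+-congˡ (sym p^2m+2)) (*-cong (*-congˡ (sym (s-+-1 j i))) r⁻¹₁))
                            (*-cong (reflexive (≡.cong (p ^_) (≡.sym (ℕ.m+n∸m≡n j i)))) (*-cong (*-congˡ (sym (s-+ j i))) r⁻¹₂)))
                    C₂ ⟩
        _ ∎
        where
        m : ℕ
        m = j ℕ.+ i
        P K ρ x y : Carrier
        P = p ^ i
        K = p ^ (m ℕ.+ j ℕ.+ 2)
        ρ = r (2 ℕ.* m ℕ.+ 1)
        x = r⁻¹ i
        y = r⁻¹ (m ℕ.+ j ℕ.+ 3)

        e₀ : ∀ m j → suc m ℕ.+ suc j ℕ.+ 1 ≡.≡ m ℕ.+ j ℕ.+ 3
        e₀ = ℕ.solve-∀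
        e₁ : ∀ j i → 2 ℕ.* (j ℕ.+ i) ℕ.+ 2 ≡.≡ i ℕ.+ (j ℕ.+ i ℕ.+ j ℕ.+ 2)
        e₁ = ℕ.solve-∀
        e₂ : ∀ m j → m ℕ.+ j ℕ.+ 3 ≡.≡ suc (m ℕ.+ j ℕ.+ 2)
        e₂ = ℕ.solve-∀
        e₃ : ∀ m j → m ℕ.+ suc j ℕ.+ 1 ≡.≡ m ℕ.+ j ℕ.+ 2
        e₃ = ℕ.solve-∀
        e₄ : ∀ m j → m ℕ.+ j ℕ.+ 2 ≡.≡ suc (m ℕ.+ j ℕ.+ 1)
        e₄ = ℕ.solve-∀
        e₅ : ∀ m j → m ℕ.+ suc (suc j) ℕ.+ 1 ≡.≡ m ℕ.+ j ℕ.+ 3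
        e₅ = ℕ.solve-∀

        p^2m+2 : p ^ (2 ℕ.* m ℕ.+ 2) ≈ P * K
        p^2m+2 = trans (reflexive (≡.cong (p ^_) (e₁ j i))) (^-homo-* p i (m ℕ.+ j ℕ.+ 2))

        r⁻¹-2 : (1# - p * K) * y ≈ r⁻¹ (m ℕ.+ j ℕ.+ 2)
        r⁻¹-2 = trans (*-congˡ (r⁻¹-at (suc (m ℕ.+ j ℕ.+ 2)) (e₂ m j))) (r⁻¹-suc (m ℕ.+ j ℕ.+ 2))

        r⁻¹₁ : (1# - p * K) * y ≈ r⁻¹ (m ℕ.+ suc j ℕ.+ 1)
        r⁻¹₁ = trans r⁻¹-2 (sym (r⁻¹-at _ (e₃ m j)))

        r⁻¹₂ : (1# - K) * ((1# - p * K) * y) ≈ r⁻¹ (m ℕ.+ j ℕ.+ 1)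
        r⁻¹₂ = begin
          (1# - K) * ((1# - p * K) * y)     ≈⟨ *-congˡ r⁻¹-2 ⟩
          (1# - K) * r⁻¹ (m ℕ.+ j ℕ.+ 2)
            ≈⟨ reflexive (≡.cong (λ e → (1# - p ^ e) * r⁻¹ e) (e₄ m j)) ⟩
          _                                 ≈⟨ r⁻¹-suc (m ℕ.+ j ℕ.+ 1) ⟩
          r⁻¹ (m ℕ.+ j ℕ.+ 1)               ∎

        C₂ : K * (ρ * ((p - P) * ((1# - P) * x)) * y) ≈ p ^ (m ℕ.+ j ℕ.+ 3) * C m (suc (suc j))
        C₂ = begin
          K * (ρ * ((p - P) * ((1# - P) * x)) * y)    ≈⟨ *-congˡ (*-congʳ (*-congˡ (s-+-2 j i))) ⟨
          K * (ρ * (p * s m (suc (suc j))) * y)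
            ≈⟨ solve 5 (λ p K ρ s y → K :* (ρ :* (p :* s) :* y) := p :* K :* (ρ :* s :* y)) refl p K ρ (s m (suc (suc j))) y ⟩
          p * K * (ρ * s m (suc (suc j)) * y)
            ≈⟨ *-cong (reflexive (≡.cong (p ^_) (≡.sym (e₂ m j)))) (*-congˡ (sym (r⁻¹-at _ (e₅ m j)))) ⟩
          p ^ (m ℕ.+ j ℕ.+ 3) * C m (suc (suc j))     ∎

    private
      module _ (a b d : ℕ → Carrier) (c : Carrier) (W : ℕ → Carrier) where

        shifted-coefficient : ℕ → Carrier
        shifted-coefficient zero    = c * a 0 + d 0 + d 1
        shifted-coefficient (suc k) = c * a (suc k) + b k + d (suc (suc k))

        shifted-term : ℕ → Carrier
        shifted-term zero    = c * (a 0 * W 0) + (b 0 * W 1 + d 0 * W 0)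
        shifted-term (suc k) = c * (a (suc k) * W (suc k)) + (b (suc k) * W (suc (suc k)) + d (suc k) * W k)

        -- Sorts the sum by W: b moves up one index and d down one. At k = 0 the lower neighbour is
        -- W 0 again, because T (k+1) + T (-k) is unchanged under k ↦ -1 - k. Truncation leaves two
        -- boundary terms.
        ∑<-shifted : ∀ M → ∑< (suc M) shifted-term ≈
          ∑< (suc M) (λ k → shifted-coefficient k * W k) + (b M * W (suc M) - d (suc M) * W M)
        ∑<-shifted zero    =
          solve 7 (λ c a b d d′ w w′ →
            con 0 :+ (c :* (a :* w) :+ (b :* w′ :+ d :* w)) :=
            (con 0 :+ (c :* a :+ d :+ d′) :* w) :+ (b :* w′ :- d′ :* w))
            refl c (a 0) (b 0) (d 0) (d 1) (W 0) (W 1)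
        ∑<-shifted (suc M) = begin
          ∑< (suc M) shifted-term + shifted-term (suc M) ≈⟨ +-congʳ (∑<-shifted M) ⟩
          _
            ≈⟨ prove (S ∷ c ∷ a (suc M) ∷ b M ∷ b (suc M) ∷ d (suc M) ∷ d (2 ℕ.+ M) ∷ W M ∷ W (suc M) ∷ W (2 ℕ.+ M) ∷ [])
                 (v (# 0) :+ (v (# 3) :* v (# 8) :- v (# 5) :* v (# 7)) :+ (v (# 1) :* (v (# 2) :* v (# 8)) :+ (v (# 4) :* v (# 9) :+ v (# 5) :* v (# 7))))
                 (v (# 0) :+ (v (# 1) :* v (# 2) :+ v (# 3) :+ v (# 6)) :* v (# 8) :+ (v (# 4) :* v (# 9) :- v (# 6) :* v (# 8)))
                 refl ⟩
          _ ∎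
          where
          v : Fin 10 → Polynomial 10
          v = var
          S : Carrier
          S = ∑< (suc M) (λ k → shifted-coefficient k * W k)

    -- W k stands for T (k+1) + T (−k), where T k = xᵏ pᵏ⁽ᵏ⁻¹⁾ᐟ², and X for p x + 1/x.
    module _ (X : Carrier) (W L : ℕ → Carrier)
      (X-W-zero : X * W 0 ≈ W 1 + p * W 0)
      (X-W-suc : ∀ k → p ^ suc k * (X * W (suc k)) ≈ W (suc (suc k)) + p ^ (2 ℕ.* k ℕ.+ 3) * W k)
      (L-zero : L 0 ≈ W 0)
      (L-suc : ∀ n → L (suc n) ≈ (1# + p ^ (2 ℕ.* n ℕ.+ 2) + p ^ n * X) * L n)
      where

      -- In the generic case L n is (1 + x) times the product of (1 + pʲx)(1 + pʲ/x) for 1 ≤ j ≤ n.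
      -- Pairing T (k+1) with T (-k) lets x act only through p(x + 1/x), and `X-W-suc` carries a
      -- factor p^(k+1), so no negative powers are needed. The new factor acts on the coefficients
      -- by the recurrences for C.
      finite-theta : ∀ n → L n ≈ ∑< (suc n) (λ k → C n k * W k)
      finite-theta zero    = begin
        L 0                      ≈⟨ L-zero ⟩
        W 0                      ≈⟨ solve 1 (λ w → w := con 0 :+ con 1 :* w) refl (W 0) ⟩
        0# + 1# * W 0            ≈⟨ +-congˡ (*-congʳ C₀₀) ⟨
        0# + C 0 0 * W 0         ∎
        where
        C₀₀ : C 0 0 ≈ 1#
        C₀₀ = begin
          r 1 * r⁻¹ 0 * r⁻¹ 1    ≈⟨ *-congʳ (*-congˡ (trans (sym (*-identityˡ _)) (r-inverse 0))) ⟩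
          r 1 * 1# * r⁻¹ 1       ≈⟨ *-congʳ (*-identityʳ _) ⟩
          r 1 * r⁻¹ 1            ≈⟨ r-inverse 1 ⟩
          1#                     ∎
      finite-theta (suc n) = begin
        L (suc n)                                       ≈⟨ L-suc n ⟩
        (c + p ^ n * X) * L n                           ≈⟨ *-congˡ (finite-theta n) ⟩
        (c + p ^ n * X) * ∑< (suc n) (λ k → C n k * W k)
          -- The sum is extended by its vanishing term k = n + 1 to the range of the next row.
          ≈⟨ *-congˡ (trans (sym (+-identityʳ _)) (+-congˡ (sym (trans (*-congʳ (C-> n (suc n) ℕ.≤-refl)) (zeroˡ _))))) ⟩
        (c + p ^ n * X) * ∑< (2 ℕ.+ n) (λ k → C n k * W k)   ≈⟨ *-∑< (2 ℕ.+ n) _ _ ⟩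
        ∑< (2 ℕ.+ n) (λ k → (c + p ^ n * X) * (C n k * W k)) ≈⟨ ∑<-cong (2 ℕ.+ n) (λ k _ → term k) ⟩
        ∑< (2 ℕ.+ n) (shifted-term (C n) b d c W)     ≈⟨ ∑<-shifted (C n) b d c W (suc n) ⟩
        ∑< (2 ℕ.+ n) (λ k → shifted-coefficient (C n) b d c W k * W k) + (b (suc n) * W (2 ℕ.+ n) - d (2 ℕ.+ n) * W (suc n))
          ≈⟨ +-cong (∑<-cong (2 ℕ.+ n) λ k _ → *-congʳ (sym (coefficient k)))
               (+-cong (*-congʳ (b-> (suc n) ℕ.≤-refl)) (-‿cong (*-congʳ (d-> (2 ℕ.+ n) (ℕ.m<n⇒m<1+n ℕ.≤-refl))))) ⟩
        ∑< (2 ℕ.+ n) (λ k → C (suc n) k * W k) + (0# * W (2 ℕ.+ n) - 0# * W (suc n))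
          ≈⟨ solve 3 (λ x y z → x :+ (con 0 :* y :- con 0 :* z) := x) refl _ _ _ ⟩
        ∑< (2 ℕ.+ n) (λ k → C (suc n) k * W k)          ∎
        where
        c : Carrier
        c = 1# + p ^ (2 ℕ.* n ℕ.+ 2)

        b d : ℕ → Carrier
        b k = p ^ (n ∸ k) * C n k
        d k = p ^ (n ℕ.+ k ℕ.+ 1) * C n k

        b-> : ∀ k → n < k → b k ≈ 0#
        b-> k n<k = trans (*-congˡ (C-> n k n<k)) (zeroʳ _)

        d-> : ∀ k → n < k → d k ≈ 0#
        d-> k n<k = trans (*-congˡ (C-> n k n<k)) (zeroʳ _)

        coefficient : ∀ k → C (suc n) k ≈ shifted-coefficient (C n) b d c W k
        coefficient zero    = trans (C-zero n)
          (+-cong (+-congˡ (*-congʳ (reflexive (≡.cong (p ^_) (e₁ n))))) (*-congʳ (reflexive (≡.cong (p ^_) (e₂ n)))))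
          where
          e₁ : ∀ n → n ℕ.+ 1 ≡.≡ n ℕ.+ 0 ℕ.+ 1
          e₁ = ℕ.solve-∀
          e₂ : ∀ n → n ℕ.+ 2 ≡.≡ n ℕ.+ 1 ℕ.+ 1
          e₂ = ℕ.solve-∀
        coefficient (suc k) = trans (C-suc n k) (+-congˡ (*-congʳ (reflexive (≡.cong (p ^_) (e n k)))))
          where
          e : ∀ n k → n ℕ.+ k ℕ.+ 3 ≡.≡ n ℕ.+ suc (suc k) ℕ.+ 1
          e = ℕ.solve-∀

        -- Trades pⁿ for pᵏ. For k > n the exponent n ∸ k is cut off at 0, harmlessly, as `C n k`
        -- vanishes there.
        scale : ∀ k → C n k * p ^ n ≈ b k * p ^ k
        scale k with ℕ.≤-<-connex k n
        ... | inj₂ n<k = trans (*-congʳ (C-> n k n<k)) (trans (zeroˡ _) (sym (trans (*-congʳ (b-> k n<k)) (zeroˡ _))))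
        ... | inj₁ k≤n = begin
          C n k * p ^ n                   ≡⟨ ≡.cong (λ m → C n k * p ^ m) (ℕ.m∸n+n≡m k≤n) ⟨
          C n k * p ^ (n ∸ k ℕ.+ k)       ≈⟨ *-congˡ (^-homo-* p (n ∸ k) k) ⟩
          C n k * (p ^ (n ∸ k) * p ^ k)   ≈⟨ solve 3 (λ x y z → x :* (y :* z) := y :* x :* z) refl _ _ _ ⟩
          b k * p ^ k                     ∎

        split : ∀ k → (c + p ^ n * X) * (C n k * W k) ≈ c * (C n k * W k) + b k * (p ^ k * (X * W k))
        split k = begin
          (c + p ^ n * X) * (C n k * W k)
            ≈⟨ solve 5 (λ c p x a w → (c :+ p :* x) :* (a :* w) := c :* (a :* w) :+ a :* p :* (x :* w)) refl
                 c (p ^ n) X (C n k) (W k) ⟩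
          c * (C n k * W k) + C n k * p ^ n * (X * W k)
            ≈⟨ +-congˡ (trans (*-congʳ (scale k)) (*-assoc _ _ _)) ⟩
          c * (C n k * W k) + b k * (p ^ k * (X * W k)) ∎

        term : ∀ k → (c + p ^ n * X) * (C n k * W k) ≈ shifted-term (C n) b d c W k
        term zero    = trans (split 0) (+-congˡ (begin
          b 0 * (1# * (X * W 0))          ≈⟨ *-congˡ (trans (*-identityˡ _) X-W-zero) ⟩
          b 0 * (W 1 + p * W 0)
            ≈⟨ solve 5 (λ a q w′ w p → q :* a :* (w′ :+ p :* w) := q :* a :* w′ :+ p :* q :* a :* w) refl
                 (C n 0) (p ^ n) (W 1) (W 0) p ⟩
          b 0 * W 1 + p ^ suc n * C n 0 * W 0
            ≈⟨ +-congˡ (*-congʳ (*-congʳ (reflexive (≡.cong (p ^_) (e n))))) ⟩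
          b 0 * W 1 + d 0 * W 0           ∎))
          where
          e : ∀ n → suc n ≡.≡ n ℕ.+ 0 ℕ.+ 1
          e = ℕ.solve-∀
        term (suc k) = trans (split (suc k)) (+-congˡ (begin
          b (suc k) * (p ^ suc k * (X * W (suc k)))       ≈⟨ *-congˡ (X-W-suc k) ⟩
          b (suc k) * (W (2 ℕ.+ k) + p ^ (2 ℕ.* k ℕ.+ 3) * W k)
            ≡⟨ ≡.cong (λ e → b (suc k) * (W (2 ℕ.+ k) + p ^ e * W k)) (e₁ k) ⟩
          b (suc k) * (W (2 ℕ.+ k) + p ^ (suc k ℕ.+ (k ℕ.+ 2)) * W k)
            ≈⟨ *-congˡ (+-congˡ (*-congʳ (^-homo-* p (suc k) (k ℕ.+ 2)))) ⟩
          b (suc k) * (W (2 ℕ.+ k) + p ^ suc k * p ^ (k ℕ.+ 2) * W k)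
            ≈⟨ solve 5 (λ b u y z w → b :* (u :+ y :* z :* w) := b :* u :+ b :* y :* z :* w) refl _ _ _ _ _ ⟩
          b (suc k) * W (2 ℕ.+ k) + b (suc k) * p ^ suc k * p ^ (k ℕ.+ 2) * W k
            ≈⟨ +-congˡ (*-congʳ (*-congʳ (scale (suc k)))) ⟨
          b (suc k) * W (2 ℕ.+ k) + C n (suc k) * p ^ n * p ^ (k ℕ.+ 2) * W k
            ≈⟨ +-congˡ (*-congʳ (trans (*-assoc _ _ _) (trans (*-comm _ _) (*-congʳ (sym (^-homo-* p n (k ℕ.+ 2))))))) ⟩
          b (suc k) * W (2 ℕ.+ k) + p ^ (n ℕ.+ (k ℕ.+ 2)) * C n (suc k) * W k
            ≡⟨ ≡.cong (λ e → b (suc k) * W (2 ℕ.+ k) + p ^ e * C n (suc k) * W k) (e₂ n k) ⟩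
          b (suc k) * W (2 ℕ.+ k) + d (suc k) * W k       ∎))
          where
          e₁ : ∀ k → 2 ℕ.* k ℕ.+ 3 ≡.≡ suc k ℕ.+ (k ℕ.+ 2)
          e₁ = ℕ.solve-∀
          e₂ : ∀ n k → n ℕ.+ (k ℕ.+ 2) ≡.≡ n ℕ.+ suc k ℕ.+ 1
          e₂ = ℕ.solve-∀

  -- τ k = k(k − 1)/2
  τ : ℕ → ℕ
  τ zero    = 0
  τ (suc k) = τ k ℕ.+ k

  sign : ℕ → Carrier
  sign zero    = 1#
  sign (suc k) = - sign k

  -- The case p = t^(α+β), x = -t^α, so that L n tends to ∏ (1 - t^α pʲ)(1 - t^β pʲ) over j ≥ 0. The
  -- choice α = 1, β = 2 leads to Euler's pentagonal series, and α = β = 1 to Gauss's series for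
  -- E₁²/E₂.
  module TripleProduct (t : Carrier) (α β : ℕ) where

    a b : ℕ → ℕ
    a k = α ℕ.* τ k ℕ.+ β ℕ.* τ (1 ℕ.+ k)
    b k = α ℕ.* τ (2 ℕ.+ k) ℕ.+ β ℕ.* τ (1 ℕ.+ k)

    p X : Carrier
    p = t ^ (α ℕ.+ β)
    X = - (t ^ (2 ℕ.* α ℕ.+ β) + t ^ β)

    W L : ℕ → Carrier
    W k = sign k * (t ^ a k - t ^ b k)
    L zero    = 1# - t ^ α
    L (suc n) = L n * ((1# - t ^ (α ℕ.+ (α ℕ.+ β) ℕ.* suc n)) * (1# - t ^ (β ℕ.+ (α ℕ.+ β) ℕ.* n)))

    private
      p^ : ∀ n → p ^ n ≈ t ^ ((α ℕ.+ β) ℕ.* n)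
      p^ n = ^-assocʳ t (α ℕ.+ β) n

      t^-+ : ∀ {m} i j → m ≡.≡ i ℕ.+ j → t ^ m ≈ t ^ i * t ^ j
      t^-+ i j eq = trans (reflexive (≡.cong (t ^_) eq)) (^-homo-* t i j)

      t^-+₃ : ∀ {m} i j k → m ≡.≡ i ℕ.+ j ℕ.+ k → t ^ m ≈ t ^ i * t ^ j * t ^ k
      t^-+₃ i j k eq = trans (t^-+ (i ℕ.+ j) k eq) (*-congʳ (^-homo-* t i j))

      p^*t^ : ∀ {i} n j → (α ℕ.+ β) ℕ.* n ℕ.+ j ≡.≡ i → p ^ n * t ^ j ≈ t ^ i
      p^*t^ n j eq = trans (*-congʳ (p^ n)) (trans (sym (^-homo-* t ((α ℕ.+ β) ℕ.* n) j)) (reflexive (≡.cong (t ^_) eq)))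

    W-zero : W 0 ≈ 1# - t ^ α
    W-zero = begin
      1# * (t ^ a 0 - t ^ b 0) ≈⟨ *-identityˡ _ ⟩
      t ^ a 0 - t ^ b 0
        ≡⟨ ≡.cong₂ (λ i j → t ^ i - t ^ j) (e₁ α β) (e₂ α β) ⟩
      1# - t ^ α               ∎
      where
      e₁ : ∀ α β → α ℕ.* 0 ℕ.+ β ℕ.* 0 ≡.≡ 0
      e₁ = ℕ.solve-∀
      e₂ : ∀ α β → α ℕ.* 1 ℕ.+ β ℕ.* 0 ≡.≡ α
      e₂ = ℕ.solve-∀

    X-W-zero : X * W 0 ≈ W 1 + p * W 0
    X-W-zero = begin
      X * W 0                                   ≈⟨ *-cong (-‿cong (+-congʳ (t^-+₃ α α β (e₁ α β)))) W-zero ⟩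
      - (x * x * y + y) * (1# - x)
        ≈⟨ solve 2 (λ x y → :- (x :* x :* y :+ y) :* (con 1 :- x) :=
             :- con 1 :* (y :- x :* x :* x :* y) :+ x :* y :* (con 1 :- x)) refl x y ⟩
      - 1# * (y - x * x * x * y) + x * y * (1# - x)
        ≈⟨ +-cong (*-congˡ (+-cong (reflexive (≡.cong (t ^_) (e₂ α β))) (-‿cong t^b₁))) (*-cong (^-homo-* t α β) W-zero) ⟨
      W 1 + p * W 0                             ∎
      where
      x y : Carrier
      x = t ^ α
      y = t ^ β
      e₁ : ∀ α β → 2 ℕ.* α ℕ.+ β ≡.≡ α ℕ.+ α ℕ.+ β
      e₁ = ℕ.solve-∀
      e₂ : ∀ α β → α ℕ.* 0 ℕ.+ β ℕ.* 1 ≡.≡ β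
      e₂ = ℕ.solve-∀
      e₃ : ∀ α β → α ℕ.* 3 ℕ.+ β ℕ.* 1 ≡.≡ (α ℕ.+ α) ℕ.+ α ℕ.+ β
      e₃ = ℕ.solve-∀
      t^b₁ : t ^ b 1 ≈ x * x * x * y
      t^b₁ = trans (t^-+₃ (α ℕ.+ α) α β (e₃ α β)) (*-congʳ (*-congʳ (^-homo-* t α α)))

    X-W-suc : ∀ k → p ^ suc k * (X * W (suc k)) ≈ W (suc (suc k)) + p ^ (2 ℕ.* k ℕ.+ 3) * W k
    X-W-suc k = begin
      p ^ suc k * (X * W (suc k))               ≈⟨ *-congʳ (p^ (suc k)) ⟩
      z * (- (x + y) * (- σ * (u - v)))
        ≈⟨ solve 6 (λ x y z u v σ → z :* (:- (x :+ y) :* (:- σ :* (u :- v))) :=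
             :- :- σ :* (u :* z :* y :- v :* z :* x) :+ σ :* (u :* z :* x :- v :* z :* y)) refl x y z u v σ ⟩
      - - σ * (u * z * y - v * z * x) + σ * (u * z * x - v * z * y)
        ≈⟨ +-cong (*-congˡ (+-cong
              (t^-+₃ (a (suc k)) ((α ℕ.+ β) ℕ.* suc k) β (e₁ α β (τ k) k))
              (-‿cong (t^-+₃ (b (suc k)) ((α ℕ.+ β) ℕ.* suc k) (2 ℕ.* α ℕ.+ β) (e₂ α β (τ k) k)))))
            (*-congˡ (+-cong (t^-+₃ (a (suc k)) ((α ℕ.+ β) ℕ.* suc k) (2 ℕ.* α ℕ.+ β) (e₃ α β (τ k) k))
              (-‿cong (t^-+₃ (b (suc k)) ((α ℕ.+ β) ℕ.* suc k) β (e₄ α β (τ k) k))))) ⟨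
      W (suc (suc k)) + σ * (t ^ (q k ℕ.+ a k) - t ^ (q k ℕ.+ b k))
        ≈⟨ +-congˡ (*-congˡ (+-cong (^-homo-* t (q k) (a k)) (-‿cong (^-homo-* t (q k) (b k))))) ⟩
      W (suc (suc k)) + σ * (t ^ q k * t ^ a k - t ^ q k * t ^ b k)
        ≈⟨ +-congˡ (solve 4 (λ σ p u v → σ :* (p :* u :- p :* v) := p :* (σ :* (u :- v))) refl _ _ _ _) ⟩
      W (suc (suc k)) + t ^ q k * W k           ≈⟨ +-congˡ (*-congʳ (p^ (2 ℕ.* k ℕ.+ 3))) ⟨
      W (suc (suc k)) + p ^ (2 ℕ.* k ℕ.+ 3) * W k ∎
      where
      x y z u v σ : Carrier
      x = t ^ (2 ℕ.* α ℕ.+ β)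
      y = t ^ β
      z = t ^ ((α ℕ.+ β) ℕ.* suc k)
      u = t ^ a (suc k)
      v = t ^ b (suc k)
      σ = sign k
      q : ℕ → ℕ
      q k = (α ℕ.+ β) ℕ.* (2 ℕ.* k ℕ.+ 3)

      e₁ : ∀ α β T k → α ℕ.* (T ℕ.+ k ℕ.+ suc k) ℕ.+ β ℕ.* (T ℕ.+ k ℕ.+ suc k ℕ.+ suc (suc k)) ≡.≡
        (α ℕ.* (T ℕ.+ k) ℕ.+ β ℕ.* (T ℕ.+ k ℕ.+ suc k)) ℕ.+ (α ℕ.+ β) ℕ.* suc k ℕ.+ β
      e₁ = ℕ.solve-∀
      e₂ : ∀ α β T k → α ℕ.* (T ℕ.+ k ℕ.+ suc k ℕ.+ suc (suc k) ℕ.+ suc (suc (suc k))) ℕ.+ β ℕ.* (T ℕ.+ k ℕ.+ suc k ℕ.+ suc (suc k)) ≡.≡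
        (α ℕ.* (T ℕ.+ k ℕ.+ suc k ℕ.+ suc (suc k)) ℕ.+ β ℕ.* (T ℕ.+ k ℕ.+ suc k)) ℕ.+ (α ℕ.+ β) ℕ.* suc k ℕ.+ (2 ℕ.* α ℕ.+ β)
      e₂ = ℕ.solve-∀
      e₃ : ∀ α β T k → (α ℕ.+ β) ℕ.* (2 ℕ.* k ℕ.+ 3) ℕ.+ (α ℕ.* T ℕ.+ β ℕ.* (T ℕ.+ k)) ≡.≡
        (α ℕ.* (T ℕ.+ k) ℕ.+ β ℕ.* (T ℕ.+ k ℕ.+ suc k)) ℕ.+ (α ℕ.+ β) ℕ.* suc k ℕ.+ (2 ℕ.* α ℕ.+ β)
      e₃ = ℕ.solve-∀
      e₄ : ∀ α β T k → (α ℕ.+ β) ℕ.* (2 ℕ.* k ℕ.+ 3) ℕ.+ (α ℕ.* (T ℕ.+ k ℕ.+ suc k) ℕ.+ β ℕ.* (T ℕ.+ k)) ≡.≡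
        (α ℕ.* (T ℕ.+ k ℕ.+ suc k ℕ.+ suc (suc k)) ℕ.+ β ℕ.* (T ℕ.+ k ℕ.+ suc k)) ℕ.+ (α ℕ.+ β) ℕ.* suc k ℕ.+ β
      e₄ = ℕ.solve-∀

    L-suc : ∀ n → L (suc n) ≈ (1# + p ^ (2 ℕ.* n ℕ.+ 2) + p ^ n * X) * L n
    L-suc n = begin
      L n * ((1# - u) * (1# - v))
        ≈⟨ solve 3 (λ l u v → l :* ((con 1 :- u) :* (con 1 :- v)) := (con 1 :+ u :* v :- (u :+ v)) :* l) refl (L n) u v ⟩
      (1# + u * v - (u + v)) * L n
        ≈⟨ *-congʳ (+-cong (+-congˡ uv≈) (-‿cong (+-cong u≈ v≈))) ⟩
      (1# + p ^ (2 ℕ.* n ℕ.+ 2) - (p ^ n * x + p ^ n * y)) * L n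
        ≈⟨ *-congʳ (+-congˡ (solve 3 (λ p x y → :- (p :* x :+ p :* y) := p :* (:- (x :+ y))) refl _ _ _)) ⟩
      (1# + p ^ (2 ℕ.* n ℕ.+ 2) + p ^ n * X) * L n ∎
      where
      x y u v : Carrier
      x = t ^ (2 ℕ.* α ℕ.+ β)
      y = t ^ β
      u = t ^ (α ℕ.+ (α ℕ.+ β) ℕ.* suc n)
      v = t ^ (β ℕ.+ (α ℕ.+ β) ℕ.* n)
      e₁ : ∀ α β n → (α ℕ.+ (α ℕ.+ β) ℕ.* suc n) ℕ.+ (β ℕ.+ (α ℕ.+ β) ℕ.* n) ≡.≡ (α ℕ.+ β) ℕ.* (2 ℕ.* n ℕ.+ 2)
      e₁ = ℕ.solve-∀
      e₂ : ∀ α β n → (α ℕ.+ β) ℕ.* n ℕ.+ (2 ℕ.* α ℕ.+ β) ≡.≡ α ℕ.+ (α ℕ.+ β) ℕ.* suc n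
      e₂ = ℕ.solve-∀
      uv≈ : u * v ≈ p ^ (2 ℕ.* n ℕ.+ 2)
      uv≈ = trans (sym (t^-+ (α ℕ.+ (α ℕ.+ β) ℕ.* suc n) (β ℕ.+ (α ℕ.+ β) ℕ.* n) (≡.sym (e₁ α β n)))) (sym (p^ (2 ℕ.* n ℕ.+ 2)))
      u≈ : u ≈ p ^ n * x
      u≈ = sym (p^*t^ n (2 ℕ.* α ℕ.+ β) (e₂ α β n))
      v≈ : v ≈ p ^ n * y
      v≈ = sym (p^*t^ n β (ℕ.+-comm _ β))

  -- The degenerate case x = -1, where T (k+1) + T (-k) is 0. Here W k is the quotient of that sum
  -- by 1 + x, evaluated at x = -1. The recurrences are homogeneous in W and L, so they survive the
  -- division; this gives Jacobi's series for the cube.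
  module CubeProduct (p : Carrier) where

    X : Carrier
    X = - (ι 2 * p)

    W L : ℕ → Carrier
    W k = sign k * (ι (2 ℕ.* k ℕ.+ 1) * p ^ τ (suc k))
    L n = (p !) n * (p !) n

    private
      ι-2k+ : ∀ c k → ι (2 ℕ.* k ℕ.+ c) ≈ ι 2 * ι k + ι c
      ι-2k+ c k = trans (ι-+ (2 ℕ.* k) c) (+-congʳ (ι-* 2 k))

      W≈ : ∀ c k j → 2 ℕ.* j ℕ.+ 1 ≡.≡ 2 ℕ.* k ℕ.+ c → W j ≈ sign j * ((ι 2 * ι k + ι c) * p ^ τ (suc j))
      W≈ c k j eq = *-congˡ (*-congʳ (trans (reflexive (≡.cong ι eq)) (ι-2k+ c k)))

    X-W-zero : X * W 0 ≈ W 1 + p * W 0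
    X-W-zero = solve 1 (λ p → :- (con 2 :* p) :* (con 1 :* (con 1 :* con 1)) :=
      :- con 1 :* (con 3 :* (p :* con 1)) :+ p :* (con 1 :* (con 1 :* con 1))) refl p

    X-W-suc : ∀ k → p ^ suc k * (X * W (suc k)) ≈ W (suc (suc k)) + p ^ (2 ℕ.* k ℕ.+ 3) * W k
    X-W-suc k = begin
      p ^ suc k * (X * W (suc k))               ≈⟨ *-congˡ (*-congˡ (W≈ 3 k (suc k) (e₁ k))) ⟩
      z * (- (ι 2 * p) * (- σ * ((ι 2 * κ + ι 3) * u)))
        ≈⟨ solve 5 (λ p z σ κ u → z :* (:- (con 2 :* p) :* (:- σ :* ((con 2 :* κ :+ con 3) :* u))) :=
             :- :- σ :* ((con 2 :* κ :+ con 5) :* (u :* (p :* z))) :+ σ :* ((con 2 :* κ :+ con 1) :* (u :* (p :* z))))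
             refl p z σ κ u ⟩
      - - σ * ((ι 2 * κ + ι 5) * (u * (p * z))) + σ * ((ι 2 * κ + ι 1) * (u * (p * z)))
        ≈⟨ +-cong (trans (*-congˡ (*-congˡ (sym (^-homo-* p (τ (2 ℕ.+ k)) (2 ℕ.+ k))))) (sym (W≈ 5 k (suc (suc k)) (e₂ k))))
                  (*-congˡ (*-congˡ p^)) ⟩
      W (suc (suc k)) + σ * ((ι 2 * κ + ι 1) * (p ^ (2 ℕ.* k ℕ.+ 3) * p ^ τ (suc k)))
        ≈⟨ +-congˡ (solve 4 (λ σ w P u → σ :* (w :* (P :* u)) := P :* (σ :* (w :* u))) refl _ _ _ _) ⟩
      W (suc (suc k)) + p ^ (2 ℕ.* k ℕ.+ 3) * (σ * ((ι 2 * κ + ι 1) * p ^ τ (suc k)))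
        ≈⟨ +-congˡ (*-congˡ (W≈ 1 k k ≡.refl)) ⟨
      W (suc (suc k)) + p ^ (2 ℕ.* k ℕ.+ 3) * W k ∎
      where
      z σ κ u : Carrier
      z = p ^ suc k
      σ = sign k
      κ = ι k
      u = p ^ τ (2 ℕ.+ k)
      e₁ : ∀ k → 2 ℕ.* suc k ℕ.+ 1 ≡.≡ 2 ℕ.* k ℕ.+ 3
      e₁ = ℕ.solve-∀
      e₂ : ∀ k → 2 ℕ.* suc (suc k) ℕ.+ 1 ≡.≡ 2 ℕ.* k ℕ.+ 5
      e₂ = ℕ.solve-∀
      e₃ : ∀ T k → T ℕ.+ k ℕ.+ suc k ℕ.+ suc (suc k) ≡.≡ 2 ℕ.* k ℕ.+ 3 ℕ.+ (T ℕ.+ k)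
      e₃ = ℕ.solve-∀
      p^ : u * (p * z) ≈ p ^ (2 ℕ.* k ℕ.+ 3) * p ^ τ (suc k)
      p^ = begin
        u * p ^ (2 ℕ.+ k)                 ≈⟨ ^-homo-* p (τ (2 ℕ.+ k)) (2 ℕ.+ k) ⟨
        p ^ (τ (2 ℕ.+ k) ℕ.+ (2 ℕ.+ k))   ≡⟨ ≡.cong (p ^_) (e₃ (τ k) k) ⟩
        p ^ (2 ℕ.* k ℕ.+ 3 ℕ.+ τ (suc k)) ≈⟨ ^-homo-* p (2 ℕ.* k ℕ.+ 3) (τ (suc k)) ⟩
        p ^ (2 ℕ.* k ℕ.+ 3) * p ^ τ (suc k) ∎

    L-zero : L 0 ≈ W 0
    L-zero = solve 0 (con 1 :* con 1 := con 1 :* (con 1 :* con 1)) refl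

    L-suc : ∀ n → L (suc n) ≈ (1# + p ^ (2 ℕ.* n ℕ.+ 2) + p ^ n * X) * L n
    L-suc n = begin
      (p !) n * (1# - p * z) * ((p !) n * (1# - p * z))
        ≈⟨ solve 3 (λ l p z → l :* (con 1 :- p :* z) :* (l :* (con 1 :- p :* z)) :=
             (con 1 :+ (p :* z) :* (p :* z) :+ z :* (:- (con 2 :* p))) :* (l :* l)) refl ((p !) n) p z ⟩
      (1# + p ^ suc n * p ^ suc n + z * X) * L n
        ≈⟨ *-congʳ (+-congʳ (+-congˡ (trans (sym (^-homo-* p (suc n) (suc n))) (reflexive (≡.cong (p ^_) (e n)))))) ⟩
      (1# + p ^ (2 ℕ.* n ℕ.+ 2) + p ^ n * X) * L n ∎
      where
      z : Carrier
      z = p ^ n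
      e : ∀ n → suc n ℕ.+ suc n ≡.≡ 2 ℕ.* n ℕ.+ 2
      e = ℕ.solve-∀

-- Third-order differential equations for theta sums

module ThetaEquations (R : CommutativeRing 0ℓ 0ℓ) (char7 : Characteristic7 R)
  (D : CommutativeRing.Carrier R → CommutativeRing.Carrier R) (isDerivation : IsDerivation R D) where

  open CommutativeRing R hiding (zero)
  open import Relation.Binary.Reasoning.Setoid setoid
  open Algebra.Properties.Semiring.Exp semiring using (_^_; ^-congˡ; ^-homo-*; ^-assocʳ)
  open Char7 R char7
  open FiniteTheta R char7
  open IsDerivation isDerivation
  open Derivation R char7 D isDerivation

  twist-+ : ∀ c f g → twist c (f + g) ≈ twist c f + twist c g
  twist-+ c f g = trans (+-congʳ (D-+ f g))
    (solve 5 (λ c f g f′ g′ → f′ :+ g′ :+ c :* (f :+ g) := (f′ :+ c :* f) :+ (g′ :+ c :* g)) refl c f g (D f) (D g))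

  twist-constant : ∀ c {k} → D k ≈ 0# → ∀ f → twist c (k * f) ≈ k * twist c f
  twist-constant c {k} D-k f = begin
    D (k * f) + c * (k * f)           ≈⟨ +-congʳ (trans (D-* k f) (+-congʳ (*-congʳ D-k))) ⟩
    0# * f + k * D f + c * (k * f)
      ≈⟨ solve 4 (λ k f f′ c → con 0 :* f :+ k :* f′ :+ c :* (k :* f) := k :* (f′ :+ c :* f)) refl k f (D f) c ⟩
    k * twist c f                     ∎

  twist³-cong : ∀ c {f g} → f ≈ g → twist³ c f ≈ twist³ c g
  twist³-cong c eq = twist-cong c (twist-cong c (twist-cong c eq))

  twist³-+ : ∀ c f g → twist³ c (f + g) ≈ twist³ c f + twist³ c g
  twist³-+ c f g = trans (twist-cong c (trans (twist-cong c (twist-+ c f g)) (twist-+ c _ _))) (twist-+ c _ _)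

  twist³-constant : ∀ c {k} → D k ≈ 0# → ∀ f → twist³ c (k * f) ≈ k * twist³ c f
  twist³-constant c D-k f = trans
    (twist-cong c (trans (twist-cong c (twist-constant c D-k f)) (twist-constant c D-k _))) (twist-constant c D-k _)

  twist³-constant-eigen : ∀ c {λ′ f} → D λ′ ≈ 0# → twist c f ≈ λ′ * f → twist³ c f ≈ λ′ ^ 3 * f
  twist³-constant-eigen c {λ′} {f} D-λ eq = begin
    twist c (twist c (twist c f))     ≈⟨ twist-cong c (twist-cong c eq) ⟩
    twist c (twist c (λ′ * f))        ≈⟨ twist-cong c (trans (twist-constant c D-λ f) (*-congˡ eq)) ⟩
    twist c (λ′ * (λ′ * f))           ≈⟨ trans (twist-constant c D-λ _) (*-congˡ (trans (twist-constant c D-λ f) (*-congˡ eq))) ⟩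
    λ′ * (λ′ * (λ′ * f))              ≈⟨ solve 2 (λ l f → l :* (l :* (l :* f)) := l :^ 3 :* f) refl λ′ f ⟩
    λ′ ^ 3 * f                        ∎

  D-sign : ∀ k → D (sign k) ≈ 0#
  D-sign zero    = D-1
  D-sign (suc k) = trans (D-neg (sign k)) (trans (-‿cong (D-sign k)) (solve 0 (:- con 0 := con 0) refl))

  twist³-0 : ∀ c → twist³ c 0# ≈ 0#
  twist³-0 c = begin
    twist³ c 0#          ≈⟨ twist³-cong c (zeroˡ 0#) ⟨
    twist³ c (0# * 0#)   ≈⟨ twist³-constant c D-0 0# ⟩
    0# * twist³ c 0#     ≈⟨ zeroˡ _ ⟩
    0#                    ∎

  ∑<-+ : ∀ n f g → ∑< n f + ∑< n g ≈ ∑< n (λ k → f k + g k)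
  ∑<-+ zero    f g = +-identityˡ 0#
  ∑<-+ (suc n) f g = trans (solve 4 (λ a b c d → (a :+ b) :+ (c :+ d) := (a :+ c) :+ (b :+ d)) refl _ _ _ _)
    (+-congʳ (∑<-+ n f g))

  ∑<-neg : ∀ n f → - ∑< n f ≈ ∑< n (λ k → - f k)
  ∑<-neg zero    f = solve 0 (:- con 0 := con 0) refl
  ∑<-neg (suc n) f = trans (solve 2 (λ a b → :- (a :+ b) := :- a :+ :- b) refl _ _) (+-congʳ (∑<-neg n f))

  twist³-∑< : ∀ c n f → twist³ c (∑< n f) ≈ ∑< n (λ k → twist³ c (f k))
  twist³-∑< c zero    f = twist³-0 c
  twist³-∑< c (suc n) f = trans (twist³-+ c _ _) (+-congʳ (twist³-∑< c n f))

  -- Serves the equations in which 7N terms collapse to N: of seven consecutive values of k few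
  -- contributions survive, and those of block j combine to term j of the theta series in t⁴⁹.
  ∑<-blocks : ∀ N f g → (∀ j → f (j ℕ.* 7) + f (1 ℕ.+ j ℕ.* 7) + f (2 ℕ.+ j ℕ.* 7) + f (3 ℕ.+ j ℕ.* 7) +
                              f (4 ℕ.+ j ℕ.* 7) + f (5 ℕ.+ j ℕ.* 7) + f (6 ℕ.+ j ℕ.* 7) ≈ g j) →
              ∑< (N ℕ.* 7) f ≈ ∑< N g
  ∑<-blocks zero    f g eq = refl
  ∑<-blocks (suc N) f g eq = begin
    ∑< (N ℕ.* 7) f + f₀ + f₁ + f₂ + f₃ + f₄ + f₅ + f₆
      ≈⟨ solve 8 (λ s a b c d e f g → s :+ a :+ b :+ c :+ d :+ e :+ f :+ g := s :+ (a :+ b :+ c :+ d :+ e :+ f :+ g))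
           refl (∑< (N ℕ.* 7) f) f₀ f₁ f₂ f₃ f₄ f₅ f₆ ⟩
    ∑< (N ℕ.* 7) f + (f₀ + f₁ + f₂ + f₃ + f₄ + f₅ + f₆) ≈⟨ +-cong (∑<-blocks N f g eq) (eq N) ⟩
    ∑< N g + g N ∎
    where
    f₀ f₁ f₂ f₃ f₄ f₅ f₆ : Carrier
    f₀ = f (N ℕ.* 7)
    f₁ = f (1 ℕ.+ N ℕ.* 7)
    f₂ = f (2 ℕ.+ N ℕ.* 7)
    f₃ = f (3 ℕ.+ N ℕ.* 7)
    f₄ = f (4 ℕ.+ N ℕ.* 7)
    f₅ = f (5 ℕ.+ N ℕ.* 7)
    f₆ = f (6 ℕ.+ N ℕ.* 7)

  ι-residue : ∀ r j → ι (r ℕ.+ j ℕ.* 7) ≈ ι r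
  ι-residue r j = trans (ι-+ r (j ℕ.* 7)) (trans (+-congˡ (ι-*7 j)) (+-identityʳ _))

  2τ : ∀ k → 2 ℕ.* τ k ℕ.+ k ≡.≡ k ℕ.* k
  2τ zero    = ≡.refl
  2τ (suc k) = ≡.trans (e₁ (τ k) k) (≡.trans (≡.cong (ℕ._+ (2 ℕ.* k ℕ.+ 1)) (2τ k)) (e₂ k))
    where
    e₁ : ∀ T k → 2 ℕ.* (T ℕ.+ k) ℕ.+ suc k ≡.≡ 2 ℕ.* T ℕ.+ k ℕ.+ (2 ℕ.* k ℕ.+ 1)
    e₁ = ℕ.solve-∀
    e₂ : ∀ k → k ℕ.* k ℕ.+ (2 ℕ.* k ℕ.+ 1) ≡.≡ suc k ℕ.* suc k
    e₂ = ℕ.solve-∀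

  ι-τ : ∀ k → ι (τ k) ≈ ι 4 * (ι k * ι k - ι k)
  ι-τ k = begin
    ι (τ k)
      ≈⟨ solve 2 (λ T κ → T := con 4 :* (con 2 :* T :+ κ :- κ)) refl (ι (τ k)) (ι k) ⟩
    ι 4 * (ι 2 * ι (τ k) + ι k - ι k)
      ≈⟨ *-congˡ (+-congʳ (trans (ι-+ (2 ℕ.* τ k) k) (+-congʳ (ι-* 2 (τ k))))) ⟨
    ι 4 * (ι (2 ℕ.* τ k ℕ.+ k) - ι k)             ≡⟨ ≡.cong (λ n → ι 4 * (ι n - ι k)) (2τ k) ⟩
    ι 4 * (ι (k ℕ.* k) - ι k)                     ≈⟨ *-congˡ (+-congʳ (ι-* k k)) ⟩
    ι 4 * (ι k * ι k - ι k)                       ∎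

  τ-7 : ∀ j → τ (j ℕ.* 7) ≡.≡ 49 ℕ.* τ j ℕ.+ 21 ℕ.* j
  τ-7 zero    = ≡.refl
  τ-7 (suc j) = ≡.trans (e₁ (τ (j ℕ.* 7)) j) (≡.trans (≡.cong (ℕ._+ (49 ℕ.* j ℕ.+ 21)) (τ-7 j)) (e₂ (τ j) j))
    where
    e₁ : ∀ T j → T ℕ.+ j ℕ.* 7 ℕ.+ (1 ℕ.+ j ℕ.* 7) ℕ.+ (2 ℕ.+ j ℕ.* 7) ℕ.+ (3 ℕ.+ j ℕ.* 7) ℕ.+
                 (4 ℕ.+ j ℕ.* 7) ℕ.+ (5 ℕ.+ j ℕ.* 7) ℕ.+ (6 ℕ.+ j ℕ.* 7) ≡.≡ T ℕ.+ (49 ℕ.* j ℕ.+ 21)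
    e₁ = ℕ.solve-∀
    e₂ : ∀ T j → 49 ℕ.* T ℕ.+ 21 ℕ.* j ℕ.+ (49 ℕ.* j ℕ.+ 21) ≡.≡ 49 ℕ.* (T ℕ.+ j) ℕ.+ 21 ℕ.* suc j
    e₂ = ℕ.solve-∀

  sign-7 : ∀ j → sign (j ℕ.* 7) ≈ sign j
  sign-7 zero    = refl
  sign-7 (suc j) = trans (solve 1 (λ σ → :- :- :- :- :- :- :- σ := :- σ) refl (sign (j ℕ.* 7))) (-‿cong (sign-7 j))

  module _ (t δ : Carrier) (D-t : D t ≈ δ * t) (D-δ : D δ ≈ 0#) (δ³≈1 : δ ^ 3 ≈ 1#) where

    D-t^ : ∀ n → D (t ^ n) ≈ ι n * δ * t ^ n
    D-t^ zero    = trans D-1 (solve 1 (λ d → con 0 := con 0 :* d :* con 1) refl δ)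
    D-t^ (suc n) = begin
      D (t ^ suc n)                     ≈⟨ D-^ t n ⟩
      ι (suc n) * (t ^ n * D t)         ≈⟨ *-congˡ (*-congˡ D-t) ⟩
      ι (suc n) * (t ^ n * (δ * t))     ≈⟨ solve 4 (λ i x d t → i :* (x :* (d :* t)) := i :* d :* (t :* x)) refl _ _ _ _ ⟩
      ι (suc n) * δ * t ^ suc n         ∎

    twist-t^ : ∀ c n → twist (c * δ) (t ^ n) ≈ ((ι n + c) * δ) * t ^ n
    twist-t^ c n = trans (+-congʳ (D-t^ n))
      (solve 4 (λ i d x c → i :* d :* x :+ c :* d :* x := ((i :+ c) :* d) :* x) refl (ι n) δ (t ^ n) c)

    D-constant-δ : ∀ m n → D ((ι m + ι n) * δ) ≈ 0#
    D-constant-δ m n = begin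
      D ((ι m + ι n) * δ)                       ≈⟨ D-* _ _ ⟩
      D (ι m + ι n) * δ + (ι m + ι n) * D δ
        ≈⟨ +-cong (*-congʳ (trans (D-+ _ _) (+-cong (D-ι m) (D-ι n)))) (*-congˡ D-δ) ⟩
      (0# + 0#) * δ + (ι m + ι n) * 0#
        ≈⟨ solve 2 (λ d x → (con 0 :+ con 0) :* d :+ x :* con 0 := con 0) refl _ _ ⟩
      0#                                        ∎

    -- One twist multiplies tⁿ by (n + c)δ, and the cube makes δ disappear. For t = q^d the factor δ
    -- is d, and d³ ≡ 1 for d = 1 and d = 2, which is why q and q² obey equations of the same form.
    twist³-t^ : ∀ c n → twist³ (ι c * δ) (t ^ n) ≈ (ι n + ι c) ^ 3 * t ^ n
    twist³-t^ c n = begin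
      twist³ (ι c * δ) (t ^ n)         ≈⟨ twist³-constant-eigen (ι c * δ) (D-constant-δ n c) (twist-t^ (ι c) n) ⟩
      ((ι n + ι c) * δ) ^ 3 * t ^ n     ≈⟨ *-congʳ (solve 2 (λ i d → (i :* d) :^ 3 := i :^ 3 :* d :^ 3) refl _ δ) ⟩
      (ι n + ι c) ^ 3 * δ ^ 3 * t ^ n   ≈⟨ *-congʳ (trans (*-congˡ δ³≈1) (*-identityʳ _)) ⟩
      (ι n + ι c) ^ 3 * t ^ n           ∎

    -- 8 · k(k + 1)/2 + 1 = (2k + 1)² and 8 ≡ 1, so the twisted exponent is (2k + 1)². Its cube
    -- times the coefficient 2k + 1 is a seventh power, to which Fermat applies.
    jacobi-term : ∀ k → twist³ (ι 1 * δ) (CubeProduct.W t k) ≈ CubeProduct.W t k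
    jacobi-term k = begin
      twist³ c (sign k * (μ * x))              ≈⟨ twist³-constant c (D-sign k) _ ⟩
      sign k * twist³ c (μ * x)                ≈⟨ *-congˡ (twist³-constant c (D-ι (2 ℕ.* k ℕ.+ 1)) _) ⟩
      sign k * (μ * twist³ c x)                ≈⟨ *-congˡ (*-congˡ (twist³-t^ 1 (τ (suc k)))) ⟩
      sign k * (μ * ((ι (τ (suc k)) + ι 1) ^ 3 * x))
        ≈⟨ *-congˡ (trans (sym (*-assoc μ _ x)) (*-congʳ μ-eigen)) ⟩
      sign k * (μ * x)                          ∎
      where
      c μ x κ : Carrier
      c = ι 1 * δ
      μ = ι (2 ℕ.* k ℕ.+ 1)
      x = t ^ τ (suc k)
      κ = ι k
      ι-τ-suc : ι (τ (suc k)) ≈ ι 4 * (κ * κ + κ)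
      ι-τ-suc = begin
        ι (τ (suc k))                       ≈⟨ ι-τ (suc k) ⟩
        ι 4 * (ι (suc k) * ι (suc k) - ι (suc k)) ≈⟨ *-congˡ (+-cong (*-cong (ι-suc k) (ι-suc k)) (-‿cong (ι-suc k))) ⟩
        ι 4 * ((ι 1 + κ) * (ι 1 + κ) - (ι 1 + κ))
          ≈⟨ solve 1 (λ κ → con 4 :* ((con 1 :+ κ) :* (con 1 :+ κ) :- (con 1 :+ κ)) := con 4 :* (κ :* κ :+ κ)) refl κ ⟩
        ι 4 * (κ * κ + κ)                   ∎
      μ≈ : μ ≈ ι 2 * κ + ι 1
      μ≈ = trans (ι-+ (2 ℕ.* k) 1) (+-congʳ (ι-* 2 k))
      μ-eigen : μ * (ι (τ (suc k)) + ι 1) ^ 3 ≈ μ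
      μ-eigen = begin
        μ * (ι (τ (suc k)) + ι 1) ^ 3       ≈⟨ *-cong μ≈ (^-congˡ 3 (+-congʳ ι-τ-suc)) ⟩
        (ι 2 * κ + ι 1) * (ι 4 * (κ * κ + κ) + ι 1) ^ 3
          ≈⟨ solve 1 (λ κ → (con 2 :* κ :+ con 1) :* (con 4 :* (κ :* κ :+ κ) :+ con 1) :^ 3 := (con 2 :* κ :+ con 1) :^ 7) refl κ ⟩
        (ι 2 * κ + ι 1) ^ 7                 ≈⟨ ^-congˡ 7 μ≈ ⟨
        μ ^ 7                               ≈⟨ fermat (2 ℕ.* k ℕ.+ 1) ⟩
        μ                                   ∎

    twist³-binomial : ∀ c k m n → twist³ (ι c * δ) (sign k * (t ^ m - t ^ n)) ≈
      sign k * ((ι m + ι c) ^ 3 * t ^ m - (ι n + ι c) ^ 3 * t ^ n)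
    twist³-binomial c k m n = trans (twist³-constant (ι c * δ) (D-sign k) _) (*-congˡ (begin
      tw (t ^ m - t ^ n)                           ≈⟨ twist³-+ (ι c * δ) _ _ ⟩
      tw (t ^ m) + tw (- t ^ n)
        ≈⟨ +-congˡ (trans (twist³-cong (ι c * δ) (neg (t ^ n))) (trans (twist³-constant (ι c * δ) (D-sign 1) _) (sym (neg _)))) ⟩
      tw (t ^ m) - tw (t ^ n)                      ≈⟨ +-cong (twist³-t^ c m) (-‿cong (twist³-t^ c n)) ⟩
      _                                            ∎))
      where
      tw : Carrier → Carrier
      tw = twist³ (ι c * δ)
      neg : ∀ z → - z ≈ - 1# * z
      neg = solve 1 (λ z → :- z := :- con 1 :* z) refl

    private
      ι-τ₁ : ∀ k → ι (τ (1 ℕ.+ k)) ≈ ι 4 * ((ι 1 + ι k) * (ι 1 + ι k) - (ι 1 + ι k))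
      ι-τ₁ k = trans (ι-τ (suc k)) (*-congˡ (+-cong (*-cong (ι-suc k) (ι-suc k)) (-‿cong (ι-suc k))))

      ι-τ₂ : ∀ k → ι (τ (2 ℕ.+ k)) ≈ ι 4 * ((ι 2 + ι k) * (ι 2 + ι k) - (ι 2 + ι k))
      ι-τ₂ k = trans (ι-τ (2 ℕ.+ k)) (*-congˡ (+-cong (*-cong (ι-+ 2 k) (ι-+ 2 k)) (-‿cong (ι-+ 2 k))))

      ι-expand : ∀ c d m n → ι (c ℕ.* m ℕ.+ d ℕ.* n) ≈ ι c * ι m + ι d * ι n
      ι-expand c d m n = trans (ι-+ (c ℕ.* m) (d ℕ.* n)) (+-cong (ι-* c m) (ι-* d n))

    module Euler where
      open TripleProduct t 1 2 using (a; b; W)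
      module T = TripleProduct (t ^ 49) 1 2

      -- 24 a k + 1 = (6k + 1)² and 24 b k + 1 = (6k + 5)², and 1/24 ≡ 5. The sign in `euler` comes
      -- from 5³ ≡ -1, which is why W k is added here and not subtracted.
      term : ∀ k → twist³ (ι 5 * δ) (W k) + W k ≈
        sign k * ((ι 1 - (ι 6 * ι k + ι 1) ^ 6) * t ^ a k - (ι 1 - (ι 6 * ι k + ι 5) ^ 6) * t ^ b k)
      term k = begin
        twist³ (ι 5 * δ) (W k) + W k
          ≈⟨ +-congʳ (trans (twist³-binomial 5 k (a k) (b k))
               (*-congˡ (+-cong (*-congʳ (^-congˡ 3 (+-congʳ ι-a))) (-‿cong (*-congʳ (^-congˡ 3 (+-congʳ ι-b))))))) ⟩
        sign k * ((ι 5 * (ι 6 * κ + ι 1) ^ 2 - ι 5 + ι 5) ^ 3 * x - (ι 5 * (ι 6 * κ + ι 5) ^ 2 - ι 5 + ι 5) ^ 3 * y)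
          + sign k * (x - y)
          ≈⟨ solve 5 (λ σ m n x y →
               σ :* ((con 5 :* m :^ 2 :- con 5 :+ con 5) :^ 3 :* x :- (con 5 :* n :^ 2 :- con 5 :+ con 5) :^ 3 :* y) :+ σ :* (x :- y) :=
               σ :* ((con 1 :- m :^ 6) :* x :- (con 1 :- n :^ 6) :* y)) refl (sign k) (ι 6 * κ + ι 1) (ι 6 * κ + ι 5) x y ⟩
        _ ∎
        where
        x y κ : Carrier
        x = t ^ a k
        y = t ^ b k
        κ = ι k
        ι-a : ι (a k) ≈ ι 5 * (ι 6 * κ + ι 1) ^ 2 - ι 5
        ι-a = trans (ι-expand 1 2 (τ k) (τ (1 ℕ.+ k))) (trans (+-cong (*-congˡ (ι-τ k)) (*-congˡ (ι-τ₁ k)))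
          (solve 1 (λ κ → con 1 :* (con 4 :* (κ :* κ :- κ)) :+ con 2 :* (con 4 :* ((con 1 :+ κ) :* (con 1 :+ κ) :- (con 1 :+ κ))) :=
                          con 5 :* (con 6 :* κ :+ con 1) :^ 2 :- con 5) refl κ))
        ι-b : ι (b k) ≈ ι 5 * (ι 6 * κ + ι 5) ^ 2 - ι 5
        ι-b = trans (ι-expand 1 2 (τ (2 ℕ.+ k)) (τ (1 ℕ.+ k))) (trans (+-cong (*-congˡ (ι-τ₂ k)) (*-congˡ (ι-τ₁ k)))
          (solve 1 (λ κ → con 1 :* (con 4 :* ((con 2 :+ κ) :* (con 2 :+ κ) :- (con 2 :+ κ))) :+
                          con 2 :* (con 4 :* ((con 1 :+ κ) :* (con 1 :+ κ) :- (con 1 :+ κ))) :=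
                          con 5 :* (con 6 :* κ :+ con 5) :^ 2 :- con 5) refl κ))

      -- Only the exponents a k with k ≡ 1 and b k with k ≡ 5 modulo 7 survive.
      block : ∀ j → let g = λ k → twist³ (ι 5 * δ) (W k) + W k in
        g (j ℕ.* 7) + g (1 ℕ.+ j ℕ.* 7) + g (2 ℕ.+ j ℕ.* 7) + g (3 ℕ.+ j ℕ.* 7) +
        g (4 ℕ.+ j ℕ.* 7) + g (5 ℕ.+ j ℕ.* 7) + g (6 ℕ.+ j ℕ.* 7) ≈ - (t ^ 2) * T.W j
      block j = begin
        _ ≈⟨ +-cong (+-cong (+-cong (+-cong (+-cong (+-cong (at 0) (at 1)) (at 2)) (at 3)) (at 4)) (at 5)) (at 6) ⟩
        h 0 + h 1 + h 2 + h 3 + h 4 + h 5 + h 6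
          ≈⟨ prove (sign (j ℕ.* 7) ∷ x 0 ∷ y 0 ∷ x 1 ∷ y 1 ∷ x 2 ∷ y 2 ∷ x 3 ∷ y 3 ∷ x 4 ∷ y 4 ∷ x 5 ∷ y 5 ∷ x 6 ∷ y 6 ∷ [])
               (H 0 σ (# 1) (# 2) :+ H 1 (:- σ) (# 3) (# 4) :+ H 2 (:- :- σ) (# 5) (# 6) :+
                H 3 (:- :- :- σ) (# 7) (# 8) :+ H 4 (:- :- :- :- σ) (# 9) (# 10) :+
                H 5 (:- :- :- :- :- σ) (# 11) (# 12) :+ H 6 (:- :- :- :- :- :- σ) (# 13) (# 14))
               (:- σ :* (var (# 3) :- var (# 12))) refl ⟩
        - sign (j ℕ.* 7) * (x 1 - y 5)
          ≈⟨ *-cong (-‿cong (sign-7 j)) (+-cong (shift (T.a j) (e-a j)) (-‿cong (shift (T.b j) (e-b j)))) ⟩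
        - sign j * (t ^ 2 * (t ^ 49) ^ T.a j - t ^ 2 * (t ^ 49) ^ T.b j)
          ≈⟨ solve 4 (λ σ z u v → :- σ :* (z :* u :- z :* v) := :- z :* (σ :* (u :- v))) refl (sign j) (t ^ 2) _ _ ⟩
        - (t ^ 2) * T.W j ∎
        where
        x y h : ℕ → Carrier
        x r = t ^ a (r ℕ.+ j ℕ.* 7)
        y r = t ^ b (r ℕ.+ j ℕ.* 7)
        h r = sign (r ℕ.+ j ℕ.* 7) * ((ι 1 - (ι 6 * ι r + ι 1) ^ 6) * x r - (ι 1 - (ι 6 * ι r + ι 5) ^ 6) * y r)

        at : ∀ r → twist³ (ι 5 * δ) (W (r ℕ.+ j ℕ.* 7)) + W (r ℕ.+ j ℕ.* 7) ≈ h r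
        at r = trans (term (r ℕ.+ j ℕ.* 7)) (*-congˡ (+-cong (*-congʳ (residue 1)) (-‿cong (*-congʳ (residue 5)))))
          where
          residue : ∀ c → ι 1 - (ι 6 * ι (r ℕ.+ j ℕ.* 7) + ι c) ^ 6 ≈ ι 1 - (ι 6 * ι r + ι c) ^ 6
          residue c = +-congˡ (-‿cong (^-congˡ 6 (+-congʳ (*-congˡ (ι-residue r j)))))

        σ : Polynomial 15
        σ = var (# 0)
        H : ℕ → Polynomial 15 → Fin 15 → Fin 15 → Polynomial 15
        H r s u v = s :* ((con 1 :- (con 6 :* con r :+ con 1) :^ 6) :* var u :- (con 1 :- (con 6 :* con r :+ con 5) :^ 6) :* var v)

        shift : ∀ {m} i → m ≡.≡ 2 ℕ.+ 49 ℕ.* i → t ^ m ≈ t ^ 2 * (t ^ 49) ^ i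
        shift i eq = trans (reflexive (≡.cong (t ^_) eq)) (trans (^-homo-* t 2 (49 ℕ.* i)) (*-congˡ (sym (^-assocʳ t 49 i))))

        e-a : ∀ j → a (1 ℕ.+ j ℕ.* 7) ≡.≡ 2 ℕ.+ 49 ℕ.* T.a j
        e-a j = ≡.trans (≡.cong (λ T → 1 ℕ.* (T ℕ.+ j ℕ.* 7) ℕ.+ 2 ℕ.* (T ℕ.+ j ℕ.* 7 ℕ.+ (1 ℕ.+ j ℕ.* 7))) (τ-7 j)) (e (τ j) j)
          where
          e : ∀ T j → 1 ℕ.* (49 ℕ.* T ℕ.+ 21 ℕ.* j ℕ.+ j ℕ.* 7) ℕ.+ 2 ℕ.* (49 ℕ.* T ℕ.+ 21 ℕ.* j ℕ.+ j ℕ.* 7 ℕ.+ (1 ℕ.+ j ℕ.* 7)) ≡.≡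
                      2 ℕ.+ 49 ℕ.* (1 ℕ.* T ℕ.+ 2 ℕ.* (T ℕ.+ j))
          e = ℕ.solve-∀

        e-b : ∀ j → b (5 ℕ.+ j ℕ.* 7) ≡.≡ 2 ℕ.+ 49 ℕ.* T.b j
        e-b j = ≡.trans (≡.cong (λ T → let s = T ℕ.+ j ℕ.* 7 ℕ.+ (1 ℕ.+ j ℕ.* 7) ℕ.+ (2 ℕ.+ j ℕ.* 7) ℕ.+ (3 ℕ.+ j ℕ.* 7) ℕ.+ (4 ℕ.+ j ℕ.* 7) ℕ.+ (5 ℕ.+ j ℕ.* 7) in
                          1 ℕ.* (s ℕ.+ (6 ℕ.+ j ℕ.* 7)) ℕ.+ 2 ℕ.* s) (τ-7 j)) (e (τ j) j)
          where
          e : ∀ T j → let s = 49 ℕ.* T ℕ.+ 21 ℕ.* j ℕ.+ j ℕ.* 7 ℕ.+ (1 ℕ.+ j ℕ.* 7) ℕ.+ (2 ℕ.+ j ℕ.* 7) ℕ.+ (3 ℕ.+ j ℕ.* 7) ℕ.+ (4 ℕ.+ j ℕ.* 7) ℕ.+ (5 ℕ.+ j ℕ.* 7) in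
                      1 ℕ.* (s ℕ.+ (6 ℕ.+ j ℕ.* 7)) ℕ.+ 2 ℕ.* s ≡.≡ 2 ℕ.+ 49 ℕ.* (1 ℕ.* (T ℕ.+ j ℕ.+ suc j) ℕ.+ 2 ℕ.* (T ℕ.+ j))
          e = ℕ.solve-∀

      theta-sum : ∀ N → twist³ (ι 5 * δ) (∑< (N ℕ.* 7) W) + ∑< (N ℕ.* 7) W ≈ - (t ^ 2) * ∑< N T.W
      theta-sum N = begin
        twist³ c (∑< (N ℕ.* 7) W) + ∑< (N ℕ.* 7) W           ≈⟨ +-congʳ (twist³-∑< c (N ℕ.* 7) W) ⟩
        ∑< (N ℕ.* 7) (λ k → twist³ c (W k)) + ∑< (N ℕ.* 7) W ≈⟨ ∑<-+ (N ℕ.* 7) _ W ⟩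
        ∑< (N ℕ.* 7) (λ k → twist³ c (W k) + W k)            ≈⟨ ∑<-blocks N _ _ block ⟩
        ∑< N (λ j → - (t ^ 2) * T.W j)                        ≈⟨ *-∑< N _ _ ⟨
        - (t ^ 2) * ∑< N T.W                                  ∎
        where
        c : Carrier
        c = ι 5 * δ

    module Gauss where
      open TripleProduct t 1 1 using (a; b; W)
      module T = TripleProduct (t ^ 49) 1 1

      -- The exponents are the squares k² and (k + 1)² themselves, so the twist is by 0 and the cube
      -- yields sixth powers.
      term : ∀ k → twist³ (ι 0 * δ) (W k) - W k ≈
        sign k * ((ι k ^ 6 - ι 1) * t ^ a k - ((ι 1 + ι k) ^ 6 - ι 1) * t ^ b k)
      term k = begin
        twist³ (ι 0 * δ) (W k) - W k
          ≈⟨ +-congʳ (trans (twist³-binomial 0 k (a k) (b k))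
               (*-congˡ (+-cong (*-congʳ (^-congˡ 3 (+-congʳ ι-a))) (-‿cong (*-congʳ (^-congˡ 3 (+-congʳ ι-b))))))) ⟩
        sign k * ((κ ^ 2 + ι 0) ^ 3 * x - ((ι 1 + κ) ^ 2 + ι 0) ^ 3 * y) - sign k * (x - y)
          ≈⟨ solve 4 (λ σ κ x y →
               σ :* ((κ :^ 2 :+ con 0) :^ 3 :* x :- ((con 1 :+ κ) :^ 2 :+ con 0) :^ 3 :* y) :- σ :* (x :- y) :=
               σ :* ((κ :^ 6 :- con 1) :* x :- ((con 1 :+ κ) :^ 6 :- con 1) :* y)) refl (sign k) κ x y ⟩
        _ ∎
        where
        x y κ : Carrier
        x = t ^ a k
        y = t ^ b k
        κ = ι k
        ι-a : ι (a k) ≈ κ ^ 2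
        ι-a = trans (ι-expand 1 1 (τ k) (τ (1 ℕ.+ k))) (trans (+-cong (*-congˡ (ι-τ k)) (*-congˡ (ι-τ₁ k)))
          (solve 1 (λ κ → con 1 :* (con 4 :* (κ :* κ :- κ)) :+ con 1 :* (con 4 :* ((con 1 :+ κ) :* (con 1 :+ κ) :- (con 1 :+ κ))) :=
                          κ :^ 2) refl κ))
        ι-b : ι (b k) ≈ (ι 1 + κ) ^ 2
        ι-b = trans (ι-expand 1 1 (τ (2 ℕ.+ k)) (τ (1 ℕ.+ k))) (trans (+-cong (*-congˡ (ι-τ₂ k)) (*-congˡ (ι-τ₁ k)))
          (solve 1 (λ κ → con 1 :* (con 4 :* ((con 2 :+ κ) :* (con 2 :+ κ) :- (con 2 :+ κ))) :+
                          con 1 :* (con 4 :* ((con 1 :+ κ) :* (con 1 :+ κ) :- (con 1 :+ κ))) :=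
                          (con 1 :+ κ) :^ 2) refl κ))

      -- Only the exponents a k with k ≡ 0 and b k with k ≡ 6 modulo 7 survive.
      block : ∀ j → let g = λ k → twist³ (ι 0 * δ) (W k) - W k in
        g (j ℕ.* 7) + g (1 ℕ.+ j ℕ.* 7) + g (2 ℕ.+ j ℕ.* 7) + g (3 ℕ.+ j ℕ.* 7) +
        g (4 ℕ.+ j ℕ.* 7) + g (5 ℕ.+ j ℕ.* 7) + g (6 ℕ.+ j ℕ.* 7) ≈ - T.W j
      block j = begin
        _ ≈⟨ +-cong (+-cong (+-cong (+-cong (+-cong (+-cong (at 0) (at 1)) (at 2)) (at 3)) (at 4)) (at 5)) (at 6) ⟩
        h 0 + h 1 + h 2 + h 3 + h 4 + h 5 + h 6
          ≈⟨ prove (sign (j ℕ.* 7) ∷ x 0 ∷ y 0 ∷ x 1 ∷ y 1 ∷ x 2 ∷ y 2 ∷ x 3 ∷ y 3 ∷ x 4 ∷ y 4 ∷ x 5 ∷ y 5 ∷ x 6 ∷ y 6 ∷ [])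
               (H 0 σ (# 1) (# 2) :+ H 1 (:- σ) (# 3) (# 4) :+ H 2 (:- :- σ) (# 5) (# 6) :+
                H 3 (:- :- :- σ) (# 7) (# 8) :+ H 4 (:- :- :- :- σ) (# 9) (# 10) :+
                H 5 (:- :- :- :- :- σ) (# 11) (# 12) :+ H 6 (:- :- :- :- :- :- σ) (# 13) (# 14))
               (:- (σ :* (var (# 1) :- var (# 14)))) refl ⟩
        - (sign (j ℕ.* 7) * (x 0 - y 6))
          ≈⟨ -‿cong (*-cong (sign-7 j) (+-cong (shift (T.a j) (e-a j)) (-‿cong (shift (T.b j) (e-b j))))) ⟩
        - T.W j ∎
        where
        x y h : ℕ → Carrier
        x r = t ^ a (r ℕ.+ j ℕ.* 7)
        y r = t ^ b (r ℕ.+ j ℕ.* 7)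
        h r = sign (r ℕ.+ j ℕ.* 7) * ((ι r ^ 6 - ι 1) * x r - ((ι 1 + ι r) ^ 6 - ι 1) * y r)

        at : ∀ r → twist³ (ι 0 * δ) (W (r ℕ.+ j ℕ.* 7)) - W (r ℕ.+ j ℕ.* 7) ≈ h r
        at r = trans (term (r ℕ.+ j ℕ.* 7)) (*-congˡ (+-cong
          (*-congʳ (+-congʳ (^-congˡ 6 (ι-residue r j))))
          (-‿cong (*-congʳ (+-congʳ (^-congˡ 6 (+-congˡ (ι-residue r j))))))))

        σ : Polynomial 15
        σ = var (# 0)
        H : ℕ → Polynomial 15 → Fin 15 → Fin 15 → Polynomial 15
        H r s u v = s :* ((con r :^ 6 :- con 1) :* var u :- ((con 1 :+ con r) :^ 6 :- con 1) :* var v)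

        shift : ∀ {m} i → m ≡.≡ 49 ℕ.* i → t ^ m ≈ (t ^ 49) ^ i
        shift i eq = trans (reflexive (≡.cong (t ^_) eq)) (sym (^-assocʳ t 49 i))

        e-a : ∀ j → a (j ℕ.* 7) ≡.≡ 49 ℕ.* T.a j
        e-a j = ≡.trans (≡.cong (λ T → 1 ℕ.* T ℕ.+ 1 ℕ.* (T ℕ.+ j ℕ.* 7)) (τ-7 j)) (e (τ j) j)
          where
          e : ∀ T j → 1 ℕ.* (49 ℕ.* T ℕ.+ 21 ℕ.* j) ℕ.+ 1 ℕ.* (49 ℕ.* T ℕ.+ 21 ℕ.* j ℕ.+ j ℕ.* 7) ≡.≡
                      49 ℕ.* (1 ℕ.* T ℕ.+ 1 ℕ.* (T ℕ.+ j))
          e = ℕ.solve-∀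

        e-b : ∀ j → b (6 ℕ.+ j ℕ.* 7) ≡.≡ 49 ℕ.* T.b j
        e-b j = ≡.trans (≡.cong (λ T → let s = T ℕ.+ j ℕ.* 7 ℕ.+ (1 ℕ.+ j ℕ.* 7) ℕ.+ (2 ℕ.+ j ℕ.* 7)
                                               ℕ.+ (3 ℕ.+ j ℕ.* 7) ℕ.+ (4 ℕ.+ j ℕ.* 7) ℕ.+ (5 ℕ.+ j ℕ.* 7) ℕ.+ (6 ℕ.+ j ℕ.* 7) in
                          1 ℕ.* (s ℕ.+ (7 ℕ.+ j ℕ.* 7)) ℕ.+ 1 ℕ.* s) (τ-7 j)) (e (τ j) j)
          where
          e : ∀ T j → let s = 49 ℕ.* T ℕ.+ 21 ℕ.* j ℕ.+ j ℕ.* 7 ℕ.+ (1 ℕ.+ j ℕ.* 7) ℕ.+ (2 ℕ.+ j ℕ.* 7)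
                              ℕ.+ (3 ℕ.+ j ℕ.* 7) ℕ.+ (4 ℕ.+ j ℕ.* 7) ℕ.+ (5 ℕ.+ j ℕ.* 7) ℕ.+ (6 ℕ.+ j ℕ.* 7) in
                      1 ℕ.* (s ℕ.+ (7 ℕ.+ j ℕ.* 7)) ℕ.+ 1 ℕ.* s ≡.≡ 49 ℕ.* (1 ℕ.* (T ℕ.+ j ℕ.+ suc j) ℕ.+ 1 ℕ.* (T ℕ.+ j))
          e = ℕ.solve-∀

      theta-sum : ∀ N → twist³ (ι 0 * δ) (∑< (N ℕ.* 7) W) - ∑< (N ℕ.* 7) W ≈ - ∑< N T.W
      theta-sum N = begin
        twist³ c (∑< (N ℕ.* 7) W) - ∑< (N ℕ.* 7) W             ≈⟨ +-cong (twist³-∑< c (N ℕ.* 7) W) (∑<-neg (N ℕ.* 7) W) ⟩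
        ∑< (N ℕ.* 7) (λ k → twist³ c (W k)) + ∑< (N ℕ.* 7) (λ k → - W k) ≈⟨ ∑<-+ (N ℕ.* 7) _ _ ⟩
        ∑< (N ℕ.* 7) (λ k → twist³ c (W k) - W k)              ≈⟨ ∑<-blocks N _ _ block ⟩
        ∑< N (λ j → - T.W j)                                    ≈⟨ ∑<-neg N T.W ⟨
        - ∑< N T.W                                              ∎
        where
        c : Carrier
        c = ι 0 * δ

-- The ring of integer power series modulo 7

module Congruence where

  import Defs
  open import Defs hiding (_*_; _^_)
  open import Data.Integer using (ℤ; +_; 0ℤ; 1ℤ)
  open import Data.Integer.Divisibility.Signed
    using (_∣_; _∣?_; divides; ∣m∣n⇒∣m+n; ∣n⇒∣m*n; ∣m⇒∣m*n; ∣m⇒∣-m)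
  open import Data.Integer.Tactic.RingSolver using (solve-∀)
  open import Relation.Binary.PropositionalEquality using (_≡_)

  infix 4 _≈ᶻ_ _≈_
  infix 10 ↑_

  -- A record and not a synonym for divisibility, so that both integers can be inferred from a
  -- proof. The carrier stays ℤ with congruence as its equality, and the integer series of the
  -- theorem belong to the ring as they stand.
  record _≈ᶻ_ (a b : ℤ) : Set where
    constructor mod7
    field 7∣- : + 7 ∣ a ℤ.- b

  open _≈ᶻ_ public

  ℤ/7 : CommutativeRing 0ℓ 0ℓ
  ℤ/7 = record
    { Carrier = ℤ ; _≈_ = _≈ᶻ_ ; _+_ = ℤ._+_ ; _*_ = ℤ._*_ ; -_ = ℤ.-_ ; 0# = 0ℤ ; 1# = 1ℤ
    ; isCommutativeRing = record
      { isRing = record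
        { +-isAbelianGroup = record
          { isGroup = record
            { isMonoid = record
              { isSemigroup = record
                { isMagma = record
                  { isEquivalence = record { refl = ≡⇒≈ᶻ ≡.refl ; sym = symᶻ ; trans = transᶻ }
                  ; ∙-cong = λ {a} {b} {c} {d} p q → mod7 (≡.subst (+ 7 ∣_) (regroup a b c d) (∣m∣n⇒∣m+n (7∣- p) (7∣- q)))
                  }
                ; assoc = λ a b c → ≡⇒≈ᶻ (ℤ.+-assoc a b c)
                }
              ; identity = (λ a → ≡⇒≈ᶻ (ℤ.+-identityˡ a)) , (λ a → ≡⇒≈ᶻ (ℤ.+-identityʳ a))
              }
            ; inverse = (λ a → ≡⇒≈ᶻ (ℤ.+-inverseˡ a)) , (λ a → ≡⇒≈ᶻ (ℤ.+-inverseʳ a))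
            ; ⁻¹-cong = λ {a} {b} p → mod7 (≡.subst (+ 7 ∣_) (negate a b) (∣m⇒∣-m (7∣- p)))
            }
          ; comm = λ a b → ≡⇒≈ᶻ (ℤ.+-comm a b)
          }
        ; *-cong = λ {a} {b} {c} {d} p q → mod7 (≡.subst (+ 7 ∣_) (product a b c d)
            (∣m∣n⇒∣m+n (∣m⇒∣m*n c (7∣- p)) (∣n⇒∣m*n b (7∣- q))))
        ; *-assoc = λ a b c → ≡⇒≈ᶻ (ℤ.*-assoc a b c)
        ; *-identity = (λ a → ≡⇒≈ᶻ (ℤ.*-identityˡ a)) , (λ a → ≡⇒≈ᶻ (ℤ.*-identityʳ a))
        ; distrib = (λ a b c → ≡⇒≈ᶻ (ℤ.*-distribˡ-+ a b c)) , (λ a b c → ≡⇒≈ᶻ (ℤ.*-distribʳ-+ a b c))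
        }
      ; *-comm = λ a b → ≡⇒≈ᶻ (ℤ.*-comm a b)
      }
    }
    where
    ≡⇒≈ᶻ : ∀ {a b} → a ≡ b → a ≈ᶻ b
    ≡⇒≈ᶻ {a} ≡.refl = mod7 (≡.subst (+ 7 ∣_) (≡.sym (ℤ.+-inverseʳ a)) (divides 0ℤ ≡.refl))

    negate : ∀ a b → ℤ.- (a ℤ.- b) ≡ ℤ.- a ℤ.- ℤ.- b
    negate = solve-∀

    swap : ∀ a b → ℤ.- (a ℤ.- b) ≡ b ℤ.- a
    swap = solve-∀

    chain : ∀ a b c → (a ℤ.- b) ℤ.+ (b ℤ.- c) ≡ a ℤ.- c
    chain = solve-∀

    regroup : ∀ a b c d → (a ℤ.- b) ℤ.+ (c ℤ.- d) ≡ (a ℤ.+ c) ℤ.- (b ℤ.+ d)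
    regroup = solve-∀

    product : ∀ a b c d → (a ℤ.- b) ℤ.* c ℤ.+ b ℤ.* (c ℤ.- d) ≡ a ℤ.* c ℤ.- b ℤ.* d
    product = solve-∀

    symᶻ : ∀ {a b} → a ≈ᶻ b → b ≈ᶻ a
    symᶻ {a} {b} p = mod7 (≡.subst (+ 7 ∣_) (swap a b) (∣m⇒∣-m (7∣- p)))

    transᶻ : ∀ {a b c} → a ≈ᶻ b → b ≈ᶻ c → a ≈ᶻ c
    transᶻ {a} {b} {c} p q = mod7 (≡.subst (+ 7 ∣_) (chain a b c) (∣m∣n⇒∣m+n (7∣- p) (7∣- q)))

  module Z = CommutativeRing ℤ/7
  module Z7 = Char7 ℤ/7 (mod7 (divides 1ℤ ≡.refl))
  module S = SeriesLaws ℤ/7 (mod7 (divides 1ℤ ≡.refl))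

  -- A wrapper on which the ring operations do not unfold, so that unification
  -- can recover their arguments.
  record ℤ⟦q⟧ : Set where
    no-eta-equality
    constructor ↑_
    field coeff : PowerSeries

  open ℤ⟦q⟧ public

  record _≈_ (f g : ℤ⟦q⟧) : Set where
    constructor coeffwise
    field at : ∀ m → coeff f m ≈ᶻ coeff g m

  open _≈_ public

  D : ℤ⟦q⟧ → ℤ⟦q⟧
  coeff (D f) = S.D (coeff f)

  module _ where

    private
      infixl 6 _+_
      infixl 7 _*_

      _+_ _*_ : ℤ⟦q⟧ → ℤ⟦q⟧ → ℤ⟦q⟧
      coeff (f + g) = coeff f S.⊕ coeff g
      coeff (f * g) = coeff f Defs.* coeff g

      -_ : ℤ⟦q⟧ → ℤ⟦q⟧
      coeff (- f) = S.⊝ coeff f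

    series : CommutativeRing 0ℓ 0ℓ
    series = record
      { Carrier = ℤ⟦q⟧ ; _≈_ = _≈_ ; _+_ = _+_ ; _*_ = _*_ ; -_ = -_ ; 0# = ↑ (λ _ → 0ℤ) ; 1# = ↑ one
      ; isCommutativeRing = record
        { isRing = record
          { +-isAbelianGroup = record
            { isGroup = record
              { isMonoid = record
                { isSemigroup = record
                  { isMagma = record
                    { isEquivalence = record
                      { refl = coeffwise λ _ → Z.refl
                      ; sym = λ p → coeffwise λ m → Z.sym (at p m)
                      ; trans = λ p q → coeffwise λ m → Z.trans (at p m) (at q m)
                      }
                    ; ∙-cong = λ p q → coeffwise λ m → Z.+-cong (at p m) (at q m)
                    }
                  ; assoc = λ f g h → coeffwise λ m → Z.+-assoc (coeff f m) (coeff g m) (coeff h m)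
                  }
                ; identity = (λ f → coeffwise λ m → Z.+-identityˡ (coeff f m)) , (λ f → coeffwise λ m → Z.+-identityʳ (coeff f m))
                }
              ; inverse = (λ f → coeffwise λ m → Z.-‿inverseˡ (coeff f m)) , (λ f → coeffwise λ m → Z.-‿inverseʳ (coeff f m))
              ; ⁻¹-cong = λ p → coeffwise λ m → Z.-‿cong (at p m)
              }
            ; comm = λ f g → coeffwise λ m → Z.+-comm (coeff f m) (coeff g m)
            }
          ; *-cong = λ p q → coeffwise λ m → S.⊛-cong m (at p) (at q)
          ; *-assoc = λ f g h → coeffwise λ m → S.⊛-assoc m (coeff f) (coeff g) (coeff h)
          ; *-identity = (λ f → coeffwise λ m → Z.trans (S.⊛-comm m one (coeff f)) (S.⊛-identityʳ (coeff f) m))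
                       , (λ f → coeffwise (S.⊛-identityʳ (coeff f)))
          ; distrib =
              (λ h f g → coeffwise λ m → Z.trans (S.⊛-comm m (coeff h) (coeff (f + g)))
                 (Z.trans (S.⊛-distribʳ m (coeff f) (coeff g) (coeff h))
                   (Z.+-cong (S.⊛-comm m (coeff f) (coeff h)) (S.⊛-comm m (coeff g) (coeff h)))))
            , (λ h f g → coeffwise λ m → S.⊛-distribʳ m (coeff f) (coeff g) (coeff h))
          }
        ; *-comm = λ f g → coeffwise λ m → S.⊛-comm m (coeff f) (coeff g)
        }
      }

  module A = CommutativeRing series
  open import Algebra.Properties.Semiring.Mult.TCOptimised A.semiring using () renaming (_×_ to _⨯_)

  7⨯1≈0 : 7 ⨯ A.1# ≈ A.0#
  7⨯1≈0 = coeffwise λ m →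
    Z7.solve 1 (λ x → x Z7.:+ x Z7.:+ x Z7.:+ x Z7.:+ x Z7.:+ x Z7.:+ x Z7.:= Z7.con 0) Z.refl (one m)

  isDerivation : IsDerivation series D
  isDerivation = record
    { D-cong = λ p → coeffwise λ m → Z.*-congˡ {Z7.ι m} (at p m)
    ; D-+    = λ f g → coeffwise λ m → Z.distribˡ (Z7.ι m) (coeff f m) (coeff g m)
    ; D-*    = λ f g → coeffwise λ m → S.leibniz m (coeff f) (coeff g)
    }

  open IsDerivation isDerivation

  open A using
    ( _+_; _*_; -_; _-_; 0#; 1#; refl; sym; trans; reflexive; +-cong; +-congˡ; +-congʳ; +-identityˡ; -‿cong; -‿inverseʳ
    ; *-cong; *-congˡ; *-congʳ; *-identityˡ; *-identityʳ; *-assoc; *-comm; zeroˡ; distribʳ)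
  open Algebra.Properties.Semiring.Exp A.semiring using (_^_; ^-congˡ)
  open Char7 series 7⨯1≈0 using (ι; solve; _:=_; _:+_; _:*_; _:-_; :-_; _:^_; con; frobenius; ι-suc)
  open Derivation series 7⨯1≈0 D isDerivation
  open FiniteTheta series 7⨯1≈0
  open ThetaEquations series 7⨯1≈0 D isDerivation
  open import Relation.Binary.Reasoning.Setoid A.setoid

  -- Approximation modulo powers of q

  infix 4 _≈[_]_

  -- The triple product is proved for partial products only. Limits are taken by proving agreement
  -- modulo every power of q.
  record _≈[_]_ (f : ℤ⟦q⟧) (N : ℕ) (g : ℤ⟦q⟧) : Set where
    constructor below
    field at< : ∀ m → m < N → coeff f m ≈ᶻ coeff g m

  open _≈[_]_

  module _ {N : ℕ} where

    ≈⇒≈[] : ∀ {f g} → f ≈ g → f ≈[ N ] g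
    ≈⇒≈[] p = below λ m _ → at p m

    ≈[]-sym : ∀ {f g} → f ≈[ N ] g → g ≈[ N ] f
    ≈[]-sym p = below λ m m<N → Z.sym (at< p m m<N)

    ≈[]-trans : ∀ {f g h} → f ≈[ N ] g → g ≈[ N ] h → f ≈[ N ] h
    ≈[]-trans p q = below λ m m<N → Z.trans (at< p m m<N) (at< q m m<N)

    +-cong[] : ∀ {f f′ g g′} → f ≈[ N ] f′ → g ≈[ N ] g′ → f + g ≈[ N ] f′ + g′
    +-cong[] p q = below λ m m<N → Z.+-cong (at< p m m<N) (at< q m m<N)

    -‿cong[] : ∀ {f g} → f ≈[ N ] g → - f ≈[ N ] - g
    -‿cong[] p = below λ m m<N → Z.-‿cong (at< p m m<N)

    *-cong[] : ∀ {f f′ g g′} → f ≈[ N ] f′ → g ≈[ N ] g′ → f * g ≈[ N ] f′ * g′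
    *-cong[] p q = below λ m m<N → S.⊛-cong-≤ m
      (λ k k≤m → at< p k (ℕ.≤-<-trans k≤m m<N)) (λ k k≤m → at< q k (ℕ.≤-<-trans k≤m m<N))

    twist-cong[] : ∀ c {f g} → f ≈[ N ] g → twist c f ≈[ N ] twist c g
    twist-cong[] c p = +-cong[] (below λ m m<N → Z.*-congˡ {Z7.ι m} (at< p m m<N)) (*-cong[] (≈⇒≈[] refl) p)

    twist³-cong[] : ∀ c {f g} → f ≈[ N ] g → twist³ c f ≈[ N ] twist³ c g
    twist³-cong[] c p = twist-cong[] c (twist-cong[] c (twist-cong[] c p))

  ≈[]-weaken : ∀ {M N f g} → M ≤ N → f ≈[ N ] g → f ≈[ M ] g
  ≈[]-weaken M≤N p = below λ m m<M → at< p m (ℕ.<-≤-trans m<M M≤N)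

  ≈[]⇒≈ : ∀ {f g} → (∀ N → f ≈[ suc N ] g) → f ≈ g
  ≈[]⇒≈ p = coeffwise λ m → at< (p m) m ℕ.≤-refl

  *-order : ∀ {M N f g} → f ≈[ M ] 0# → g ≈[ N ] 0# → f * g ≈[ M ℕ.+ N ] 0#
  *-order {M} {N} p q = below (S.⊛-order M N (at< p) (at< q))

  q : ℕ → ℤ⟦q⟧
  q e = ↑ (q^ e)

  q-+ : ∀ i j → q i * q j ≈ q (i ℕ.+ j)
  q-+ i j = coeffwise (go i)
    where
    go : ∀ i m → coeff (q i * q j) m ≈ᶻ (q^ (i ℕ.+ j)) m
    go zero    m       = at (*-identityˡ (q j)) m
    go (suc i) zero    = Z.refl
    go (suc i) (suc m) = Z.trans (Z.+-identityˡ _) (go i m)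

  q-^ : ∀ d n → q d ^ n ≈ q (d ℕ.* n)
  q-^ d zero    = trans (coeffwise λ _ → Z.refl) (reflexive (≡.cong q (≡.sym (ℕ.*-zeroʳ d))))
  q-^ d (suc n) = trans (*-congˡ (q-^ d n)) (trans (q-+ d (d ℕ.* n)) (reflexive (≡.cong q (≡.sym (ℕ.*-suc d n)))))

  q-order : ∀ {N e} → N ≤ e → q e ≈[ N ] 0#
  q-order {N} {e} N≤e = below λ m m<N → go e m (ℕ.<-≤-trans m<N N≤e)
    where
    go : ∀ e m → m < e → (q^ e) m ≈ᶻ 0ℤ
    go (suc e) zero    _         = Z.refl
    go (suc e) (suc m) (s≤s m<e) = go e m m<e

  coeff-ι : ∀ n f m → coeff (ι n * f) m ≈ᶻ Z7.ι n ℤ.* coeff f m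
  coeff-ι zero    f m = Z.trans (at (zeroˡ f) m) (Z.sym (Z.zeroˡ (coeff f m)))
  coeff-ι (suc n) f m = Z.trans (at (trans (*-congʳ (ι-suc n)) (trans (distribʳ f 1# (ι n)) (+-congʳ (*-identityˡ f)))) m)
    (Z.trans (Z.+-congˡ {coeff f m} (coeff-ι n f m))
      (Z.trans (Z7.solve 2 (λ x k → x Z7.:+ k Z7.:* x Z7.:= (Z7.con 1 Z7.:+ k) Z7.:* x) Z.refl (coeff f m) (Z7.ι n))
        (Z.*-congʳ {coeff f m} (Z.sym (Z7.ι-suc n)))))

  D-q : ∀ d → D (q d) ≈ ι d * q d
  D-q d = coeffwise λ m → Z.trans (go d m) (Z.sym (coeff-ι d (q d) m))
    where
    step : ∀ n x → Z7.ι (suc n) ℤ.* x ≈ᶻ x ℤ.+ Z7.ι n ℤ.* x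
    step n x = Z.trans (Z.*-congʳ {x} (Z7.ι-suc n))
      (Z7.solve 2 (λ x k → (Z7.con 1 Z7.:+ k) Z7.:* x Z7.:= x Z7.:+ k Z7.:* x) Z.refl x (Z7.ι n))

    go : ∀ d m → Z7.ι m ℤ.* (q^ d) m ≈ᶻ Z7.ι d ℤ.* (q^ d) m
    go zero    zero    = Z.refl
    go zero    (suc m) = Z.trans (Z.zeroʳ (Z7.ι (suc m))) (Z.sym (Z.zeroˡ 0ℤ))
    go (suc d) zero    = Z.trans (Z.zeroˡ 0ℤ) (Z.sym (Z.zeroʳ (Z7.ι (suc d))))
    go (suc d) (suc m) = Z.trans (step m ((q^ d) m)) (Z.trans (Z.+-congˡ {(q^ d) m} (go d m)) (Z.sym (step d ((q^ d) m))))

  ↑-* : ∀ f g → ↑ (f Defs.* g) ≈ ↑ f * ↑ g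
  ↑-* f g = coeffwise λ _ → Z.refl

  -- Infinite products

  Convergent : (ℕ → PowerSeries) → Set
  Convergent f = ∀ n → OneBelow (suc n) (f (suc n))

  ∏≤-suc : ∀ N f → ↑ ∏≤ (suc N) f ≈ ↑ ∏≤ N f * ↑ f (suc N)
  ∏≤-suc N f = ↑-* _ _

  ∏≤≈∏ : ∀ f → Convergent f → ∀ {M N} → M ≤ N → ↑ ∏≤ N f ≈[ suc M ] ↑ ∏ f
  ∏≤≈∏ f f≡1 {M} {N} M≤N = below λ { m (s≤s m≤M) → Z.reflexive (∏-limit f f≡1 m N (ℕ.≤-trans m≤M M≤N)) }

  ∏≤-cong : ∀ N f g → (∀ n → ↑ f (suc n) ≈ ↑ g (suc n)) → ↑ ∏≤ N f ≈ ↑ ∏≤ N g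
  ∏≤-cong zero    f g f≈g = refl
  ∏≤-cong (suc N) f g f≈g = begin
    ↑ ∏≤ (suc N) f            ≈⟨ ∏≤-suc N f ⟩
    ↑ ∏≤ N f * ↑ f (suc N)    ≈⟨ *-cong (∏≤-cong N f g f≈g) (f≈g N) ⟩
    ↑ ∏≤ N g * ↑ g (suc N)    ≈⟨ ∏≤-suc N g ⟨
    ↑ ∏≤ (suc N) g            ∎

  ∏≤-* : ∀ N f g → ↑ ∏≤ N (λ n → f n Defs.* g n) ≈ ↑ ∏≤ N f * ↑ ∏≤ N g
  ∏≤-* zero    f g = sym (*-identityˡ _)
  ∏≤-* (suc N) f g = begin
    ↑ ∏≤ (suc N) fg                                      ≈⟨ trans (∏≤-suc N fg) (*-cong (∏≤-* N f g) (↑-* (f (suc N)) (g (suc N)))) ⟩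
    ↑ ∏≤ N f * ↑ ∏≤ N g * (↑ f (suc N) * ↑ g (suc N))
      ≈⟨ solve 4 (λ a b c d → a :* b :* (c :* d) := a :* c :* (b :* d)) refl _ _ _ _ ⟩
    ↑ ∏≤ N f * ↑ f (suc N) * (↑ ∏≤ N g * ↑ g (suc N))    ≈⟨ *-cong (∏≤-suc N f) (∏≤-suc N g) ⟨
    ↑ ∏≤ (suc N) f * ↑ ∏≤ (suc N) g                      ∎
    where
    fg : ℕ → PowerSeries
    fg n = f n Defs.* g n

  ∏≤-one : ∀ N → ↑ ∏≤ N (λ _ → one) ≈ 1#
  ∏≤-one zero    = refl
  ∏≤-one (suc N) = trans (∏≤-suc N _) (trans (*-identityʳ _) (∏≤-one N))

  ∏-cong : ∀ f g → (∀ n → ↑ f (suc n) ≈ ↑ g (suc n)) → ↑ ∏ f ≈ ↑ ∏ g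
  ∏-cong f g f≈g = coeffwise λ m → at (∏≤-cong m f g f≈g) m

  ∏-* : ∀ f g → Convergent f → Convergent g → ↑ ∏ (λ n → f n Defs.* g n) ≈ ↑ ∏ f * ↑ ∏ g
  ∏-* f g f≡1 g≡1 = coeffwise λ m → Z.trans (at (∏≤-* m f g) m)
    (at< (*-cong[] (∏≤≈∏ f f≡1 (ℕ.≤-refl {m})) (∏≤≈∏ g g≡1 ℕ.≤-refl)) m ℕ.≤-refl)

  ∏-one : ↑ ∏ (λ _ → one) ≈ 1#
  ∏-one = coeffwise λ m → at (∏≤-one m) m

  ^-convergent : ∀ f e → Convergent f → Convergent (λ n → f n Defs.^ e)
  ^-convergent f e f≡1 n = ^-oneBelow e (f≡1 n)

  ∏-^ : ∀ f → Convergent f → ∀ e → ↑ ∏ (λ n → f n Defs.^ e) ≈ (↑ ∏ f) ^ e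
  ∏-^ f f≡1 zero    = ∏-one
  ∏-^ f f≡1 (suc e) = trans (∏-* f (λ n → f n Defs.^ e) f≡1 (^-convergent f e f≡1)) (*-congˡ (∏-^ f f≡1 e))

  ↑-^ : ∀ f e → ↑ (f Defs.^ e) ≈ (↑ f) ^ e
  ↑-^ f zero    = refl
  ↑-^ f (suc e) = trans (↑-* f (f Defs.^ e)) (*-congˡ (↑-^ f e))

  e-factor i-factor : ℕ → ℕ → PowerSeries
  e-factor d n = 1-q^ (d ℕ.* n)
  i-factor d n = 1/⟨1-q^ d ℕ.* n ⟩

  -- E d = (qᵈ; qᵈ)_∞ and I d = 1/E d.
  E I : ℕ → ℤ⟦q⟧
  E d = ↑ ∏ (e-factor d)
  I d = ↑ ∏ (i-factor d)

  E≤ I≤ : ℕ → ℕ → ℤ⟦q⟧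
  E≤ d N = ↑ ∏≤ N (e-factor d)
  I≤ d N = ↑ ∏≤ N (i-factor d)

  1-q≈ : ∀ e → ↑ (1-q^ e) ≈ 1# - q e
  1-q≈ e = coeffwise λ _ → Z.refl

  E≤-suc : ∀ d N → E≤ d (suc N) ≈ E≤ d N * (1# - q (d ℕ.* suc N))
  E≤-suc d N = trans (∏≤-suc N (e-factor d)) (*-congˡ (1-q≈ (d ℕ.* suc N)))

  module _ (d : ℕ) .{{_ : NonZero d}} where

    e-convergent : Convergent (e-factor d)
    e-convergent n = 1-q^-oneBelow (d ℕ.* suc n) (ℕ.m≤n*m (suc n) d)

    i-convergent : Convergent (i-factor d)
    i-convergent n = 1/⟨1-q^⟩-oneBelow (d ℕ.* suc n) (ℕ.m≤n*m (suc n) d)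

    factor-inverse : ∀ n → ↑ (e-factor d (suc n) Defs.* i-factor d (suc n)) ≈ 1#
    factor-inverse n = coeffwise λ m → Z.reflexive (1/⟨1-q^⟩-inverse (d ℕ.* suc n) {{ℕ.m*n≢0 d (suc n)}} m)

    E≤-inverse : ∀ N → E≤ d N * I≤ d N ≈ 1#
    E≤-inverse N = trans (sym (∏≤-* N (e-factor d) (i-factor d)))
      (trans (∏≤-cong N _ (λ _ → one) factor-inverse) (∏≤-one N))

    E-inverse : E d * I d ≈ 1#
    E-inverse = trans (sym (∏-* (e-factor d) (i-factor d) e-convergent i-convergent))
      (trans (∏-cong _ (λ _ → one) factor-inverse) ∏-one)

    E-frobenius : E (7 ℕ.* d) ≈ E d ^ 7
    E-frobenius = trans (∏-cong (e-factor (7 ℕ.* d)) (λ n → e-factor d n Defs.^ 7) λ n → begin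
      ↑ (1-q^ (7 ℕ.* d ℕ.* suc n))      ≡⟨ ≡.cong (λ e → ↑ (1-q^ e)) (e d (suc n)) ⟩
      ↑ (1-q^ (d ℕ.* suc n ℕ.* 7))      ≈⟨ 1-q≈ (d ℕ.* suc n ℕ.* 7) ⟩
      1# - q (d ℕ.* suc n ℕ.* 7)        ≈⟨ +-congˡ (-‿cong (q-^ (d ℕ.* suc n) 7)) ⟨
      1# - q (d ℕ.* suc n) ^ 7          ≈⟨ frobenius (q (d ℕ.* suc n)) ⟨
      (1# - q (d ℕ.* suc n)) ^ 7        ≈⟨ ^-congˡ 7 (1-q≈ (d ℕ.* suc n)) ⟨
      (↑ (1-q^ (d ℕ.* suc n))) ^ 7      ≈⟨ ↑-^ (e-factor d (suc n)) 7 ⟨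
      ↑ (e-factor d (suc n) Defs.^ 7)   ∎) (∏-^ (e-factor d) e-convergent 7)
      where
      e : ∀ d n → 7 ℕ.* d ℕ.* n ≡ d ℕ.* n ℕ.* 7
      e = ℕ.solve-∀

    !≈E≤ : ∀ {p} → p ≈ q d → ∀ N → (p !) N ≈ E≤ d N
    !≈E≤ p≈q zero    = refl
    !≈E≤ p≈q (suc N) = trans (*-cong (!≈E≤ p≈q N)
      (+-congˡ (-‿cong (trans (^-congˡ (suc N) p≈q) (q-^ d (suc N)))))) (sym (E≤-suc d N))

    E≈E≤ : ∀ {M} N → M ≤ N → E d ≈[ suc M ] E≤ d N
    E≈E≤ N M≤N = ≈[]-sym (∏≤≈∏ (e-factor d) e-convergent M≤N)

    module _ (p : ℤ⟦q⟧) (p≈q : p ≈ q d) where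

      private
        r⁻¹ : ℕ → ℤ⟦q⟧
        r⁻¹ = I≤ d

        r-inverse : ∀ N → (p !) N * r⁻¹ N ≈ 1#
        r-inverse N = trans (*-congʳ (!≈E≤ p≈q N)) (E≤-inverse N)

      -- The binomial [2n+1 choose n-k] tends to 1/(p;p)_∞. Of its three factors (p;p)_m the one of
      -- smallest index, m = n - k = i, fixes the precision, as (p;p)_m agrees with the infinite
      -- product below q^(m+1).
      E*C≈1 : ∀ k i → E d * C p r⁻¹ r-inverse (k ℕ.+ i) k ≈[ suc i ] 1#
      E*C≈1 k i = ≈[]-trans (≈⇒≈[] (*-congˡ (*-congʳ (*-congˡ (s-+ p r⁻¹ r-inverse k i)))))
        (≈[]-trans (*-cong[] (E≈E≤ i ℕ.≤-refl) (*-cong[] (*-cong[] r≈ (≈⇒≈[] refl)) (≈⇒≈[] refl)))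
          (≈⇒≈[] (begin
            e * (e′ * r⁻¹ i * r⁻¹ N)
              ≈⟨ solve 4 (λ e e′ i i′ → e :* (e′ :* i :* i′) := (e :* i) :* (e′ :* i′)) refl e e′ (r⁻¹ i) (r⁻¹ N) ⟩
            (e * r⁻¹ i) * (e′ * r⁻¹ N)  ≈⟨ *-cong (E≤-inverse i) (E≤-inverse N) ⟩
            1# * 1#                     ≈⟨ *-identityˡ 1# ⟩
            1#                          ∎)))
        where
        n N : ℕ
        n = k ℕ.+ i
        N = n ℕ.+ k ℕ.+ 1
        e e′ : ℤ⟦q⟧
        e = E≤ d i
        e′ = E≤ d N
        i≤n : i ≤ n
        i≤n = ℕ.m≤n+m i k
        r≈ : (p !) (2 ℕ.* n ℕ.+ 1) ≈[ suc i ] e′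
        r≈ = ≈[]-trans (≈⇒≈[] (!≈E≤ p≈q (2 ℕ.* n ℕ.+ 1)))
          (≈[]-trans (≈[]-sym (E≈E≤ _ (ℕ.≤-trans i≤n (ℕ.≤-trans (ℕ.m≤m+n n (n ℕ.+ 0)) (ℕ.m≤m+n _ 1)))))
                     (E≈E≤ N (ℕ.≤-trans i≤n (ℕ.≤-trans (ℕ.m≤m+n n k) (ℕ.m≤m+n _ 1)))))

      -- For larger k the binomials are less accurate, but W k is smaller: E d * C n k - 1 has order
      -- at least n - k + 1 and W k order at least k, so each term of the finite identity is correct
      -- modulo q^(n+1).
      theta-limit : (X : ℤ⟦q⟧) (W L : ℕ → ℤ⟦q⟧)
        (X-W-zero : X * W 0 ≈ W 1 + p * W 0)
        (X-W-suc : ∀ k → p ^ suc k * (X * W (suc k)) ≈ W (suc (suc k)) + p ^ (2 ℕ.* k ℕ.+ 3) * W k)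
        (L-zero : L 0 ≈ W 0)
        (L-suc : ∀ n → L (suc n) ≈ (1# + p ^ (2 ℕ.* n ℕ.+ 2) + p ^ n * X) * L n) →
        (∀ k → W k ≈[ k ] 0#) → ∀ n → E d * L n ≈[ suc n ] ∑< (suc n) W
      theta-limit X W L X-W-zero X-W-suc L-zero L-suc W-order n = ≈[]-trans
        (≈⇒≈[] (trans (*-congˡ (finite-theta p r⁻¹ r-inverse X W L X-W-zero X-W-suc L-zero L-suc n)) (*-∑< (suc n) (E d) _)))
        (sum[] (suc n) _ W λ k k<n → term k (ℕ.≤-pred k<n))
        where
        c : ℕ → ℤ⟦q⟧
        c = C p r⁻¹ r-inverse n

        sum[] : ∀ M f g → (∀ k → k < M → f k ≈[ suc n ] g k) → ∑< M f ≈[ suc n ] ∑< M g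
        sum[] zero    f g eq = ≈⇒≈[] refl
        sum[] (suc M) f g eq = +-cong[] (sum[] M f g λ k k<M → eq k (ℕ.m<n⇒m<1+n k<M)) (eq M ℕ.≤-refl)

        term : ∀ k → k ≤ n → E d * (c k * W k) ≈[ suc n ] W k
        term k k≤n = ≈[]-trans (≈⇒≈[] (begin
            E d * (c k * W k)                   ≈⟨ solve 3 (λ e c w → e :* (c :* w) := (e :* c :- con 1) :* w :+ w) refl (E d) (c k) (W k) ⟩
            (E d * c k - 1#) * W k + W k        ∎))
          (≈[]-trans (+-cong[] small (≈⇒≈[] refl)) (≈⇒≈[] (+-identityˡ (W k))))
          where
          i : ℕ
          i = n ∸ k
          Ec≈1 : E d * c k ≈[ suc i ] 1#
          Ec≈1 = ≡.subst (λ n → E d * C p r⁻¹ r-inverse n k ≈[ suc i ] 1#) (ℕ.m+[n∸m]≡n k≤n) (E*C≈1 k i)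
          small : (E d * c k - 1#) * W k ≈[ suc n ] 0#
          small = ≡.subst (λ N → (E d * c k - 1#) * W k ≈[ N ] 0#) (≡.cong suc (ℕ.m∸n+n≡m k≤n))
            (*-order (≈[]-trans (+-cong[] Ec≈1 (≈⇒≈[] refl)) (≈⇒≈[] (-‿inverseʳ 1#))) (W-order k))

  -- The theta series of Euler, Gauss and Jacobi

  module _ (d : ℕ) .{{d≢0 : NonZero d}} (t : ℤ⟦q⟧) (t≈q : t ≈ q d) where

    t^≈ : ∀ n → t ^ n ≈ q (d ℕ.* n)
    t^≈ n = trans (^-congˡ n t≈q) (q-^ d n)

    E≤-suc-t : ∀ N {n} → suc N ≡ n → E≤ d (suc N) ≈ E≤ d N * (1# - t ^ n)
    E≤-suc-t N ≡.refl = trans (E≤-suc d N) (*-congˡ (+-congˡ (-‿cong (sym (t^≈ (suc N))))))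

    E≤-*-suc : ∀ c .{{_ : NonZero c}} N {n} → c ℕ.* suc N ≡ n → E≤ (d ℕ.* c) (suc N) ≈ E≤ (d ℕ.* c) N * (1# - t ^ n)
    E≤-*-suc c N ≡.refl = trans (E≤-suc (d ℕ.* c) N)
      (*-congˡ (+-congˡ (-‿cong (trans (reflexive (≡.cong q (ℕ.*-assoc d c (suc N)))) (sym (t^≈ (c ℕ.* suc N)))))))

    binomial-order : ∀ k {m n} → k ≤ m → k ≤ n → sign k * (t ^ m - t ^ n) ≈[ k ] 0#
    binomial-order k {m} {n} k≤m k≤n = ≈[]-trans (*-cong[] (≈⇒≈[] refl) (+-cong[] (small k≤m) (-‿cong[] (small k≤n))))
      (≈⇒≈[] (solve 1 (λ s → s :* (con 0 :- con 0) := con 0) refl (sign k)))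
      where
      small : ∀ {m} → k ≤ m → t ^ m ≈[ k ] 0#
      small {m} k≤m = ≈[]-trans (≈⇒≈[] (t^≈ m)) (q-order (ℕ.≤-trans k≤m (ℕ.m≤n*m m d)))

    k≤τ : ∀ k → k ≤ τ (suc k)
    k≤τ k = ℕ.m≤n+m k (τ k)

    module _ (α β : ℕ) .{{_ : NonZero (α ℕ.+ β)}} (1≤β : 1 ≤ β) where
      open TripleProduct t α β

      triple-product : ∀ n → E (d ℕ.* (α ℕ.+ β)) * L n ≈[ suc n ] ∑< (suc n) W
      triple-product = theta-limit (d ℕ.* (α ℕ.+ β)) {{ℕ.m*n≢0 d (α ℕ.+ β)}} p (t^≈ (α ℕ.+ β))
        X W L X-W-zero X-W-suc (sym W-zero) L-suc
        λ k → binomial-order k (ℕ.≤-trans (k≤β*τ k) (ℕ.m≤n+m _ (α ℕ.* τ k))) (ℕ.≤-trans (k≤β*τ k) (ℕ.m≤n+m _ (α ℕ.* τ (2 ℕ.+ k))))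
        where
        k≤β*τ : ∀ k → k ≤ β ℕ.* τ (suc k)
        k≤β*τ k = ℕ.≤-trans (k≤τ k) (ℕ.m≤n*m _ β {{ℕ.>-nonZero 1≤β}})

    -- L n supplies the exponents up to 3n + 1 that are not divisible by 3, and the partial product
    -- of E_3d the multiples of 3, so that together they form a partial product of E_d.
    euler-series : ∀ n → E d ≈[ suc n ] ∑< (suc n) (TripleProduct.W t 1 2)
    euler-series n = ≈[]-trans (≈[]-trans (E≈E≤ d (n ℕ.* 3 ℕ.+ 1) (ℕ.≤-trans (ℕ.m≤m*n n 3) (ℕ.m≤m+n _ 1)))
      (≈[]-trans (≈⇒≈[] (sym (product n))) (*-cong[] (≈[]-sym (E≈E≤ (d ℕ.* 3) {{ℕ.m*n≢0 d 3}} n ℕ.≤-refl)) (≈⇒≈[] refl))))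
      (triple-product 1 2 (s≤s z≤n) n)
      where
      open TripleProduct t 1 2
      product : ∀ n → E≤ (d ℕ.* 3) n * L n ≈ E≤ d (n ℕ.* 3 ℕ.+ 1)
      product zero    = sym (E≤-suc-t 0 ≡.refl)
      product (suc n) = begin
        E≤ (d ℕ.* 3) (suc n) * L (suc n)     ≈⟨ *-congʳ (E≤-*-suc 3 n ≡.refl) ⟩
        E≤ (d ℕ.* 3) n * (1# - t ^ (3 ℕ.* suc n)) * (L n * ((1# - t ^ (1 ℕ.+ 3 ℕ.* suc n)) * (1# - t ^ (2 ℕ.+ 3 ℕ.* n))))
          ≈⟨ solve 5 (λ e l x y z → e :* y :* (l :* (z :* x)) := e :* l :* x :* y :* z) refl _ _ _ _ _ ⟩
        E≤ (d ℕ.* 3) n * L n * (1# - t ^ (2 ℕ.+ 3 ℕ.* n)) * (1# - t ^ (3 ℕ.* suc n)) * (1# - t ^ (1 ℕ.+ 3 ℕ.* suc n))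
          ≈⟨ *-congʳ (*-congʳ (*-congʳ (product n))) ⟩
        E≤ d N * (1# - t ^ (2 ℕ.+ 3 ℕ.* n)) * (1# - t ^ (3 ℕ.* suc n)) * (1# - t ^ (1 ℕ.+ 3 ℕ.* suc n))
          ≈⟨ *-congʳ (*-congʳ (E≤-suc-t N (e₂ n))) ⟨
        E≤ d (1 ℕ.+ N) * (1# - t ^ (3 ℕ.* suc n)) * (1# - t ^ (1 ℕ.+ 3 ℕ.* suc n))
          ≈⟨ *-congʳ (E≤-suc-t (1 ℕ.+ N) (e₃ n)) ⟨
        E≤ d (2 ℕ.+ N) * (1# - t ^ (1 ℕ.+ 3 ℕ.* suc n))
          ≈⟨ E≤-suc-t (2 ℕ.+ N) (e₄ n) ⟨
        E≤ d (3 ℕ.+ N)                       ∎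
        where
        N : ℕ
        N = n ℕ.* 3 ℕ.+ 1
        e₂ : ∀ n → suc (n ℕ.* 3 ℕ.+ 1) ≡ 2 ℕ.+ 3 ℕ.* n
        e₂ = ℕ.solve-∀
        e₃ : ∀ n → 2 ℕ.+ (n ℕ.* 3 ℕ.+ 1) ≡ 3 ℕ.* suc n
        e₃ = ℕ.solve-∀
        e₄ : ∀ n → 3 ℕ.+ (n ℕ.* 3 ℕ.+ 1) ≡ 1 ℕ.+ 3 ℕ.* suc n
        e₄ = ℕ.solve-∀

    -- L n contains the odd exponents up to 2n + 1 once and those up to 2n - 1 a second time. Two
    -- copies of E_2d complete them to two copies of E_d, and dividing by E_2d leaves the one copy
    -- that the triple product demands.
    gauss-series : ∀ n → E d ^ 2 * I (d ℕ.* 2) ≈[ suc n ] ∑< (suc n) (TripleProduct.W t 1 1)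
    gauss-series n = ≈[]-trans (≈[]-trans (*-cong[] (≈[]-trans E²≈ (≈⇒≈[] (sym (product n)))) (≈⇒≈[] refl))
      (≈[]-trans (*-cong[] (*-cong[] (*-cong[] E₂≈ E₂≈) (≈⇒≈[] refl)) (≈⇒≈[] refl)) (≈⇒≈[] cancel)))
      (triple-product 1 1 (s≤s z≤n) n)
      where
      open TripleProduct t 1 1
      e₂ i₂ : ℤ⟦q⟧
      e₂ = E (d ℕ.* 2)
      i₂ = I (d ℕ.* 2)
      n≤n*2 : n ≤ n ℕ.* 2
      n≤n*2 = ℕ.m≤m*n n 2
      E²≈ : E d ^ 2 ≈[ suc n ] E≤ d (n ℕ.* 2 ℕ.+ 1) * E≤ d (n ℕ.* 2)
      E²≈ = ≈[]-trans (≈⇒≈[] (*-congˡ (*-identityʳ _)))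
        (*-cong[] (E≈E≤ d (n ℕ.* 2 ℕ.+ 1) (ℕ.≤-trans n≤n*2 (ℕ.m≤m+n _ 1))) (E≈E≤ d (n ℕ.* 2) n≤n*2))
      E₂≈ : E≤ (d ℕ.* 2) n ≈[ suc n ] e₂
      E₂≈ = ≈[]-sym (E≈E≤ (d ℕ.* 2) {{ℕ.m*n≢0 d 2}} n ℕ.≤-refl)
      cancel : e₂ * e₂ * L n * i₂ ≈ e₂ * L n
      cancel = begin
        e₂ * e₂ * L n * i₂     ≈⟨ solve 3 (λ e i l → e :* e :* l :* i := (e :* i) :* (e :* l)) refl e₂ i₂ (L n) ⟩
        (e₂ * i₂) * (e₂ * L n) ≈⟨ trans (*-congʳ (E-inverse (d ℕ.* 2) {{ℕ.m*n≢0 d 2}})) (*-identityˡ _) ⟩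
        e₂ * L n               ∎
      product : ∀ n → E≤ (d ℕ.* 2) n * E≤ (d ℕ.* 2) n * L n ≈ E≤ d (n ℕ.* 2 ℕ.+ 1) * E≤ d (n ℕ.* 2)
      product zero    = begin
        1# * 1# * L 0                ≈⟨ solve 1 (λ l → con 1 :* con 1 :* l := con 1 :* l :* con 1) refl (L 0) ⟩
        1# * L 0 * 1#                ≈⟨ *-congʳ (E≤-suc-t 0 ≡.refl) ⟨
        E≤ d 1 * E≤ d 0              ∎
      product (suc n) = begin
        E≤ (d ℕ.* 2) (suc n) * E≤ (d ℕ.* 2) (suc n) * L (suc n)
          ≈⟨ *-congʳ (*-cong (E≤-*-suc 2 n ≡.refl) (E≤-*-suc 2 n ≡.refl)) ⟩
        ε * y * (ε * y) * (L n * (z * x))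
          ≈⟨ solve 5 (λ e l x y z → e :* y :* (e :* y) :* (l :* (z :* x)) := e :* e :* l :* (y :* z :* (x :* y))) refl ε (L n) x y z ⟩
        ε * ε * L n * (y * z * (x * y))
          ≈⟨ *-congʳ (product n) ⟩
        E≤ d (N ℕ.+ 1) * E≤ d N * (y * z * (x * y))
          ≈⟨ solve 5 (λ e e′ x y z → e :* e′ :* (y :* z :* (x :* y)) := e :* y :* z :* (e′ :* x :* y)) refl (E≤ d (N ℕ.+ 1)) (E≤ d N) x y z ⟩
        E≤ d (N ℕ.+ 1) * y * z * (E≤ d N * x * y)
          ≈⟨ *-cong (trans (E≤-suc-t (1 ℕ.+ (N ℕ.+ 1)) (s₁ n)) (*-congʳ (E≤-suc-t (N ℕ.+ 1) (s₂ n))))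
                    (trans (E≤-suc-t (1 ℕ.+ N) (s₃ n)) (*-congʳ (E≤-suc-t N (s₄ n)))) ⟨
        E≤ d (2 ℕ.+ (N ℕ.+ 1)) * E≤ d (2 ℕ.+ N) ∎
        where
        N : ℕ
        N = n ℕ.* 2
        ε x y z : ℤ⟦q⟧
        ε = E≤ (d ℕ.* 2) n
        x = 1# - t ^ (1 ℕ.+ 2 ℕ.* n)
        y = 1# - t ^ (2 ℕ.* suc n)
        z = 1# - t ^ (1 ℕ.+ 2 ℕ.* suc n)
        s₁ : ∀ n → 2 ℕ.+ (n ℕ.* 2 ℕ.+ 1) ≡ 1 ℕ.+ 2 ℕ.* suc n
        s₁ = ℕ.solve-∀
        s₂ : ∀ n → suc (n ℕ.* 2 ℕ.+ 1) ≡ 2 ℕ.* suc n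
        s₂ = ℕ.solve-∀
        s₃ : ∀ n → 2 ℕ.+ n ℕ.* 2 ≡ 2 ℕ.* suc n
        s₃ = ℕ.solve-∀
        s₄ : ∀ n → suc (n ℕ.* 2) ≡ 1 ℕ.+ 2 ℕ.* n
        s₄ = ℕ.solve-∀

    -- Here L n is (p;p)ₙ², and the factor E d of `theta-limit` supplies the third power.
    jacobi-series : ∀ n → E d ^ 3 ≈[ suc n ] ∑< (suc n) (CubeProduct.W t)
    jacobi-series n = ≈[]-trans (≈[]-trans (≈⇒≈[] (*-congˡ (*-congˡ (*-identityʳ _))))
      (*-cong[] (≈⇒≈[] refl) (*-cong[] !≈E !≈E)))
      (theta-limit d t t≈q X W L X-W-zero X-W-suc L-zero L-suc order n)
      where
      open CubeProduct t
      !≈E : E d ≈[ suc n ] (t !) n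
      !≈E = ≈[]-trans (E≈E≤ d n ℕ.≤-refl) (≈⇒≈[] (sym (!≈E≤ d t≈q n)))
      order : ∀ k → W k ≈[ k ] 0#
      order k = ≈[]-trans (*-cong[] (≈⇒≈[] refl) (*-cong[] (≈⇒≈[] refl)
        (≈[]-trans (≈⇒≈[] (t^≈ (τ (suc k)))) (q-order (ℕ.≤-trans (k≤τ k) (ℕ.m≤n*m _ d))))))
        (≈⇒≈[] (solve 2 (λ s c → s :* (c :* con 0) := con 0) refl (sign k) (ι (2 ℕ.* k ℕ.+ 1))))

  -- Differential equations for the infinite products

  twist-congᶜ : ∀ {c c′} → c ≈ c′ → ∀ f → twist c f ≈ twist c′ f
  twist-congᶜ c≈c′ f = +-congˡ (*-congʳ c≈c′)

  twist³-congᶜ : ∀ {c c′} → c ≈ c′ → ∀ f → twist³ c f ≈ twist³ c′ f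
  twist³-congᶜ {c} c≈c′ f = trans (twist-cong c (trans (twist-cong c (twist-congᶜ c≈c′ f)) (twist-congᶜ c≈c′ _))) (twist-congᶜ c≈c′ _)

  D-E49 : ∀ d .{{_ : NonZero d}} → D (E (49 ℕ.* d)) ≈ 0#
  D-E49 d = begin
    D (E (49 ℕ.* d))              ≡⟨ ≡.cong (λ n → D (E n)) (ℕ.*-assoc 7 7 d) ⟩
    D (E (7 ℕ.* (7 ℕ.* d)))       ≈⟨ D-cong (E-frobenius (7 ℕ.* d) {{ℕ.m*n≢0 7 d}}) ⟩
    D (E (7 ℕ.* d) ^ 7)           ≈⟨ D-^7 _ ⟩
    0#                            ∎

  module Equations (d : ℕ) .{{d≢0 : NonZero d}} (d³≈1 : ι d ^ 3 ≈ 1#) where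

    private
      instance
        49d≢0 : NonZero (49 ℕ.* d)
        49d≢0 = ℕ.m*n≢0 49 d

      q^49≈ : q d ^ 49 ≈ q (49 ℕ.* d)
      q^49≈ = trans (q-^ d 49) (reflexive (≡.cong q (ℕ.*-comm d 49)))

    jacobi-equation : twist³ (ι d) (E d ^ 3) ≈ E d ^ 3
    jacobi-equation = ≈[]⇒≈ λ n → ≈[]-trans (twist³-cong[] (ι d) (jacobi-series d (q d) refl n))
      (≈[]-trans (≈⇒≈[] (trans (twist³-∑< (ι d) (suc n) _) (∑<-cong (suc n) λ k _ →
          trans (twist³-congᶜ (sym (*-identityˡ (ι d))) _) (jacobi-term (q d) (ι d) (D-q d) (D-ι d) d³≈1 k))))
        (≈[]-sym (jacobi-series d (q d) refl n)))

    euler-equation : twist³ (ι 5 * ι d) (E d) ≈ - E d - q d ^ 2 * E (49 ℕ.* d)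
    euler-equation = begin
      twist³ c (E d)                             ≈⟨ solve 2 (λ x y → x := (x :+ y) :- y) refl _ (E d) ⟩
      twist³ c (E d) + E d - E d                 ≈⟨ +-congʳ (≈[]⇒≈ coefficients) ⟩
      - (q d ^ 2) * E (49 ℕ.* d) - E d            ≈⟨ solve 3 (λ t e f → :- t :* f :- e := :- e :- t :* f) refl (q d ^ 2) (E d) _ ⟩
      - E d - q d ^ 2 * E (49 ℕ.* d)              ∎
      where
      c : ℤ⟦q⟧
      c = ι 5 * ι d
      coefficients : ∀ n → twist³ c (E d) + E d ≈[ suc n ] - (q d ^ 2) * E (49 ℕ.* d)
      coefficients n = ≈[]-trans
        -- The left side takes 7(n + 1) terms, which collapse to n + 1 terms of the series in q⁴⁹;
        -- the precision is lowered accordingly.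
        (≈[]-weaken (ℕ.m≤m*n (suc n) 7) (+-cong[]
          (twist³-cong[] c (euler-series d (q d) refl (6 ℕ.+ n ℕ.* 7)))
          (euler-series d (q d) refl (6 ℕ.+ n ℕ.* 7))))
        (≈[]-trans (≈⇒≈[] (Euler.theta-sum (q d) (ι d) (D-q d) (D-ι d) d³≈1 (suc n)))
          (*-cong[] (≈⇒≈[] refl) (≈[]-sym (euler-series (49 ℕ.* d) (q d ^ 49) q^49≈ n))))

    gauss-equation : twist³ 0# (E d ^ 2 * I (d ℕ.* 2)) ≈ E d ^ 2 * I (d ℕ.* 2) - E (49 ℕ.* d) ^ 2 * I (49 ℕ.* d ℕ.* 2)
    gauss-equation = begin
      twist³ 0# φ                                ≈⟨ solve 2 (λ x y → x := (x :- y) :+ y) refl _ φ ⟩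
      twist³ 0# φ - φ + φ                        ≈⟨ +-congʳ (+-congʳ (twist³-congᶜ (zeroˡ (ι d)) φ)) ⟨
      twist³ (ι 0 * ι d) φ - φ + φ               ≈⟨ +-congʳ (≈[]⇒≈ coefficients) ⟩
      - φ₄₉ + φ                                   ≈⟨ A.+-comm _ _ ⟩
      φ - φ₄₉                                     ∎
      where
      φ φ₄₉ : ℤ⟦q⟧
      φ = E d ^ 2 * I (d ℕ.* 2)
      φ₄₉ = E (49 ℕ.* d) ^ 2 * I (49 ℕ.* d ℕ.* 2)
      coefficients : ∀ n → twist³ (ι 0 * ι d) φ - φ ≈[ suc n ] - φ₄₉
      coefficients n = ≈[]-trans
        (≈[]-weaken (ℕ.m≤m*n (suc n) 7) (+-cong[]
          (twist³-cong[] _ (gauss-series d (q d) refl (6 ℕ.+ n ℕ.* 7)))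
          (-‿cong[] (gauss-series d (q d) refl (6 ℕ.+ n ℕ.* 7)))))
        (≈[]-trans (≈⇒≈[] (Gauss.theta-sum (q d) (ι d) (D-q d) (D-ι d) d³≈1 (suc n)))
          (-‿cong[] (≈[]-sym (gauss-series (49 ℕ.* d) (q d ^ 49) q^49≈ n))))

    D-r : D (q d ^ 2 * E (49 ℕ.* d)) ≈ ι 2 * (ι d * (q d ^ 2 * E (49 ℕ.* d)))
    D-r = begin
      D (q d ^ 2 * e)                             ≈⟨ D-* (q d ^ 2) e ⟩
      D (q d ^ 2) * e + q d ^ 2 * D e             ≈⟨ +-cong (*-congʳ (D-t^ (q d) (ι d) (D-q d) (D-ι d) d³≈1 2)) (*-congˡ (D-E49 d)) ⟩
      ι 2 * ι d * q d ^ 2 * e + q d ^ 2 * 0#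
        ≈⟨ solve 3 (λ δ t e → con 2 :* δ :* t :* e :+ t :* con 0 := con 2 :* (δ :* (t :* e))) refl (ι d) (q d ^ 2) e ⟩
      ι 2 * (ι d * (q d ^ 2 * e))                 ∎
      where
      e : ℤ⟦q⟧
      e = E (49 ℕ.* d)

    open LogDerivative (ι d) (E d) (I d) (q d ^ 2 * E (49 ℕ.* d)) (D-ι d) (E-inverse d) D-r jacobi-equation euler-equation public

  -- Levels 1 and 2 together

  private
    module E₁ = Equations 1 (solve 0 (con 1 :^ 3 := con 1) refl)
    module E₂ = Equations 2 (solve 0 (con 2 :^ 3 := con 1) refl)

  logarithmic-derivative : ∀ {e i} → e * i ≈ 1# → D e ≈ D e * i * e
  logarithmic-derivative {e} {i} ei≈1 = begin
    D e                ≈⟨ *-identityʳ _ ⟨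
    D e * 1#           ≈⟨ *-congˡ ei≈1 ⟨
    D e * (e * i)      ≈⟨ solve 3 (λ e′ e i → e′ :* (e :* i) := e′ :* i :* e) refl (D e) e i ⟩
    D e * i * e        ∎

  φ φ⁻¹ φ₄₉ : ℤ⟦q⟧
  φ = E 1 ^ 2 * I 2
  φ⁻¹ = E 2 * I 1 ^ 2
  φ₄₉ = E 49 ^ 2 * I 98

  φφ⁻¹≈1 : φ * φ⁻¹ ≈ 1#
  φφ⁻¹≈1 = begin
    E 1 ^ 2 * I 2 * (E 2 * I 1 ^ 2)
      ≈⟨ solve 4 (λ e₁ i₁ e₂ i₂ → e₁ :^ 2 :* i₂ :* (e₂ :* i₁ :^ 2) := (e₁ :* i₁) :^ 2 :* (e₂ :* i₂)) refl (E 1) (I 1) (E 2) (I 2) ⟩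
    (E 1 * I 1) ^ 2 * (E 2 * I 2)      ≈⟨ *-cong (^-congˡ 2 (E-inverse 1)) (E-inverse 2) ⟩
    1# ^ 2 * 1#                        ≈⟨ solve 0 (con 1 :^ 2 :* con 1 := con 1) refl ⟩
    1#                                 ∎

  D-φ₄₉ : D φ₄₉ ≈ 0#
  D-φ₄₉ = begin
    D φ₄₉                                               ≈⟨ D-* _ _ ⟩
    D (E 49 ^ 2) * I 98 + E 49 ^ 2 * D (I 98)
      ≈⟨ +-cong (*-congʳ (trans (D-^ (E 49) 1) (*-congˡ (*-congˡ (D-E49 1)))))
                (*-congˡ (trans (D-inverse (E-inverse 98)) (-‿cong (*-congˡ (D-E49 2))))) ⟩
    ι 2 * (E 49 ^ 1 * 0#) * I 98 + E 49 ^ 2 * - (I 98 * I 98 * 0#)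
      ≈⟨ solve 3 (λ e e² i → con 2 :* (e :* con 0) :* i :+ e² :* (:- (i :* i :* con 0)) := con 0) refl _ _ _ ⟩
    0#                                                  ∎

  private
    v₁ v₂ : ℤ⟦q⟧
    v₁ = D (E 1) * I 1
    v₂ = D (E 2) * I 2

    D-E₁ : D (E 1) ≈ v₁ * E 1
    D-E₁ = logarithmic-derivative (E-inverse 1)

    D-E₂ : D (E 2) ≈ v₂ * E 2
    D-E₂ = logarithmic-derivative (E-inverse 2)

  twist-φ : twist 0# φ ≈ (ι 2 * E₁.u - E₂.u) * φ
  twist-φ = begin
    D φ + 0# * φ
      ≈⟨ +-congʳ (trans (D-* _ _) (+-cong (*-congʳ (trans (D-^ (E 1) 1) (*-congˡ (*-congˡ D-E₁)))) (*-congˡ (D-inverse (E-inverse 2))))) ⟩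
    ι 2 * (E 1 ^ 1 * (v₁ * E 1)) * I 2 + E 1 ^ 2 * - (I 2 * I 2 * D (E 2)) + 0# * φ
      ≈⟨ solve 4 (λ e i v d → con 2 :* (e :^ 1 :* (v :* e)) :* i :+ e :^ 2 :* (:- (i :* i :* d)) :+ con 0 :* (e :^ 2 :* i) :=
           (con 2 :* (con 5 :* con 1 :+ v) :- (con 5 :* con 2 :+ d :* i)) :* (e :^ 2 :* i)) refl (E 1) (I 2) v₁ (D (E 2)) ⟩
    (ι 2 * E₁.u - E₂.u) * φ ∎

  F : ℤ⟦q⟧
  F = E 1 ^ 4 * E 2

  -- The fractional exponent is 4/24 + 2/24 = 1/4, in residues 4 · 5 + 5 · 2 ≡ 2.
  twist-F : twist (ι 2) F ≈ (ι 4 * E₁.u + E₂.u) * F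
  twist-F = begin
    D F + ι 2 * F
      ≈⟨ +-congʳ (trans (D-* _ _) (+-cong (*-congʳ (trans (D-^ (E 1) 3) (*-congˡ (*-congˡ D-E₁)))) (*-congˡ D-E₂))) ⟩
    ι 4 * (E 1 ^ 3 * (v₁ * E 1)) * E 2 + E 1 ^ 4 * (v₂ * E 2) + ι 2 * F
      ≈⟨ solve 4 (λ e₁ e₂ v w → con 4 :* (e₁ :^ 3 :* (v :* e₁)) :* e₂ :+ e₁ :^ 4 :* (w :* e₂) :+ con 2 :* (e₁ :^ 4 :* e₂) :=
           (con 4 :* (con 5 :* con 1 :+ v) :+ (con 5 :* con 2 :+ w)) :* (e₁ :^ 4 :* e₂)) refl (E 1) (E 2) v₁ v₂ ⟩
    (ι 4 * E₁.u + E₂.u) * F ∎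

  cancel-order-1 : ∀ c h → coeff h 0 ≈ᶻ 0ℤ → c ℤ.* coeff h 1 ≈ᶻ 1ℤ → ∀ g → g * h ≈ 0# → g ≈ 0#
  cancel-order-1 c h h₀≈0 ch₁≈1 g gh≈0 = coeffwise (S.⊛-cancel₁ {c} {coeff h} {coeff g} h₀≈0 ch₁≈1 (at gh≈0))

  cofactor : ℤ⟦q⟧
  cofactor = (E₁.Q + E₂.Q) * ((E₁.Q ^ 2 - E₂.Q ^ 2) ^ 2 - ι 2 * E₂.Q)

  -- Modulo 7 and q², Q is 1 + 2q and T is 4, so the cofactor begins with 2q. It is not a unit, but
  -- it is q times one, and 4 inverts 2. Both coefficients are checked by evaluation.
  cofactor-cancel : ∀ g → g * cofactor ≈ 0# → g ≈ 0#
  cofactor-cancel = cancel-order-1 (+ 4) cofactor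
    (mod7 (toWitness {a? = + 7 ∣? coeff cofactor 0 ℤ.- 0ℤ} _))
    (mod7 (toWitness {a? = + 7 ∣? + 4 ℤ.* coeff cofactor 1 ℤ.- 1ℤ} _))

  open TwoLevels E₁.u E₂.u E₁.Q E₂.Q φ φ⁻¹ φ₄₉ E₁.u≈5Q² E₁.D-Q E₂.u≈5Q² E₂.D-Q φφ⁻¹≈1 D-φ₄₉ twist-φ
    (Equations.gauss-equation 1 (solve 0 (con 1 :^ 3 := con 1) refl)) cofactor-cancel using (twist⁶)

  -- The square root of Z ≈ (1 − Q³)², with the sign fixed by the coefficient of q.
  1-Q³≈ : ι 1 - E₁.Q ^ 3 ≈ q 1 * E 1 ^ 24
  1-Q³≈ = begin
    x                  ≈⟨ solve 2 (λ x y → x := (x :- y) :+ y) refl x y ⟩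
    (x - y) + y        ≈⟨ +-congʳ (cancel-order-1 (+ 4) (x + y)
                            (mod7 (toWitness {a? = + 7 ∣? coeff (x + y) 0 ℤ.- 0ℤ} _))
                            (mod7 (toWitness {a? = + 7 ∣? + 4 ℤ.* coeff (x + y) 1 ℤ.- 1ℤ} _)) (x - y) difference) ⟩
    0# + y             ≈⟨ +-identityˡ y ⟩
    y                  ∎
    where
    x y e i : ℤ⟦q⟧
    x = ι 1 - E₁.Q ^ 3
    y = q 1 * E 1 ^ 24
    e = E 1
    i = I 1
    x²≈y² : x ^ 2 ≈ y ^ 2
    x²≈y² = begin
      x ^ 2                                 ≈⟨ E₁.Z≈[1-Q³]² ⟨
      q 1 ^ 2 * E 49 * i                    ≈⟨ *-congʳ (*-congˡ (trans (E-frobenius 7) (^-congˡ 7 (E-frobenius 1)))) ⟩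
      q 1 ^ 2 * (e ^ 7) ^ 7 * i
        ≈⟨ solve 3 (λ t e i → t :^ 2 :* (e :^ 7) :^ 7 :* i := (t :* e :^ 24) :^ 2 :* (e :* i)) refl (q 1) e i ⟩
      y ^ 2 * (e * i)                       ≈⟨ trans (*-congˡ (E-inverse 1)) (*-identityʳ _) ⟩
      y ^ 2                                 ∎
    difference : (x - y) * (x + y) ≈ 0#
    difference = begin
      (x - y) * (x + y)   ≈⟨ solve 2 (λ x y → (x :- y) :* (x :+ y) := x :^ 2 :- y :^ 2) refl x y ⟩
      x ^ 2 - y ^ 2       ≈⟨ +-congʳ x²≈y² ⟩
      y ^ 2 - y ^ 2       ≈⟨ -‿inverseʳ _ ⟩
      0#                  ∎

  -- The factor 1 - Q³ is Δ(q), and (1 - T³)² is Δ(q²)² directly, so that level 2 requires no square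
  -- root. Multiplied by F they give q⁵ E₁²⁸ E₂⁴⁹, which is q⁵ times a series in q⁷: only the
  -- exponents kept by `U` occur in it.
  twist⁶-F : twist³ (ι 2) (twist³ (ι 2) F) ≈ F + q 5 * E 7 ^ 4 * E 14 ^ 7
  twist⁶-F = begin
    twist³ (ι 2) (twist³ (ι 2) F)
      ≈⟨ twist⁶ twist-F ⟩
    (ι 1 + (ι 1 - E₁.Q ^ 3) * (ι 1 - E₂.Q ^ 3) ^ 2) * F
      ≈⟨ *-congʳ (+-congˡ (*-cong 1-Q³≈ (trans (sym E₂.Z≈[1-Q³]²) (*-congʳ (*-congˡ (E-frobenius 14)))))) ⟩
    (ι 1 + q 1 * E 1 ^ 24 * (q 2 ^ 2 * E 14 ^ 7 * I 2)) * (E 1 ^ 4 * E 2)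
      ≈⟨ solve 6 (λ t s e₁ e₂ i₂ g → (con 1 :+ t :* e₁ :^ 24 :* (s :* g :* i₂)) :* (e₁ :^ 4 :* e₂) :=
           e₁ :^ 4 :* e₂ :+ t :* s :* (e₁ :^ 7) :^ 4 :* g :* (e₂ :* i₂)) refl (q 1) (q 2 ^ 2) (E 1) (E 2) (I 2) (E 14 ^ 7) ⟩
    F + q 1 * q 2 ^ 2 * (E 1 ^ 7) ^ 4 * E 14 ^ 7 * (E 2 * I 2)
      ≈⟨ +-congˡ (trans (*-congˡ (E-inverse 2)) (trans (*-identityʳ _)
           (*-congʳ (*-cong (trans (*-congˡ (q-^ 2 2)) (q-+ 1 4)) (^-congˡ 4 (sym (E-frobenius 1))))))) ⟩
    F + q 5 * E 7 ^ 4 * E 14 ^ 7 ∎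

  -- Extraction of the exponents 7n + 5

  U : ℤ⟦q⟧ → ℤ⟦q⟧
  coeff (U f) n = coeff f (7 ℕ.* n ℕ.+ 5)

  U-cong : ∀ {f g} → f ≈ g → U f ≈ U g
  U-cong f≈g = coeffwise λ n → at f≈g (7 ℕ.* n ℕ.+ 5)

  U-+ : ∀ f g → U (f + g) ≈ U f + U g
  U-+ f g = coeffwise λ _ → Z.refl

  -- Twisting by 2 multiplies the coefficient of q^m by m + 2, which is 0 modulo 7 when m ≡ 5. The
  -- outermost of the six twists therefore suffices.
  U-twist : ∀ f → U (twist (ι 2) f) ≈ 0#
  U-twist f = coeffwise λ n → let m = 7 ℕ.* n ℕ.+ 5; x = coeff f m in
    Z.trans (Z.+-congˡ {Z7.ι m ℤ.* x} (coeff-ι 2 f m))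
      (Z.trans (Z.+-congʳ {Z7.ι 2 ℤ.* x} (Z.*-congʳ {x} (residue n)))
        (Z7.solve 1 (λ x → Z7.con 5 Z7.:* x Z7.:+ Z7.con 2 Z7.:* x Z7.:= Z7.con 0) Z.refl x))
    where
    residue : ∀ n → Z7.ι (7 ℕ.* n ℕ.+ 5) ≈ᶻ Z7.ι 5
    residue n = Z.trans (Z7.ι-+ (7 ℕ.* n) 5) (Z.trans (Z.+-congʳ (Z.trans (Z.reflexive (≡.cong Z7.ι (ℕ.*-comm 7 n))) (Z7.ι-*7 n))) (Z.+-identityˡ (Z7.ι 5)))

  -- Says that h = g(q⁷), in the only form in which this is used.
  Inflates : ℤ⟦q⟧ → ℤ⟦q⟧ → Set
  Inflates g h = ∀ f → U (f * h) ≈ U f * g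

  inflates-≈ : ∀ {g g′ h h′} → g ≈ g′ → h ≈ h′ → Inflates g h → Inflates g′ h′
  inflates-≈ g≈g′ h≈h′ p f = trans (U-cong (*-congˡ (sym h≈h′))) (trans (p f) (*-congˡ g≈g′))

  inflates-1 : Inflates 1# 1#
  inflates-1 f = trans (U-cong (*-identityʳ f)) (sym (*-identityʳ (U f)))

  inflates-* : ∀ {g g′ h h′} → Inflates g h → Inflates g′ h′ → Inflates (g * g′) (h * h′)
  inflates-* {g} {g′} {h} {h′} p p′ f = begin
    U (f * (h * h′))      ≈⟨ U-cong (*-assoc f h h′) ⟨
    U (f * h * h′)        ≈⟨ p′ (f * h) ⟩
    U (f * h) * g′        ≈⟨ *-congʳ (p f) ⟩
    U f * g * g′          ≈⟨ *-assoc _ _ _ ⟩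
    U f * (g * g′)        ∎

  inflates-^ : ∀ {g h} → Inflates g h → ∀ e → Inflates (g ^ e) (h ^ e)
  inflates-^ p zero    = inflates-1
  inflates-^ p (suc e) = inflates-* p (inflates-^ p e)

  inflates-q : ∀ d → Inflates (q d) (q (7 ℕ.* d))
  inflates-q d f = trans (U-cong (*-comm f (q (7 ℕ.* d)))) (trans (coeffwise λ n →
      Z.trans (Z.reflexive (q^-* (7 ℕ.* d) (coeff f) (7 ℕ.* n ℕ.+ 5)))
        (Z.trans (Z.reflexive (shift d n)) (Z.reflexive (≡.sym (q^-* d (coeff (U f)) n)))))
    (*-comm (q d) (U f)))
    where
    shift : ∀ d n → (if 7 ℕ.* d ℕ.≤ᵇ 7 ℕ.* n ℕ.+ 5 then coeff f (7 ℕ.* n ℕ.+ 5 ∸ 7 ℕ.* d) else 0ℤ) ≡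
                    (if d ℕ.≤ᵇ n then coeff f (7 ℕ.* (n ∸ d) ℕ.+ 5) else 0ℤ)
    shift d n with d ℕ.≤? n
    ... | yes d≤n rewrite dec-true (d ℕ.≤? n) d≤n
                        | dec-true (7 ℕ.* d ℕ.≤? 7 ℕ.* n ℕ.+ 5) (ℕ.≤-trans (ℕ.*-monoʳ-≤ 7 d≤n) (ℕ.m≤m+n _ 5)) =
      ≡.cong (coeff f) (≡.trans (ℕ.+-∸-comm 5 (ℕ.*-monoʳ-≤ 7 d≤n)) (≡.cong (ℕ._+ 5) (≡.sym (ℕ.*-distribˡ-∸ 7 n d))))
    ... | no d≰n rewrite dec-false (d ℕ.≤? n) d≰n
                       | dec-false (7 ℕ.* d ℕ.≤? 7 ℕ.* n ℕ.+ 5) (ℕ.<⇒≱ (ℕ.<-≤-trans (ℕ.+-monoʳ-< (7 ℕ.* n) {5} {7} (ℕ.m≤n+m 6 1))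
                           (≡.subst (ℕ._≤ 7 ℕ.* d) (≡.trans (ℕ.*-suc 7 n) (ℕ.+-comm 7 (7 ℕ.* n))) (ℕ.*-monoʳ-≤ 7 (ℕ.≰⇒> d≰n))))) = ≡.refl

  inflates-factor : ∀ d → Inflates (1# - q d) (1# - q (7 ℕ.* d))
  inflates-factor d f = begin
    U (f * (1# - q (7 ℕ.* d)))           ≈⟨ U-cong (solve 2 (λ f x → f :* (con 1 :- x) := f :+ :- con 1 :* (f :* x)) refl f (q (7 ℕ.* d))) ⟩
    U (f + - 1# * (f * q (7 ℕ.* d)))     ≈⟨ U-cong (+-congˡ (solve 1 (λ x → :- con 1 :* x := :- x) refl _)) ⟩
    U (f + - (f * q (7 ℕ.* d)))          ≈⟨ coeffwise (λ _ → Z.refl) ⟩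
    U f - U (f * q (7 ℕ.* d))            ≈⟨ +-congˡ (-‿cong (inflates-q d f)) ⟩
    U f - U f * q d                      ≈⟨ solve 2 (λ f x → f :- f :* x := f :* (con 1 :- x)) refl (U f) (q d) ⟩
    U f * (1# - q d)                     ∎

  -- Inflation is known factor by factor. The coefficient at N = 7n + 5 on the left sees only the
  -- first N factors, and since n ≤ N the partial product on the right is already exact at n.
  inflates-E : ∀ d .{{_ : NonZero d}} → Inflates (E d) (E (7 ℕ.* d))
  inflates-E d f = coeffwise λ n → let N = 7 ℕ.* n ℕ.+ 5; n≤N = ℕ.≤-trans (ℕ.m≤n*m n 7) (ℕ.m≤m+n _ 5) in
    Z.trans (at< (*-cong[] (≈⇒≈[] (refl {f})) (E≈E≤ (7 ℕ.* d) {{ℕ.m*n≢0 7 d}} N ℕ.≤-refl)) N ℕ.≤-refl)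
      (Z.trans (at (partial N f) n) (at< (*-cong[] (≈⇒≈[] (refl {U f})) (≈[]-sym (E≈E≤ d N n≤N))) n ℕ.≤-refl))
    where
    partial : ∀ N → Inflates (E≤ d N) (E≤ (7 ℕ.* d) N)
    partial zero    = inflates-1
    partial (suc N) = inflates-≈ (sym (E≤-suc d N))
      (trans (*-congˡ (+-congˡ (-‿cong (reflexive (≡.cong q (≡.sym (ℕ.*-assoc 7 d (suc N)))))))) (sym (E≤-suc (7 ℕ.* d) N)))
      (inflates-* (partial N) (inflates-factor (d ℕ.* suc N)))

  U-q⁵ : U (q 5) ≈ 1#
  U-q⁵ = coeffwise λ n → Z.reflexive (≡.trans (≡.cong (q^ 5) (ℕ.+-comm (7 ℕ.* n) 5)) (constant n))
    where
    constant : ∀ n → (q^ 0) (7 ℕ.* n) ≡ one n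
    constant zero    = ≡.refl
    constant (suc n) = ≡.refl

  -- The products of the theorem and the conclusion

  product≈ : ↑ ∏ (λ n → (1-q^ n) Defs.^ 4 Defs.* (1-q^ (2 ℕ.* n)) Defs.^ 6) ≈ E 1 ^ 4 * E 2 ^ 6
  product≈ = begin
    _ ≈⟨ ∏-cong _ (λ n → e-factor 1 n Defs.^ 4 Defs.* e-factor 2 n Defs.^ 6)
           (λ n → reflexive (≡.cong (λ m → ↑ ((1-q^ m) Defs.^ 4 Defs.* e-factor 2 (suc n) Defs.^ 6)) (≡.sym (ℕ.*-identityˡ (suc n))))) ⟩
    _ ≈⟨ ∏-* _ _ (^-convergent (e-factor 1) 4 (e-convergent 1)) (^-convergent (e-factor 2) 6 (e-convergent 2)) ⟩
    _ ≈⟨ *-cong (∏-^ (e-factor 1) (e-convergent 1) 4) (∏-^ (e-factor 2) (e-convergent 2) 6) ⟩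
    E 1 ^ 4 * E 2 ^ 6 ∎

  Δ₃≈ : ↑ Δ 3 ≈ E 2 * E 7 * (I 1 ^ 3 * I 14)
  Δ₃≈ = begin
    ↑ Δ 3
      ≈⟨ ∏-cong (Δ-factor 3) (λ n → numerator n Defs.* denominator n)
           (λ n → reflexive (≡.cong (λ m → ↑ (numerator (suc n) Defs.* (1/⟨1-q^ m ⟩ Defs.^ 3 Defs.* i-factor 14 (suc n)))) (≡.sym (ℕ.*-identityˡ (suc n))))) ⟩
    ↑ ∏ (λ n → numerator n Defs.* denominator n)
      ≈⟨ ∏-* numerator denominator
           (λ n → *-oneBelow (e-convergent 2 n) (e-convergent 7 n))
           (λ n → *-oneBelow (^-convergent (i-factor 1) 3 (i-convergent 1) n) (i-convergent 14 n)) ⟩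
    ↑ ∏ numerator * ↑ ∏ denominator
      ≈⟨ *-cong (∏-* (e-factor 2) (e-factor 7) (e-convergent 2) (e-convergent 7))
                (trans (∏-* (λ n → i-factor 1 n Defs.^ 3) (i-factor 14) (^-convergent (i-factor 1) 3 (i-convergent 1)) (i-convergent 14))
                       (*-congʳ (∏-^ (i-factor 1) (i-convergent 1) 3))) ⟩
    E 2 * E 7 * (I 1 ^ 3 * I 14) ∎
    where
    numerator denominator : ℕ → PowerSeries
    numerator n = e-factor 2 n Defs.* e-factor 7 n
    denominator n = i-factor 1 n Defs.^ 3 Defs.* i-factor 14 n

  F≈Δ₃*E : F ≈ ↑ Δ 3 * E 14
  F≈Δ₃*E = begin
    E 1 ^ 4 * E 2
      ≈⟨ solve 2 (λ x y → x :* y := x :* y :* con 1 :^ 3 :* con 1) refl (E 1 ^ 4) (E 2) ⟩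
    E 1 ^ 4 * E 2 * 1# ^ 3 * 1#
      ≈⟨ *-cong (*-congˡ (^-congˡ 3 (E-inverse 1))) (E-inverse 14) ⟨
    E 1 ^ 4 * E 2 * (E 1 * I 1) ^ 3 * (E 14 * I 14)
      ≈⟨ solve 5 (λ e₁ e₂ i₁ e₁₄ i₁₄ → e₁ :^ 4 :* e₂ :* (e₁ :* i₁) :^ 3 :* (e₁₄ :* i₁₄) :=
           e₂ :* e₁ :^ 7 :* (i₁ :^ 3 :* i₁₄) :* e₁₄) refl (E 1) (E 2) (I 1) (E 14) (I 14) ⟩
    E 2 * E 1 ^ 7 * (I 1 ^ 3 * I 14) * E 14
      ≈⟨ *-congʳ (trans (*-congʳ (*-congˡ (sym (E-frobenius 1)))) (sym Δ₃≈)) ⟩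
    ↑ Δ 3 * E 14 ∎

  -- `U` annihilates the left side of `twist⁶-F`. On the right it lets series in q⁷ pass with q⁷
  -- replaced by q, so E₁₄ comes out as E₂ and E₇ as E₁.
  U-F≈ : U (↑ Δ 3) * E 2 + E 1 ^ 4 * E 2 ^ 7 ≈ 0#
  U-F≈ = begin
    U (↑ Δ 3) * E 2 + E 1 ^ 4 * E 2 ^ 7
      ≈⟨ +-cong (trans (U-cong F≈Δ₃*E) (inflates-E 2 (↑ Δ 3)))
                (trans (inflates-^ (inflates-E 2) 7 _) (*-congʳ (trans (inflates-^ (inflates-E 1) 4 (q 5)) (trans (*-congʳ U-q⁵) (*-identityˡ _))))) ⟨
    U F + U (q 5 * E 7 ^ 4 * E 14 ^ 7)    ≈⟨ U-+ F _ ⟨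
    U (F + q 5 * E 7 ^ 4 * E 14 ^ 7)      ≈⟨ U-cong twist⁶-F ⟨
    U (twist³ (ι 2) (twist³ (ι 2) F))   ≈⟨ U-twist _ ⟩
    0#                                    ∎

  -- After division by E₂ the sum `U-F≈` says that the product is -U (↑ Δ 3), and -1 ≡ 6 is the
  -- constant of the theorem.
  product≈6*U-Δ₃ : E 1 ^ 4 * E 2 ^ 6 ≈ ι 6 * U (↑ Δ 3)
  product≈6*U-Δ₃ = begin
    E 1 ^ 4 * E 2 ^ 6
      ≈⟨ solve 2 (λ x y → x :* y := x :* y :* con 1) refl (E 1 ^ 4) (E 2 ^ 6) ⟩
    E 1 ^ 4 * E 2 ^ 6 * 1#
      ≈⟨ *-congˡ (E-inverse 2) ⟨
    E 1 ^ 4 * E 2 ^ 6 * (E 2 * I 2)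
      ≈⟨ solve 4 (λ x e i u → x :* e :^ 6 :* (e :* i) := (u :* e :+ x :* e :^ 7) :* i :+ con 6 :* u :* (e :* i)) refl
           (E 1 ^ 4) (E 2) (I 2) (U (↑ Δ 3)) ⟩
    (U (↑ Δ 3) * E 2 + E 1 ^ 4 * E 2 ^ 7) * I 2 + ι 6 * U (↑ Δ 3) * (E 2 * I 2)
      ≈⟨ +-cong (*-congʳ U-F≈) (*-congˡ (E-inverse 2)) ⟩
    0# * I 2 + ι 6 * U (↑ Δ 3) * 1#
      ≈⟨ solve 2 (λ i x → con 0 :* i :+ x :* con 1 := x) refl (I 2) (ι 6 * U (↑ Δ 3)) ⟩
    ι 6 * U (↑ Δ 3) ∎

  coefficient-congruence : ∀ n →
    ∏ (λ n → (1-q^ n) Defs.^ 4 Defs.* (1-q^ (2 ℕ.* n)) Defs.^ 6) n ≈ᶻ + 6 ℤ.* Δ 3 (7 ℕ.* n ℕ.+ 5)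
  coefficient-congruence n = Z.trans (at (trans product≈ product≈6*U-Δ₃) n) (coeff-ι 6 (U (↑ Δ 3)) n)

open import Defs
open import Data.Integer using (+_)

theorem1p1 : ∏ (λ n → (1-q^ n) ^ 4 * (1-q^ (2 ℕ.* n)) ^ 6) ≡ (+ 6) · (λ n → Δ 3 (7 ℕ.* n ℕ.+ 5)) [mod 7 ]
theorem1p1 n = Congruence.7∣- (Congruence.coefficient-congruence n)
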